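{- For every positive integer $k$, \[ c_k = \max_{f \in \mathbb{Z}_{>0},\ \pi \in \mathcal{T}_k} \frac{K(f,\pi)}{f}. \] In particular, $c_k$ is rational.
   Context: For $n\ge 2$ let $s_k=(k\ k{+}1)\in S_n$ and let $w_0=n\,(n-1)\cdots 2\,1$ be the longest permutation. Let $\mathcal{M}(k,n)$ be the maximum number of occurrences of $s_k$ in a reduced word of $w_0\in S_n$, and $c_k=\lim_{n\to\infty}\mathcal{M}(k,n)/n$ (this limit exists). Generalized wiring diagrams. A generalized wiring diagram has countably many wires labeled $1,2,3,\dots$; before any step, wire $i$ is at level $i$. It consists of a finite sequence of steps $t=1,2,\dots$; at each step either (i) the two wires at adjacent levels $h,h+1$ cross (swap levels; this is an intersection at level $h$), or (ii) the wire at some level $h$ falls (goes to infinity): it is removed, it intersects each wire below it (the intersection with the wire at level $h+j$ counts as an intersection at level $h+j-1$, $j\ge1$), and the wires formerly at levels $h+1,h+2,\dots$ move to levels $h,h+1,\dots$. The diagram is reduced if no pair of wires intersects more than once. Fix $k$. A reduced generalized wiring diagram is simple if there is no (S1) pair of wires $a<b$ intersecting (by a crossing or by a fall) at a level other than $k$ at a moment when all wires $a+1,\dots,b-1$ have already fallen, and no (S2) wire $a$ that intersects $k$ wires with larger labels (not counting intersections created when $a$ itself falls). Let $\tilde{\mathcal{W}}(k)$ denote the set of simple reduced generalized wiring diagrams (in which only finitely many wires ever occupy the first $k$ levels). For a diagram $W$ and time $t$ (after step $t$; $t=0$ is the start), if $a_1<a_2<\cdots$ are the labels of the not-yet-fallen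 wires, let $\pi^{(t)}_W$ be the permutation of $\mathbb{Z}_{>0}$ (fixing all but finitely many points) such that wire $a_{\pi^{(t)}_W(h)}$ is at level $h$; so $\pi^{(0)}_W=\mathrm{id}$. Let $\mathcal{T}_k$ be the set of all permutations $\pi^{(t)}_W$ over all $W\in\tilde{\mathcal{W}}(k)$ and all $t$. A piece $P$ is the single step of a diagram $W$ at some time $t$ together with $\pi^-_P=\pi^{(t-1)}_W$ and $\pi^+_P=\pi^{(t)}_W$; it is simple if it arises in this way from some $W\in\tilde{\mathcal{W}}(k)$. Pieces $P_1,\dots,P_r$ with $\pi^+_{P_i}=\pi^-_{P_{i+1}}$ for all $i$ can be concatenated (drawn one after another) into a pattern $Q=P_1+\cdots+P_r$ with $\pi^-_Q=\pi^-_{P_1}$, $\pi^+_Q=\pi^+_{P_r}$; $Q$ is simple if every $P_i$ is simple. For $f\in\mathbb{Z}_{>0}$ and $\pi\in\mathcal{T}_k$, $K(f,\pi)$ is the maximum number of intersections at level $k$ among all simple patterns $Q=P_1+\cdots+P_r$ such that $\pi^-_{P_1},\dots,\pi^-_{P_r}$ are pairwise distinct, $\pi^-_{P_1}=\pi^+_{P_r}=\pi$, and exactly $f$ wires fall in $Q$ (the maximum in the claim is over pairs for which such a pattern exists). -}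

module Defs where

open import Data.Nat using (ℕ; zero; suc; _+_; _*_; _∸_; _≤_; _<_; _≟_; _<?_; _≤?_; NonZero)
open import Data.Fin using (Fin)
open import Data.List using (List; []; _∷_; _++_; _∷ʳ_; length; drop; take; foldl; filter; map; upTo; reverse; concatMap)
open import Data.List.Relation.Unary.All using (All)
open import Data.List.Relation.Unary.AllPairs using (AllPairs)
open import Data.Product using (Σ; _×_; _,_; ∃)
open import Data.Unit using (⊤)
open import Data.Sum using (_⊎_)
open import Data.Empty using (⊥)
open import Relation.Nullary using (¬_; yes; no)
open import Relation.Binary.PropositionalEquality using (_≡_; _≢_; _≗_)
open import Function.Definitions using (Injective)
open import Data.Integer using (+_)
import Data.Rational as ℚ
open ℚ using (ℚ)

-- Part 1: reduced words of the longest permutation w₀ ∈ Sₙ and 𝓜(k,n).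
-- A word is a list of generator indices i (meaning s_i = (i i+1)).
-- A permutation of {1..n} is kept in one-line notation as a list;
-- right multiplication by s_i swaps positions i and i+1 (1-based).

swapAt : ℕ → List ℕ → List ℕ
swapAt (suc zero) (x ∷ y ∷ r) = y ∷ x ∷ r
swapAt (suc (suc i)) (x ∷ r) = x ∷ swapAt (suc i) r
swapAt _ l = l

wordPerm : ℕ → List ℕ → List ℕ
wordPerm n w = foldl (λ l i → swapAt i l) (map suc (upTo n)) w

IsReducedWordW0 : ℕ → List ℕ → Set
IsReducedWordW0 n w =
  All (λ i → 1 ≤ i × i < n) w
  × wordPerm n w ≡ reverse (map suc (upTo n))
  × 2 * length w ≡ n * (n ∸ 1)

occ : ℕ → List ℕ → ℕ
occ k w = length (filter (k ≟_) w)

IsM : ℕ → ℕ → ℕ → Set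
IsM k n m =
  (Σ (List ℕ) λ w → IsReducedWordW0 n w × occ k w ≡ m)
  × (∀ w → IsReducedWordW0 n w → occ k w ≤ m)

-- Part 2: generalized wiring diagrams.
-- Levels and wire labels are 1,2,3,…; a configuration is a function
-- σ : ℕ → ℕ, σ h = label of the wire at level h (σ 0 = 0 is junk).

data Step : Set where
  cross : ℕ → Step   -- wires at levels h, h+1 cross
  fall  : ℕ → Step

stepLevel : Step → ℕ
stepLevel (cross h) = h
stepLevel (fall h) = h

Diagram : Set
Diagram = List Step

applyStep : (ℕ → ℕ) → Step → (ℕ → ℕ)
applyStep σ (cross h) l with l ≟ h
... | yes _ = σ (suc h)
... | no _ with l ≟ suc h
...   | yes _ = σ h
...   | no _ = σ l
applyStep σ (fall h) l with l <? h
... | yes _ = σ l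
... | no _ = σ (suc l)

conf : Diagram → ℕ → (ℕ → ℕ)
conf W t = foldl applyStep (λ l → l) (take t W)

ValidDiagram : Diagram → Set
ValidDiagram W = All (λ s → 1 ≤ stepLevel s) W

-- IntersectDir W t a b l : at step t (t ≥ 1) wire a, and wire b directly
-- or further below it, intersect at level l.
data IntersectDir (W : Diagram) : ℕ → ℕ → ℕ → ℕ → Set where
  byCross : ∀ {t h rest a b l} → drop t W ≡ cross h ∷ rest →
            conf W t h ≡ a → conf W t (suc h) ≡ b → l ≡ h →
            IntersectDir W (suc t) a b l
  byFall  : ∀ {t h j rest a b l} → drop t W ≡ fall h ∷ rest →
            conf W t h ≡ a → conf W t (h + suc j) ≡ b → l ≡ h + j →
            IntersectDir W (suc t) a b l

Intersect : Diagram → ℕ → ℕ → ℕ → ℕ → Set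
Intersect W t a b l = IntersectDir W t a b l ⊎ IntersectDir W t b a l

FallsAt : Diagram → ℕ → ℕ → Set
FallsAt W t c = Σ ℕ λ t' → Σ ℕ λ h → Σ Diagram λ rest →
  t ≡ suc t' × drop t' W ≡ fall h ∷ rest × conf W t' h ≡ c

Reduced : Diagram → Set
Reduced W = ∀ {t t' a b l l'} → Intersect W t a b l → Intersect W t' a b l' → t ≡ t'

S1-violation : ℕ → Diagram → Set
S1-violation k W = Σ ℕ λ t → Σ ℕ λ a → Σ ℕ λ b → Σ ℕ λ l →
  a < b × Intersect W t a b l × l ≢ k ×
  (∀ c → a < c → c < b → Σ ℕ λ t' → t' < t × FallsAt W t' c)

S2-violation : ℕ → Diagram → Set
S2-violation k W = Σ ℕ λ a → Σ (Fin k → ℕ) λ g → Injective _≡_ _≡_ g ×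
  (∀ i → a < g i × Σ ℕ λ t → Σ ℕ λ l → Intersect W t a (g i) l × ¬ FallsAt W t a)

-- W ∈ 𝓦̃(k)   (diagrams are finite lists of steps, so only finitely many
-- wires ever occupy the first k levels)
SimpleDiagram : ℕ → Diagram → Set
SimpleDiagram k W = ValidDiagram W × Reduced W × ¬ S1-violation k W × ¬ S2-violation k W

fallenWires : Diagram → ℕ → List ℕ
fallenWires W t = concatMap f (upTo t)
  where
  f : ℕ → List ℕ
  f i with drop i W
  ... | fall h ∷ _ = conf W i h ∷ []
  ... | _ = []

-- π^{(t)}_W : if a₁<a₂<… are the surviving labels and the wire at level h has
-- label x = a_r, then r = x − #{fallen wires with label < x}.
perm : Diagram → ℕ → (ℕ → ℕ)
perm W t h = conf W t h ∸ length (filter (_<? conf W t h) (fallenWires W t))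

InT : ℕ → (ℕ → ℕ) → Set
InT k π = Σ Diagram λ W → SimpleDiagram k W × Σ ℕ λ t → t ≤ length W × π ≗ perm W t

record Piece : Set where
  constructor piece
  field
    step : Step
    π⁻   : ℕ → ℕ
    π⁺   : ℕ → ℕ
open Piece public

SimplePiece : ℕ → Piece → Set
SimplePiece k P = Σ Diagram λ W → SimpleDiagram k W × Σ ℕ λ t → Σ Diagram λ rest →
  drop t W ≡ step P ∷ rest × π⁻ P ≗ perm W t × π⁺ P ≗ perm W (suc t)

-- number of intersections at level k produced by a step: a crossing at level h
-- gives one iff h = k; a fall at level h gives intersections at levels h, h+1, …,
-- hence exactly one at level k iff h ≤ k.
levelKStep : ℕ → Step → ℕ
levelKStep k (cross h) with h ≟ k
... | yes _ = 1
... | no _ = 0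
levelKStep k (fall h) with h ≤? k
... | yes _ = 1
... | no _ = 0

levelK : ℕ → List Piece → ℕ
levelK k [] = 0
levelK k (P ∷ Ps) = levelKStep k (step P) + levelK k Ps

isFall : Step → ℕ
isFall (cross _) = 0
isFall (fall _) = 1

falls : List Piece → ℕ
falls [] = 0
falls (P ∷ Ps) = isFall (step P) + falls Ps

Chain : List Piece → Set
Chain [] = ⊤
Chain (P ∷ []) = ⊤
Chain (P ∷ Q ∷ Ps) = (π⁺ P ≗ π⁻ Q) × Chain (Q ∷ Ps)

AdmissiblePattern : ℕ → ℕ → (ℕ → ℕ) → List Piece → Set
AdmissiblePattern k f π Ps =
  All (SimplePiece k) Ps × Chain Ps
  × AllPairs (λ P Q → ¬ (π⁻ P ≗ π⁻ Q)) Ps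
  × (Σ Piece λ P₁ → Σ (List Piece) λ rest → Ps ≡ P₁ ∷ rest × π⁻ P₁ ≗ π)
  × (Σ (List Piece) λ ini → Σ Piece λ Pr → Ps ≡ ini ∷ʳ Pr × π⁺ Pr ≗ π)
  × falls Ps ≡ f

IsK : ℕ → ℕ → (ℕ → ℕ) → ℕ → Set
IsK k f π m =
  (Σ (List Piece) λ Ps → AdmissiblePattern k f π Ps × levelK k Ps ≡ m)
  × (∀ Ps → AdmissiblePattern k f π Ps → levelK k Ps ≤ m)

{-# OPTIONS --safe #-}

-- Reducedness, (S1) and (S2) can be read off the permutation of the surviving wires, so simple diagrams are the
-- walks from the identity in an automaton whose states are permutations. Every reachable permutation fixes all
-- levels h ≥ 2k: a wire that was overtaken has at most k smaller wires above it, and fewer than k larger ones. The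
-- automaton is therefore finite, every cycle of it has a fall, and by loop erasure a walk with F falls has at most
-- F·K/f + O(1) intersections at level k, where K/f is the best ratio of a simple cycle.
--
-- Repeating the best cycle, and letting a fall cross all remaining wires of Sₙ, gives a reduced word that
-- completes to one of w₀: this bounds 𝓜(k,n) from below. Conversely a reduced word of w₀ is followed by a walk that
-- skips the crossings forbidden by (S1) and drops a wire when it is overtaken for the k-th time, after which the
-- wire stays below level k; the walk remains below the word in the weak order, so that it never lacks a
-- crossing at level k, and at most n wires fall.

module Submission where

open import Defs
open import Data.Nat hiding (_/_; ∣_-_∣)
open import Data.Nat.Properties
open import Data.Nat.DivMod using (m≡m%n+[m/n]*n; m%n<n; m/n*n≤m)
import Data.Nat.DivMod as DivMod
open import Data.Nat.Solver using (module +-*-Solver)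
open import Data.Fin as Fin using (Fin; toℕ; fromℕ<; finToFun; funToFin)
import Data.Fin.Properties as FinP
open import Data.List using (List; []; _∷_; _++_; _∷ʳ_; length; map; concatMap; cartesianProduct; lookup;
  filter; foldl; take; drop; upTo; applyUpTo; downFrom; reverse)
open import Data.List.Properties using (length-map; length-upTo; length-++; foldl-++; take++drop≡id; filter-++;
  filter-accept; filter-reject; concatMap-++; concatMap-cong; upTo-∷ʳ; ++-identityʳ; map-upTo; reverse-upTo; reverse-map)
open import Data.List.Membership.Propositional using (_∈_; _∉_)
open import Data.List.Membership.Propositional.Properties using (∈-lookup; ∈-map⁺; ∈-concatMap⁺; ∈-cartesianProduct⁺; ∈-upTo⁺)
open import Data.List.Relation.Unary.Any as Any using (here; there)
open import Data.List.Relation.Unary.All as All using (All; []; _∷_)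
import Data.List.Relation.Unary.All.Properties as AllP
open import Data.List.Relation.Unary.AllPairs using (AllPairs; []; _∷_)
open import Data.List.Relation.Unary.Linked as Linked using (Linked; []; [-]; _∷_)
open import Data.List.Relation.Unary.Unique.Propositional using (Unique)
import Data.List.Relation.Unary.Sorted.TotalOrder.Properties as Sorted
open import Data.List.Relation.Binary.Pointwise using (Pointwise-≡⇒≡)
open import Data.List.Relation.Binary.Permutation.Propositional
  using (_↭_; ↭-refl; ↭-trans; ↭-sym; ↭-reflexive; ↭⇒↭ₛ; prep; swap)
open import Data.List.Relation.Binary.Permutation.Propositional.Properties using (All-resp-↭; ↭-reverse)
open import Data.Product using (Σ; _×_; _,_; proj₁; proj₂; ∃)
open import Data.Sum as Sum using (_⊎_; inj₁; inj₂)
open import Data.Empty using (⊥; ⊥-elim)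
open import Data.Unit using (⊤; tt)
open import Function using (_∘_; id)
open import Function.Definitions using (Injective)
import Relation.Binary.Construct.Flip.EqAndOrd as Flip
open import Relation.Binary.Definitions using (Tri; tri<; tri≈; tri>)
open import Relation.Binary.PropositionalEquality
open import Relation.Nullary using (¬_; Dec; yes; no; contradiction)
open import Relation.Nullary.Decidable using (_×-dec_; _⊎-dec_; _→-dec_; ¬?; map′; decidable-stable)

-- Counting larger values

-- The existence of the limit is part of the result: if the best cycle has K intersections at level
-- k and f falls, the two directions together give |𝓜(k,n)·f - K·n| ≤ C with C independent of n. The
-- obstacle in passing from words to walks is (S1). It can forbid a crossing that the word makes,
-- and it can forbid the very fall by which a wire should be dropped. Both are overcome by one
-- remark: two wires of consecutive ranks compare alike with every third wire. So leaving out their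
-- crossing destroys no comparison with the word, and deleting either of two such neighbours leaves
-- the same permutation. As (S1) exempts level k, no intersection that counts is lost on the way.
-- States are functions on ℕ, whose equality is undecidable. The search for the best cycle therefore
-- runs on codes in a finite set, and statements about states hold up to pointwise equality.

above : (ℕ → ℕ) → ℕ → ℕ → ℕ
above f v zero = 0
above f v (suc n) with v <? f n
... | yes _ = suc (above f v n)
... | no _ = above f v n

above-yes : ∀ f v n → v < f n → above f v (suc n) ≡ suc (above f v n)
above-yes f v n p with v <? f n
... | yes _ = refl
... | no ¬p = contradiction p ¬p

above-no : ∀ f v n → f n ≤ v → above f v (suc n) ≡ above f v n
above-no f v n p with v <? f n
... | yes q = contradiction q (≤⇒≯ p)
... | no _ = refl

above-mono : ∀ {f g v w} n → (∀ q → q < n → v < f q → w < g q) → above f v n ≤ above g w n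
above-mono zero h = z≤n
above-mono {f} {g} {v} {w} (suc n) h with v <? f n
... | yes p = ≤-trans (s≤s (above-mono n (λ q l → h q (m<n⇒m<1+n l)))) (≤-reflexive (sym (above-yes g w n (h n ≤-refl p))))
... | no _ with w <? g n
...   | yes _ = m≤n⇒m≤1+n (above-mono n (λ q l → h q (m<n⇒m<1+n l)))
...   | no _ = above-mono n (λ q l → h q (m<n⇒m<1+n l))

above-cong : ∀ {f g v w} n → (∀ q → q < n → v < f q → w < g q) → (∀ q → q < n → w < g q → v < f q) →
             above f v n ≡ above g w n
above-cong n p q = ≤-antisym (above-mono n p) (above-mono n q)

above-zero : ∀ {f v} n → (∀ q → q < n → f q ≤ v) → above f v n ≡ 0
above-zero zero h = refl
above-zero {f} {v} (suc n) h = trans (above-no f v n (h n ≤-refl)) (above-zero n (λ q l → h q (m<n⇒m<1+n l)))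

above-bound : ∀ {f v} m n → m ≤ n → (∀ q → q < m → f q ≤ v) → m + above f v n ≤ n
above-bound {f} {v} m n m≤n h = go (≤⇒≤′ m≤n)
  where
  go : ∀ {n} → m ≤′ n → m + above f v n ≤ n
  go (≤′-reflexive refl) = ≤-reflexive (trans (cong (m +_) (above-zero m h)) (+-identityʳ m))
  go (≤′-step {n = n} l) with v <? f n
  ... | yes _ = ≤-trans (≤-reflexive (+-suc m _)) (s≤s (go l))
  ... | no _ = m≤n⇒m≤1+n (go l)

above-head-yes : ∀ f v n → v < f 0 → above f v (suc n) ≡ suc (above (f ∘ suc) v n)
above-head-yes f v zero p = above-yes f v 0 p
above-head-yes f v (suc n) p with v <? f (suc n)
... | yes _ = cong suc (above-head-yes f v n p)
... | no _ = above-head-yes f v n p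

above-head-no : ∀ f v n → f 0 ≤ v → above f v (suc n) ≡ above (f ∘ suc) v n
above-head-no f v zero p = above-no f v 0 p
above-head-no f v (suc n) p with v <? f (suc n)
... | yes _ = cong suc (above-head-no f v n p)
... | no _ = above-head-no f v n p

above-step-≤ : ∀ f v n → above f v n ≤ above f v (suc n)
above-step-≤ f v n with v <? f n
... | yes _ = n≤1+n _
... | no _ = ≤-refl

above-length-mono : ∀ f v {m n} → m ≤ n → above f v m ≤ above f v n
above-length-mono f v m≤n = go (≤⇒≤′ m≤n)
  where
  go : ∀ {m n} → m ≤′ n → above f v m ≤ above f v n
  go (≤′-reflexive refl) = ≤-refl
  go (≤′-step l) = ≤-trans (go l) (above-step-≤ f v _)

above-hit-< : ∀ f v {p q} → p < q → v < f p → above f v p < above f v q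
above-hit-< f v {p} p<q l = ≤-trans (≤-reflexive (sym (above-yes f v p l))) (above-length-mono f v p<q)

-- A hit is sent to the number of hits before it.
injection⇒≤above : ∀ {m} f v n (g : Fin m → ℕ) → (∀ {i j} → g i ≡ g j → i ≡ j) →
                   (∀ i → g i < n × v < f (g i)) → m ≤ above f v n
injection⇒≤above f v n g inj hit = FinP.injective⇒≤ {f = λ i → fromℕ< (above-hit-< f v (proj₁ (hit i)) (proj₂ (hit i)))} (λ {i} {j} e → inj (go i j (trans (sym (FinP.toℕ-fromℕ< _)) (trans (cong toℕ e) (FinP.toℕ-fromℕ< _)))))
  where
  go : ∀ i j → above f v (g i) ≡ above f v (g j) → g i ≡ g j
  go i j e with <-cmp (g i) (g j)
  ... | tri< l _ _ = contradiction e (<⇒≢ (above-hit-< f v l (proj₂ (hit i))))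
  ... | tri≈ _ e' _ = e'
  ... | tri> _ _ l = contradiction (sym e) (<⇒≢ (above-hit-< f v l (proj₂ (hit j))))

nth-above : ∀ f v n i → i < above f v n → ∃ λ q → q < n × v < f q × above f v q ≡ i
nth-above f v (suc n) i i< with v <? f n
... | no _ = let (q , l , r) = nth-above f v n i i< in q , m<n⇒m<1+n l , r
... | yes p with i ≟ above f v n
...   | yes e = n , ≤-refl , p , sym e
...   | no i≢ = let (q , l , r) = nth-above f v n i (≤∧≢⇒< (≤-pred i<) i≢) in q , m<n⇒m<1+n l , r

-- Turns a count into the injective family that `S2-violation` asks for: the i-th member is the hit
-- that has exactly i hits before it.
≤above⇒injection : ∀ {m} f v n → m ≤ above f v n →
                   Σ (Fin m → ℕ) λ g → (∀ {i j} → g i ≡ g j → i ≡ j) × (∀ i → g i < n × v < f (g i))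
≤above⇒injection {m} f v n m≤ = proj₁ ∘ pick , (λ {i} {j} → inj i j) , λ i → proj₁ (proj₂ (pick i)) , proj₁ (proj₂ (proj₂ (pick i)))
  where
  pick : (i : Fin m) → ∃ λ q → q < n × v < f q × above f v q ≡ toℕ i
  pick i = nth-above f v n (toℕ i) (<-≤-trans (FinP.toℕ<n i) m≤)
  inj : ∀ i j → proj₁ (pick i) ≡ proj₁ (pick j) → i ≡ j
  inj i j e = FinP.toℕ-injective (trans (sym (proj₂ (proj₂ (proj₂ (pick i))))) (trans (cong (above f v) e) (proj₂ (proj₂ (proj₂ (pick j))))))

injection⇒≤ : ∀ m n (f : ℕ → ℕ) → (∀ i → i < m → f i < n) → (∀ i j → i < m → j < m → f i ≡ f j → i ≡ j) → m ≤ n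
injection⇒≤ m n f bd inj = FinP.injective⇒≤ {f = λ (i : Fin m) → fromℕ< (bd (toℕ i) (FinP.toℕ<n i))}
  (λ {i} {j} e → FinP.toℕ-injective (inj _ _ (FinP.toℕ<n i) (FinP.toℕ<n j)
    (trans (sym (FinP.toℕ-fromℕ< _)) (trans (cong toℕ e) (FinP.toℕ-fromℕ< _)))))

-- Steps acting on positions

-- A state π gives the rank, among the surviving wires, of the wire at each level.
State : Set
State = ℕ → ℕ

Inj : State → Set
Inj π = ∀ {p q} → π p ≡ π q → p ≡ q

cross-upper : ∀ (σ : State) h → applyStep σ (cross h) h ≡ σ (suc h)
cross-upper σ h with h ≟ h
... | yes _ = refl
... | no h≢h = contradiction refl h≢h

cross-lower : ∀ (σ : State) h → applyStep σ (cross h) (suc h) ≡ σ h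
cross-lower σ h with suc h ≟ h
... | yes e = contradiction e (1+n≢n)
... | no _ with suc h ≟ suc h
...   | yes _ = refl
...   | no ne = contradiction refl ne

cross-other : ∀ (σ : State) h {l} → l ≢ h → l ≢ suc h → applyStep σ (cross h) l ≡ σ l
cross-other σ h {l} p q with l ≟ h
... | yes e = contradiction e p
... | no _ with l ≟ suc h
...   | yes e = contradiction e q
...   | no _ = refl

fall-above : ∀ (σ : State) h {l} → l < h → applyStep σ (fall h) l ≡ σ l
fall-above σ h {l} p with l <? h
... | yes _ = refl
... | no ¬p = contradiction p ¬p

fall-below : ∀ (σ : State) h {l} → h ≤ l → applyStep σ (fall h) l ≡ σ (suc l)
fall-below σ h {l} p with l <? h
... | yes q = contradiction q (≤⇒≯ p)
... | no _ = refl

-- Every step acts on every labelling by precomposition with one map of levels, and this map is what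
-- the step makes of the identity. Questions of order and injectivity are thereby reduced to levels.
src : Step → ℕ → ℕ
src s l = applyStep id s l

applyStep-src : ∀ (σ : State) s l → applyStep σ s l ≡ σ (src s l)
applyStep-src σ (cross h) l with l ≟ h
... | yes _ = refl
... | no _ with l ≟ suc h
...   | yes _ = refl
...   | no _ = refl
applyStep-src σ (fall h) l with l <? h
... | yes _ = refl
... | no _ = refl

src-involutive : ∀ h l → src (cross h) (src (cross h) l) ≡ l
src-involutive h l with l ≟ h
... | yes refl = cross-lower id h
... | no p with l ≟ suc h
...   | yes refl = cross-upper id h
...   | no q = cross-other id h p q

src-fall≢ : ∀ h l → src (fall h) l ≢ h
src-fall≢ h l e with l <? h
... | yes p = contradiction e (<⇒≢ p)
... | no p = contradiction (sym e) (<⇒≢ (s≤s (≮⇒≥ p)))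

src-fall-< : ∀ h {l m} → l < m → src (fall h) l < src (fall h) m
src-fall-< h {l} {m} l<m with l <? h | m <? h
... | yes _ | yes _ = l<m
... | yes _ | no _ = m<n⇒m<1+n l<m
... | no p | yes q = contradiction (<-trans l<m q) p
... | no _ | no _ = s≤s l<m

src-fall-reflects-< : ∀ h {l m} → src (fall h) l < src (fall h) m → l < m
src-fall-reflects-< h {l} {m} p with <-cmp l m
... | tri< q _ _ = q
... | tri≈ _ refl _ = contradiction p (<-irrefl refl)
... | tri> _ _ q = contradiction p (<-asym (src-fall-< h q))

src-fall-surj : ∀ h {p} → p ≢ h → ∃ λ l → src (fall h) l ≡ p
src-fall-surj h {p} p≢h with <-cmp p h
... | tri< q _ _ = p , fall-above id h q
... | tri≈ _ e _ = contradiction e p≢h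
src-fall-surj h {suc p} p≢h | tri> _ _ q = p , fall-below id h (≤-pred q)

src-cross-< : ∀ h {l m} → l < m → ¬ (l ≡ h × m ≡ suc h) → src (cross h) l < src (cross h) m
src-cross-< h {l} {m} l<m ne with l ≟ h
... | yes refl with m ≟ l
...   | yes refl = contradiction l<m (<-irrefl refl)
...   | no _ with m ≟ suc l
...     | yes refl = contradiction (refl , refl) ne
...     | no q = ≤∧≢⇒< l<m (q ∘ sym)
src-cross-< h {l} {m} l<m ne | no l≢h with l ≟ suc h
... | yes refl with m ≟ h
...   | yes refl = contradiction l<m (<-asym ≤-refl)
...   | no _ with m ≟ suc h
...     | yes refl = contradiction l<m (<-irrefl refl)
...     | no q = <-trans ≤-refl l<m
src-cross-< h {l} {m} l<m ne | no l≢h | no l≢h' with m ≟ h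
... | yes refl = m<n⇒m<1+n l<m
... | no _ with m ≟ suc h
...   | yes refl = ≤∧≢⇒< (≤-pred l<m) l≢h
...   | no _ = l<m

src-injective : ∀ s {l m} → src s l ≡ src s m → l ≡ m
src-injective (cross h) {l} {m} e = trans (sym (src-involutive h l)) (trans (cong (src (cross h)) e) (src-involutive h m))
src-injective (fall h) {l} {m} e with <-cmp l m
... | tri< q _ _ = contradiction e (<⇒≢ (src-fall-< h q))
... | tri≈ _ e' _ = e'
... | tri> _ _ q = contradiction (sym e) (<⇒≢ (src-fall-< h q))

applyStep-injective : ∀ (σ : State) s → Inj σ → Inj (applyStep σ s)
applyStep-injective σ s inj {p} {q} e = src-injective s (inj (trans (sym (applyStep-src σ s p)) (trans e (applyStep-src σ s q))))

applyStep-cong : ∀ {σ τ : State} s → σ ≗ τ → applyStep σ s ≗ applyStep τ s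
applyStep-cong {σ} {τ} s e l = trans (applyStep-src σ s l) (trans (e _) (sym (applyStep-src τ s l)))

-- Removing a rank

-- Standardisation of the remaining ranks once `r` is gone. It identifies `r` with its successor,
-- whence the hypotheses `≢ r` below.
lower : ℕ → ℕ → ℕ
lower r v with r <? v
... | yes _ = pred v
... | no _ = v

lower-> : ∀ r v → r < v → lower r v ≡ pred v
lower-> r v p with r <? v
... | yes _ = refl
... | no ¬p = contradiction p ¬p

lower-≤ : ∀ r v → v ≤ r → lower r v ≡ v
lower-≤ r v p with r <? v
... | yes q = contradiction q (≤⇒≯ p)
... | no _ = refl

lower-< : ∀ r {v w} → v ≢ r → v < w → lower r v < lower r w
lower-< r {v} {w} v≢r v<w with r <? v | r <? w
lower-< r {suc v} {suc w} v≢r v<w | yes _ | yes _ = ≤-pred v<w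
... | yes p | no q = contradiction (<-trans p v<w) q
lower-< r {v} {suc w} v≢r v<w | no p | yes q = <-≤-trans (≤∧≢⇒< (≮⇒≥ p) v≢r) (≤-pred q)
... | no _ | no _ = v<w

lower-reflects-< : ∀ r {v w} → w ≢ r → lower r v < lower r w → v < w
lower-reflects-< r {v} {w} w≢r p with <-cmp v w
... | tri< q _ _ = q
... | tri≈ _ refl _ = contradiction p (<-irrefl refl)
... | tri> _ _ q = contradiction p (<-asym (lower-< r w≢r q))

lower-injective : ∀ r {v w} → v ≢ r → w ≢ r → lower r v ≡ lower r w → v ≡ w
lower-injective r {v} {w} v≢r w≢r e with <-cmp v w
... | tri< q _ _ = contradiction e (<⇒≢ (lower-< r v≢r q))
... | tri≈ _ e' _ = e'
... | tri> _ _ q = contradiction (sym e) (<⇒≢ (lower-< r w≢r q))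

-- The local automaton

next : Step → State → State
next (cross h) π = applyStep π (cross h)
next (fall h) π l = lower (π h) (applyStep π (fall h) l)

-- (S2) speaks of the past, this count of the present. They agree while the wire survives: a larger
-- wire that has passed above it cannot fall first, since the pair would then intersect twice. Level
-- 0 is among the levels counted, but it holds rank 0, which is never the larger one.
overtaken : State → ℕ → ℕ
overtaken π h = above π (π h) h

-- A pair of surviving wires has only fallen wires between its labels iff its ranks are consecutive, so
-- reducedness, (S1) and (S2) are conditions on the current state and the next step.
Ok : ℕ → State → Step → Set
Ok k π (cross h) = 1 ≤ h × π h < π (suc h) × (h ≡ k ⊎ π (suc h) ≢ suc (π h)) × suc (overtaken π h) < k
Ok k π (fall h) = 1 ≤ h × (∀ l → h < l → π h < π l) × (∀ l → h < l → π l ≡ suc (π h) → l ≡ suc k)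

Ok⇒1≤ : ∀ {k π} s → Ok k π s → 1 ≤ stepLevel s
Ok⇒1≤ (cross h) o = proj₁ o
Ok⇒1≤ (fall h) o = proj₁ o

overtaken-cong : ∀ {π ρ : State} → π ≗ ρ → ∀ h → overtaken π h ≡ overtaken ρ h
overtaken-cong {π} {ρ} e h = above-cong h (λ q _ → subst₂ _<_ (e h) (e q)) (λ q _ → subst₂ _<_ (sym (e h)) (sym (e q)))

next-cong : ∀ {π ρ : State} s → π ≗ ρ → next s π ≗ next s ρ
next-cong (cross h) e = applyStep-cong (cross h) e
next-cong (fall h) e l = cong₂ lower (e h) (applyStep-cong (fall h) e l)

Ok-cong : ∀ {k} {π ρ : State} s → π ≗ ρ → Ok k π s → Ok k ρ s
Ok-cong {k} {π} {ρ} (cross h) e (a , b , c , d) = a , subst₂ _<_ (e h) (e (suc h)) b , c' c , subst (λ z → suc z < k) (overtaken-cong e h) d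
  where
  c' : h ≡ k ⊎ π (suc h) ≢ suc (π h) → h ≡ k ⊎ ρ (suc h) ≢ suc (ρ h)
  c' (inj₁ x) = inj₁ x
  c' (inj₂ x) = inj₂ (λ z → x (trans (e (suc h)) (trans z (cong suc (sym (e h))))))
Ok-cong (fall h) e (a , b , c) = a , (λ l p → subst₂ _<_ (e h) (e l) (b l p)) , λ l p q → c l p (trans (e l) (trans q (cong suc (sym (e h)))))

run : State → List Step → State
run π [] = π
run π (s ∷ w) = run (next s π) w

data Walk (k : ℕ) : State → List Step → Set where
  [] : ∀ {π} → Walk k π []
  _∷_ : ∀ {π s w} → Ok k π s → Walk k (next s π) w → Walk k π (s ∷ w)

Walk-cong : ∀ {k} {π ρ : State} {w} → π ≗ ρ → Walk k π w → Walk k ρ w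
Walk-cong e [] = []
Walk-cong e (_∷_ {s = s} o ws) = Ok-cong s e o ∷ Walk-cong (next-cong s e) ws

run-++ : ∀ π u v → run π (u ++ v) ≡ run (run π u) v
run-++ π [] v = refl
run-++ π (s ∷ u) v = run-++ (next s π) u v

Walk-++ : ∀ {k π} {u v} → Walk k π u → Walk k (run π u) v → Walk k π (u ++ v)
Walk-++ [] ys = ys
Walk-++ (x ∷ xs) ys = x ∷ Walk-++ xs ys

Walk-++⁻ : ∀ {k π} u {v} → Walk k π (u ++ v) → Walk k π u × Walk k (run π u) v
Walk-++⁻ [] ws = [] , ws
Walk-++⁻ (s ∷ u) (o ∷ ws) with Walk-++⁻ u ws
... | a , b = o ∷ a , b

-- Invariants of reachable states

record Good (k : ℕ) (π : State) : Set where
  field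
    fix0 : π 0 ≡ 0
    inj : Inj π
    surj : ∀ v → ∃ λ p → π p ≡ v
    overtaken< : ∀ h → overtaken π h < k
    -- A wire that was overtaken has at most k smaller ranks above it, the junk level 0 included.
    low≤ : ∀ h → 0 < overtaken π h → h ≤ k + overtaken π h

Good-id : ∀ {k} → 1 ≤ k → Good k id
Good-id 1≤k = record
  { fix0 = refl ; inj = id ; surj = λ v → v , refl
  ; overtaken< = λ h → ≤-trans (s≤s (≤-reflexive (z h))) 1≤k
  ; low≤ = λ h p → contradiction (subst (0 <_) (z h) p) λ () }
  where
  z : ∀ h → overtaken id h ≡ 0
  z h = above-zero h (λ q l → <⇒≤ l)

ind : ℕ → ℕ → ℕ
ind v x with v <? x
... | yes _ = 1
... | no _ = 0

above-suc : ∀ f v n → above f v (suc n) ≡ ind v (f n) + above f v n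
above-suc f v n with v <? f n
... | yes _ = refl
... | no _ = refl

above-cross : ∀ (π : State) h v q → suc h < q → above (applyStep π (cross h)) v q ≡ above π v q
above-cross π h v q p = go (≤⇒≤′ p)
  where
  σ = applyStep π (cross h)
  base : above σ v h ≡ above π v h
  base = above-cong h (λ q l → subst (v <_) (cross-other π h (<⇒≢ l) (<⇒≢ (m<n⇒m<1+n l))))
                      (λ q l → subst (v <_) (sym (cross-other π h (<⇒≢ l) (<⇒≢ (m<n⇒m<1+n l)))))
  go : ∀ {q} → suc (suc h) ≤′ q → above σ v q ≡ above π v q
  go (≤′-reflexive refl) = begin
    above σ v (suc (suc h)) ≡⟨ above-suc σ v (suc h) ⟩
    ind v (σ (suc h)) + above σ v (suc h) ≡⟨ cong (ind v (σ (suc h)) +_) (above-suc σ v h) ⟩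
    ind v (σ (suc h)) + (ind v (σ h) + above σ v h) ≡⟨ cong₂ (λ a b → ind v a + (ind v b + above σ v h)) (cross-lower π h) (cross-upper π h) ⟩
    ind v (π h) + (ind v (π (suc h)) + above σ v h) ≡⟨ x∙yz≈y∙xz (ind v (π h)) (ind v (π (suc h))) _ ⟩
    ind v (π (suc h)) + (ind v (π h) + above σ v h) ≡⟨ cong (λ z → ind v (π (suc h)) + (ind v (π h) + z)) base ⟩
    ind v (π (suc h)) + (ind v (π h) + above π v h) ≡⟨ cong (ind v (π (suc h)) +_) (above-suc π v h) ⟨
    ind v (π (suc h)) + above π v (suc h) ≡⟨ above-suc π v (suc h) ⟨
    above π v (suc (suc h)) ∎
    where open ≡-Reasoning
          open import Algebra.Properties.CommutativeSemigroup +-commutativeSemigroup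
  go (≤′-step {n = n} l) = trans (above-suc σ v n) (trans (cong₂ (λ a b → ind v a + b) (cross-other π h (≢-sym (<⇒≢ (<-trans ≤-refl (≤′⇒≤ l)))) (≢-sym (<⇒≢ (≤′⇒≤ l)))) (go l)) (sym (above-suc π v n)))

above-fall : ∀ (π : State) h v q → h ≤ q → π h ≤ v → above (applyStep π (fall h)) v q ≡ above π v (suc q)
above-fall π h v q p hv = go (≤⇒≤′ p)
  where
  σ = applyStep π (fall h)
  go : ∀ {q} → h ≤′ q → above σ v q ≡ above π v (suc q)
  go (≤′-reflexive refl) = trans (above-cong h (λ q l → subst (v <_) (fall-above π h l)) (λ q l → subst (v <_) (sym (fall-above π h l))))
                                 (sym (above-no π v h hv))
  go (≤′-step {n = n} l) = trans (above-suc σ v n) (trans (cong₂ (λ a b → ind v a + b) (fall-below π h (≤′⇒≤ l)) (go l)) (sym (above-suc π v (suc n))))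

fall≢ : ∀ {π : State} → Inj π → ∀ h l → applyStep π (fall h) l ≢ π h
fall≢ {π} inj h l e = src-fall≢ h l (inj (trans (sym (applyStep-src π (fall h) l)) e))

next-injective : ∀ {π : State} s → Inj π → Inj (next s π)
next-injective {π} (cross h) i = applyStep-injective π (cross h) i
next-injective {π} (fall h) i {p} {q} e =
  applyStep-injective π (fall h) i (lower-injective (π h) (fall≢ i h p) (fall≢ i h q) e)

overtaken-cross-other : ∀ (π : State) h {l} → l ≢ h → l ≢ suc h → overtaken (next (cross h) π) l ≡ overtaken π l
overtaken-cross-other π h {l} a b with <-cmp l h
... | tri≈ _ e _ = contradiction e a
... | tri< l<h _ _ = trans (cong (λ z → above σ z l) (cross-other π h a b))
       (above-cong l (λ q p → subst (π l <_) (oth p)) (λ q p → subst (π l <_) (sym (oth p))))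
  where
  σ = next (cross h) π
  oth : ∀ {q} → q < l → σ q ≡ π q
  oth p = cross-other π h (<⇒≢ (<-trans p l<h)) (<⇒≢ (m<n⇒m<1+n (<-trans p l<h)))
... | tri> _ _ h<l = trans (cong (λ z → above (next (cross h) π) z l) (cross-other π h a b))
       (above-cross π h (π l) l (≤∧≢⇒< h<l (b ∘ sym)))

overtaken-cross-upper : ∀ (π : State) h → π h < π (suc h) → overtaken (next (cross h) π) h ≡ overtaken π (suc h)
overtaken-cross-upper π h x<y = trans (cong (λ z → above (next (cross h) π) z h) (cross-upper π h))
  (trans (above-cong h (λ q p → subst (π (suc h) <_) (oth p)) (λ q p → subst (π (suc h) <_) (sym (oth p))))
         (sym (above-no π (π (suc h)) h (<⇒≤ x<y))))
  where
  oth : ∀ {q} → q < h → next (cross h) π q ≡ π q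
  oth p = cross-other π h (<⇒≢ p) (<⇒≢ (m<n⇒m<1+n p))

overtaken-cross-lower : ∀ (π : State) h → π h < π (suc h) → overtaken (next (cross h) π) (suc h) ≡ suc (overtaken π h)
overtaken-cross-lower π h x<y = trans (cong (λ z → above (next (cross h) π) z (suc h)) (cross-lower π h))
  (trans (above-yes (next (cross h) π) (π h) h (subst (π h <_) (sym (cross-upper π h)) x<y))
    (cong suc (above-cong h (λ q p → subst (π h <_) (oth p)) (λ q p → subst (π h <_) (sym (oth p))))))
  where
  oth : ∀ {q} → q < h → next (cross h) π q ≡ π q
  oth p = cross-other π h (<⇒≢ p) (<⇒≢ (m<n⇒m<1+n p))

overtaken-lower : ∀ (π : State) h → Inj π → ∀ l → overtaken (next (fall h) π) l ≡ overtaken (applyStep π (fall h)) l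
overtaken-lower π h i l = above-cong l (λ q _ → lower-reflects-< (π h) (fall≢ i h q)) (λ q _ → lower-< (π h) (fall≢ i h l))

overtaken-fall-above : ∀ (π : State) h → Inj π → ∀ {l} → l < h → overtaken (next (fall h) π) l ≡ overtaken π l
overtaken-fall-above π h i {l} l<h = trans (overtaken-lower π h i l) (trans (cong (λ z → above (applyStep π (fall h)) z l) (fall-above π h l<h))
  (above-cong l (λ q p → subst (π l <_) (fall-above π h (<-trans p l<h))) (λ q p → subst (π l <_) (sym (fall-above π h (<-trans p l<h))))))

overtaken-fall-below : ∀ (π : State) h → Inj π → (∀ l → h < l → π h < π l) → ∀ {l} → h ≤ l → overtaken (next (fall h) π) l ≡ overtaken π (suc l)
overtaken-fall-below π h i low {l} h≤l = trans (overtaken-lower π h i l) (trans (cong (λ z → above (applyStep π (fall h)) z l) (fall-below π h h≤l))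
  (above-fall π h (π (suc l)) l h≤l (<⇒≤ (low (suc l) (s≤s h≤l)))))

Good-next : ∀ {k π} s → Good k π → Ok k π s → Good k (next s π)
Good-next {k} {π} (cross h) g (1≤h , x<y , adj , c<) = record
  { fix0 = trans (cross-other π h (<⇒≢ 1≤h) λ ()) fix0
  ; inj = next-injective (cross h) inj
  ; surj = λ v → let (p , e) = surj v in src (cross h) p ,
      trans (applyStep-src π (cross h) (src (cross h) p)) (trans (cong π (src-involutive h p)) e)
  ; overtaken< = c
  ; low≤ = l }
  where
  open Good g
  c : ∀ q → overtaken (next (cross h) π) q < k
  c q = go (q ≟ h) (q ≟ suc h)
    where
    go : Dec (q ≡ h) → Dec (q ≡ suc h) → overtaken (next (cross h) π) q < k
    go (yes refl) _ = subst (_< k) (sym (overtaken-cross-upper π h x<y)) (overtaken< (suc h))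
    go (no _) (yes refl) = subst (_< k) (sym (overtaken-cross-lower π h x<y)) c<
    go (no a) (no b) = subst (_< k) (sym (overtaken-cross-other π h a b)) (overtaken< q)
  -- A wire overtaken before has the old bound. Otherwise let x be its rank and h ≠ k. By (S1) the
  -- wire of rank x + 1 is not at level h + 1, and nothing above x is larger than x, so it lies
  -- deeper and has been overtaken by the wire at level h + 1. The levels 0 to h hold no rank above
  -- x + 1, so the old bound for that deeper wire leaves h + 1 ≤ k.
  few : h ≤ k + overtaken π h
  few with overtaken π h in eq
  ... | suc m = subst (λ z → h ≤ k + z) eq (low≤ h (subst (0 <_) (sym eq) z<s))
  ... | zero = ≤-trans (go adj) (m≤m+n k 0)
    where
    upper≤ : ∀ q → q ≤ h → π q ≤ π h
    upper≤ q q≤h with m≤n⇒m<n∨m≡n q≤h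
    ... | inj₂ refl = ≤-refl
    ... | inj₁ q<h with π h <? π q
    ...   | no ¬l = ≮⇒≥ ¬l
    ...   | yes l = contradiction (≤-trans (s≤s z≤n) (above-hit-< π (π h) q<h l)) (λ z → contradiction (subst (0 <_) eq z) λ ())
    go : h ≡ k ⊎ π (suc h) ≢ suc (π h) → h ≤ k
    go (inj₁ refl) = ≤-refl
    go (inj₂ na) with surj (suc (π h))
    ... | r , e = ≤-trans (n≤1+n h) (+-cancelʳ-≤ (overtaken π r) (suc h) k
                    (≤-trans (above-bound (suc h) r (<⇒≤ h+1<r) (λ q q≤h → ≤-trans (upper≤ q (≤-pred q≤h)) (≤-trans (n≤1+n _) (≤-reflexive (sym e)))))
                       (low≤ r (≤-trans (s≤s z≤n) (above-hit-< π (π r) h+1<r (subst (_< π (suc h)) (sym e) (≤∧≢⇒< x<y (na ∘ sym))))))))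
      where
      h<r : h < r
      h<r with h <? r
      ... | yes p = p
      ... | no ¬p = contradiction (subst (_≤ π h) e (upper≤ r (≮⇒≥ ¬p))) 1+n≰n
      h+1<r : suc h < r
      h+1<r = ≤∧≢⇒< h<r (λ z → na (trans (cong π z) e))
  l : ∀ q → 0 < overtaken (next (cross h) π) q → q ≤ k + overtaken (next (cross h) π) q
  l q = go (q ≟ h) (q ≟ suc h)
    where
    Low : ℕ → Set
    Low z = 0 < z → q ≤ k + z
    go : Dec (q ≡ h) → Dec (q ≡ suc h) → Low (overtaken (next (cross h) π) q)
    go (yes refl) _ = subst Low (sym (overtaken-cross-upper π h x<y)) (λ p → ≤-trans (n≤1+n h) (low≤ (suc h) p))
    go (no _) (yes refl) = subst Low (sym (overtaken-cross-lower π h x<y)) (λ _ → ≤-trans (s≤s few) (≤-reflexive (sym (+-suc k _))))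
    go (no a) (no b) = subst Low (sym (overtaken-cross-other π h a b)) (low≤ q)
Good-next {k} {π} (fall h) g (1≤h , low , _) = record
  { fix0 = trans (cong (lower (π h)) (trans (fall-above π h 1≤h) fix0)) (lower-≤ (π h) 0 z≤n)
  ; inj = next-injective (fall h) inj
  ; surj = sj
  ; overtaken< = c
  ; low≤ = l }
  where
  open Good g
  pull : ∀ v w → w ≢ π h → lower (π h) w ≡ v → ∃ λ p → next (fall h) π p ≡ v
  pull v w w≢ e with surj w
  ... | p , e' with src-fall-surj h {p} (λ z → w≢ (trans (sym e') (cong π z)))
  ...   | p' , e'' = p' , trans (cong (lower (π h)) (trans (applyStep-src π (fall h) p') (trans (cong π e'') e'))) e
  sj : ∀ v → ∃ λ p → next (fall h) π p ≡ v
  sj v with v <? π h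
  ... | yes p = pull v v (<⇒≢ p) (lower-≤ (π h) v (<⇒≤ p))
  ... | no ¬p = pull v (suc v) (≢-sym (<⇒≢ (s≤s (≮⇒≥ ¬p)))) (lower-> (π h) (suc v) (s≤s (≮⇒≥ ¬p)))
  c : ∀ q → overtaken (next (fall h) π) q < k
  c q = go (q <? h)
    where
    go : Dec (q < h) → overtaken (next (fall h) π) q < k
    go (yes p) = subst (_< k) (sym (overtaken-fall-above π h inj p)) (overtaken< q)
    go (no ¬p) = subst (_< k) (sym (overtaken-fall-below π h inj low (≮⇒≥ ¬p))) (overtaken< (suc q))
  l : ∀ q → 0 < overtaken (next (fall h) π) q → q ≤ k + overtaken (next (fall h) π) q
  l q = go (q <? h)
    where
    Low : ℕ → Set
    Low z = 0 < z → q ≤ k + z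
    go : Dec (q < h) → Low (overtaken (next (fall h) π) q)
    go (yes q<h) = subst Low (sym (overtaken-fall-above π h inj q<h)) (low≤ q)
    go (no ¬p) = subst Low (sym (overtaken-fall-below π h inj low (≮⇒≥ ¬p))) (λ p → ≤-trans (n≤1+n q) (low≤ (suc q) p))

Good-run : ∀ {k π w} → Good k π → Walk k π w → Good k (run π w)
Good-run g [] = g
Good-run g (_∷_ {s = s} o ws) = Good-run (Good-next s g o) ws

-- By overtaken< and low≤ no wire at a level h ≥ 2k was overtaken, so the ranks increase from level 2k on.
Good-fixes : ∀ {k π} → Good k π → ∀ h → k + k ≤ h → π h ≡ h
Good-fixes {k} {π} g h b = ≤-antisym le ge
  where
  open Good g
  record< : ∀ {p q} → k + k ≤ q → p < q → π p < π q
  record< {p} {q} bq p<q with <-cmp (π p) (π q)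
  ... | tri< l _ _ = l
  ... | tri≈ _ e _ = contradiction (inj e) (<⇒≢ p<q)
  ... | tri> _ _ l = contradiction (≤-trans bq (low≤ q (≤-trans (s≤s z≤n) (above-hit-< π (π q) p<q l)))) (<⇒≱ (+-monoʳ-< k (overtaken< q)))
  ge : h ≤ π h
  ge = injection⇒≤ h (π h) π (λ i p → record< b p) (λ _ _ _ _ → inj)
  le : π h ≤ h
  le = injection⇒≤ (π h) h (λ v → proj₁ (surj v)) bd (λ i j _ _ e → trans (sym (proj₂ (surj i))) (trans (cong π e) (proj₂ (surj j))))
    where
    bd : ∀ i → i < π h → proj₁ (surj i) < h
    bd i l with surj i
    ... | p , e with <-cmp p h
    ...   | tri< q _ _ = q
    ...   | tri≈ _ refl _ = contradiction e (≢-sym (<⇒≢ l))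
    ...   | tri> _ _ q = contradiction (subst (_ <_) e (record< (≤-trans b (<⇒≤ q)) q)) (<-asym l)

Good-bounded : ∀ {k π} → Good k π → ∀ h → h < k + k → π h < k + k
Good-bounded {k} {π} g h b with π h <? k + k
... | yes p = p
... | no ¬p = contradiction (Good.inj g (Good-fixes g (π h) (≮⇒≥ ¬p))) (λ e → ¬p (subst (_< k + k) (sym e) b))

-- From level 2k on the state is the identity, so a step there would make consecutive ranks
-- intersect away from level k, against (S1).
Ok-bounded : ∀ {k π} s → 1 ≤ k → Good k π → Ok k π s → stepLevel s < k + k
Ok-bounded {k} {π} (cross h) 1≤k g (_ , _ , adj , _) with h <? k + k
... | yes p = p
... | no ¬p = bad adj
  where
  b = ≮⇒≥ ¬p
  bad : _ → h < k + k
  bad (inj₁ refl) = m<m+n h 1≤k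
  bad (inj₂ na) = contradiction (trans (Good-fixes g (suc h) (m≤n⇒m≤1+n b)) (cong suc (sym (Good-fixes g h b)))) na
Ok-bounded {k} {π} (fall h) 1≤k g (_ , _ , nx) with h <? k + k
... | yes p = p
... | no ¬p = subst (_< k + k) (sym (suc-injective (nx (suc h) ≤-refl (trans (Good-fixes g (suc h) (m≤n⇒m≤1+n b)) (cong suc (sym (Good-fixes g h b))))))) (m<m+n k 1≤k)
  where
  b = ≮⇒≥ ¬p

-- A wire that is going to be deleted may first be moved down. This turns a fall into crossings when
-- a word is built, and lets a wire descend to its successor when a walk is built.
fall-after-cross : ∀ (π : State) h → next (fall (suc h)) (next (cross h) π) ≗ next (fall h) π
fall-after-cross π h l = cong₂ lower (cross-lower π h) (go (<-cmp l h))
  where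
  go : Tri (l < h) (l ≡ h) (l > h) → applyStep (applyStep π (cross h)) (fall (suc h)) l ≡ applyStep π (fall h) l
  go (tri< p _ _) = trans (fall-above (applyStep π (cross h)) (suc h) (m<n⇒m<1+n p))
    (trans (cross-other π h (<⇒≢ p) (<⇒≢ (m<n⇒m<1+n p))) (sym (fall-above π h p)))
  go (tri≈ _ refl _) = trans (fall-above (applyStep π (cross h)) (suc h) ≤-refl)
    (trans (cross-upper π h) (sym (fall-below π h ≤-refl)))
  go (tri> _ _ p) = trans (fall-below (applyStep π (cross h)) (suc h) p)
    (trans (cross-other π h (≢-sym (<⇒≢ (m<n⇒m<1+n p))) (≢-sym (<⇒≢ (s≤s p)))) (sym (fall-below π h (<⇒≤ p))))

-- Loop erasure and the best cycle ratio in a finite automaton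

tot : {S : Set} → (S → ℕ) → List S → ℕ
tot f [] = 0
tot f (s ∷ w) = f s + tot f w

tot-++ : {S : Set} (f : S → ℕ) (u v : List S) → tot f (u ++ v) ≡ tot f u + tot f v
tot-++ f [] v = refl
tot-++ f (s ∷ u) v = trans (cong (f s +_) (tot-++ f u v)) (sym (+-assoc (f s) _ _))

ratio-trans : ∀ a b c d e f → 0 < d → a * d ≤ c * b → c * f ≤ e * d → a * f ≤ e * b
ratio-trans a b c d e f 0<d p q = *-cancelʳ-≤ (a * f) (e * b) d {{>-nonZero 0<d}} (begin
  a * f * d ≡⟨ xy∙z≈xz∙y a f d ⟩
  a * d * f ≤⟨ *-monoˡ-≤ f p ⟩
  c * b * f ≡⟨ xy∙z≈xz∙y c b f ⟩
  c * f * b ≤⟨ *-monoˡ-≤ b q ⟩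
  e * d * b ≡⟨ xy∙z≈xz∙y e d b ⟩
  e * b * d ∎)
  where open ≤-Reasoning
        open import Algebra.Properties.CommutativeSemigroup *-commutativeSemigroup

maxRatio : {A : Set} {P : A → Set} (P? : ∀ x → Dec (P x)) (num den : A → ℕ) → (∀ {x} → P x → 0 < den x) →
           (xs : List A) → (∀ x → x ∈ xs → ¬ P x) ⊎
           (∃ λ x → P x × (∀ y → y ∈ xs → P y → num y * den x ≤ num x * den y))
maxRatio P? num den pos [] = inj₁ λ _ ()
maxRatio P? num den pos (x ∷ xs) with P? x | maxRatio P? num den pos xs
... | no ¬p | inj₁ none = inj₁ λ { _ (here refl) → ¬p ; y (there m) → none y m }
... | yes p | inj₁ none = inj₂ (x , p , λ { _ (here refl) _ → ≤-refl ; y (there m) py → contradiction py (none y m) })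
... | no ¬p | inj₂ (z , pz , best) = inj₂ (z , pz , λ { _ (here refl) px → contradiction px ¬p ; y (there m) → best y m })
... | yes p | inj₂ (z , pz , best) with ≤-total (num x * den z) (num z * den x)
...   | inj₁ l = inj₂ (z , pz , λ { _ (here refl) _ → l ; y (there m) → best y m })
...   | inj₂ l = inj₂ (x , p , λ { _ (here refl) _ → ≤-refl ; y (there m) py → ratio-trans (num y) (den y) (num z) (den z) (num x) (den x) (pos pz) (best y m py) l })

lookup-injective : ∀ {A : Set} {xs : List A} → Unique xs → ∀ i j → lookup xs i ≡ lookup xs j → i ≡ j
lookup-injective (_ ∷ _) Fin.zero Fin.zero e = refl
lookup-injective (x∉ ∷ _) Fin.zero (Fin.suc j) e = contradiction e (All.lookup x∉ (∈-lookup j))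
lookup-injective (x∉ ∷ _) (Fin.suc i) Fin.zero e = contradiction (sym e) (All.lookup x∉ (∈-lookup i))
lookup-injective (_ ∷ u) (Fin.suc i) (Fin.suc j) e = cong Fin.suc (lookup-injective u i j e)

Unique⇒length≤ : ∀ {n} {xs : List (Fin n)} → Unique xs → length xs ≤ n
Unique⇒length≤ u = FinP.injective⇒≤ (λ {i} {j} → lookup-injective u i j)

module Automaton {S : Set} (N : ℕ) (δ : Fin N → S → Fin N) (Ok : Fin N → S → Set)
  (ok? : ∀ c s → Dec (Ok c s)) (steps : List S) (complete : ∀ {c s} → Ok c s → s ∈ steps)
  (L F : S → ℕ) (L≤1 : ∀ s → L s ≤ 1) (c₀ : Fin N) where

  open import Data.List.Membership.DecPropositional (Fin._≟_ {N}) using (_∈?_)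
  open import Data.List.Relation.Unary.Unique.DecPropositional (Fin._≟_ {N}) using (unique?)

  runᶜ : Fin N → List S → Fin N
  runᶜ c [] = c
  runᶜ c (s ∷ w) = runᶜ (δ c s) w

  data Path : Fin N → List S → Set where
    [] : ∀ {c} → Path c []
    _∷_ : ∀ {c s w} → Ok c s → Path (δ c s) w → Path c (s ∷ w)

  path? : ∀ c w → Dec (Path c w)
  path? c [] = yes []
  path? c (s ∷ w) = map′ (λ (o , p) → o ∷ p) (λ { (o ∷ p) → o , p }) (ok? c s ×-dec path? (δ c s) w)

  Path-++ : ∀ {c} {u v} → Path c u → Path (runᶜ c u) v → Path c (u ++ v)
  Path-++ [] q = q
  Path-++ (o ∷ p) q = o ∷ Path-++ p q

  runᶜ-++ : ∀ c u v → runᶜ c (u ++ v) ≡ runᶜ (runᶜ c u) v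
  runᶜ-++ c [] v = refl
  runᶜ-++ c (s ∷ u) v = runᶜ-++ (δ c s) u v

  sources : Fin N → List S → List (Fin N)
  sources c [] = []
  sources c (s ∷ w) = c ∷ sources (δ c s) w

  length-sources : ∀ c w → length (sources c w) ≡ length w
  length-sources c [] = refl
  length-sources c (s ∷ w) = cong suc (length-sources (δ c s) w)

  sources-++ : ∀ c u v → sources c (u ++ v) ≡ sources c u ++ sources (runᶜ c u) v
  sources-++ c [] v = refl
  sources-++ c (s ∷ u) v = cong (c ∷_) (sources-++ (δ c s) u v)

  Simple : Fin N → List S → Set
  Simple c w = Unique (sources c w)

  simple⇒length≤ : ∀ {c w} → Simple c w → length w ≤ N
  simple⇒length≤ {c} {w} u = subst (_≤ N) (length-sources c w) (Unique⇒length≤ u)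

  tot-L≤length : ∀ w → tot L w ≤ length w
  tot-L≤length [] = z≤n
  tot-L≤length (s ∷ w) = +-mono-≤ (L≤1 s) (tot-L≤length w)

  Reach : Fin N → Set
  Reach c = ∃ λ u → Path c₀ u × runᶜ c₀ u ≡ c

  Reach-step : ∀ {c s} → Reach c → Ok c s → Reach (δ c s)
  Reach-step {c} {s} (u , p , refl) o = u ++ s ∷ [] , Path-++ p (o ∷ []) , runᶜ-++ c₀ u (s ∷ [])

  SimpleCycle : Fin N → List S → Set
  SimpleCycle c v = Path c v × runᶜ c v ≡ c × Simple c v

  -- Cuts a simple path at its visit to `c`. That `c` is missing from the first part is what makes a
  -- step from `c` to `d` followed by this part a simple cycle.
  split-at : ∀ c {d w} → c ∈ sources d w → Path d w → Simple d w →
             Σ (List S) λ u → Σ (List S) λ v → w ≡ u ++ v × Path d u × runᶜ d u ≡ c × c ∉ sources d u ×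
               Simple d u × Path c v × Simple c v
  split-at c {w = w@(_ ∷ _)} (here refl) p u = [] , w , refl , [] , refl , (λ ()) , [] , p , u
  split-at c {d} {s ∷ w} (there m) (o ∷ p) (d∉ ∷ uq) with split-at c m p uq
  ... | u , v , refl , pu , r , c∉ , su , pv , sv =
    s ∷ u , v , refl , o ∷ pu , r , (λ { (here refl) → All.lookup d∉ m refl ; (there m′) → c∉ m′ }) ,
    (AllP.++⁻ˡ _ (subst (All (d ≢_)) (sources-++ (δ d s) u v) d∉) ∷ su) , pv , sv

  -- If no simple cycle has ratio above a / b, then neither have all the erased loops together.
  erase : ∀ a b → (∀ {c v} → Reach c → SimpleCycle c v → tot L v * b ≤ a * tot F v) →
          ∀ {c} w → Reach c → Path c w →
          Σ (List S) λ w° → Path c w° × runᶜ c w° ≡ runᶜ c w × Simple c w° ×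
            tot L w * b + a * tot F w° ≤ tot L w° * b + a * tot F w
  erase a b H [] r [] = [] , [] , refl , [] , ≤-refl
  erase a b H {c} (s ∷ w) r (o ∷ p) with erase a b H w (Reach-step r o) p
  ... | w° , p° , e , u° , le with c ∈? sources (δ c s) w°
  ...   | no c∉ = s ∷ w° , o ∷ p° , e , AllP.¬Any⇒All¬ _ c∉ ∷ u° , (begin
            (L s + tot L w) * b + a * (F s + tot F w°) ≡⟨ cong₂ _+_ (*-distribʳ-+ b (L s) _) (*-distribˡ-+ a (F s) _) ⟩
            (L s * b + tot L w * b) + (a * F s + a * tot F w°) ≡⟨ shuffle (L s * b) (tot L w * b) _ _ ⟩
            (L s * b + a * F s) + (tot L w * b + a * tot F w°) ≤⟨ +-monoʳ-≤ (L s * b + a * F s) le ⟩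
            (L s * b + a * F s) + (tot L w° * b + a * tot F w) ≡⟨ shuffle (L s * b) (tot L w° * b) _ _ ⟨
            (L s * b + tot L w° * b) + (a * F s + a * tot F w) ≡⟨ cong₂ _+_ (*-distribʳ-+ b (L s) _) (*-distribˡ-+ a (F s) _) ⟨
            (L s + tot L w°) * b + a * (F s + tot F w) ∎)
    where
    open ≤-Reasoning
    open import Algebra.Properties.CommutativeSemigroup +-commutativeSemigroup
    shuffle : ∀ x y z t → (x + y) + (z + t) ≡ (x + z) + (y + t)
    shuffle x y z t = interchange x y z t
  -- Erasure proceeds from the end, so the tail is already simple. The new step followed by the tail
  -- up to its visit to `c` is a simple cycle, to which `H` applies; what comes after it starts at
  -- `c` and is kept.
  ...   | yes c∈ with split-at c c∈ p° u°
  ...     | u , v , refl , pu , r-u , c∉ , su , pv , sv = v , pv ,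
              trans (sym (trans (runᶜ-++ (δ c s) u v) (cong (λ z → runᶜ z v) r-u))) e , sv , +-cancelʳ-≤ (a * tot F u + tot L u * b) _ _ (begin
            ((L s + tot L w) * b + a * tot F v) + (a * tot F u + tot L u * b) ≡⟨ lem₁ (L s) (tot L w) b a (tot F v) (tot F u) (tot L u) ⟩
            (tot L w * b + a * (tot F u + tot F v)) + (L s + tot L u) * b ≤⟨ +-mono-≤ (subst₂ (λ x y → tot L w * b + a * x ≤ y * b + a * tot F w) (tot-++ F u v) (tot-++ L u v) le) (H r (o ∷ pu , r-u , AllP.¬Any⇒All¬ _ c∉ ∷ su)) ⟩
            ((tot L u + tot L v) * b + a * tot F w) + a * (F s + tot F u) ≡⟨ lem₂ (tot L u) (tot L v) b a (tot F w) (F s) (tot F u) ⟩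
            (tot L v * b + a * (F s + tot F w)) + (a * tot F u + tot L u * b) ∎)
    where
    open ≤-Reasoning
    open import Data.Nat.Solver using (module +-*-Solver)
    open +-*-Solver
    lem₁ : ∀ ls lw b a fv fu lu → ((ls + lw) * b + a * fv) + (a * fu + lu * b) ≡ (lw * b + a * (fu + fv)) + (ls + lu) * b
    lem₁ = solve 7 (λ ls lw b a fv fu lu → ((ls :+ lw) :* b :+ a :* fv) :+ (a :* fu :+ lu :* b) := (lw :* b :+ a :* (fu :+ fv)) :+ (ls :+ lu) :* b) refl
    lem₂ : ∀ lu lv b a fw fs fu → ((lu + lv) * b + a * fw) + a * (fs + fu) ≡ (lv * b + a * (fs + fw)) + (a * fu + lu * b)
    lem₂ = solve 7 (λ lu lv b a fw fs fu → ((lu :+ lv) :* b :+ a :* fw) :+ a :* (fs :+ fu) := (lv :* b :+ a :* (fs :+ fw)) :+ (a :* fu :+ lu :* b)) refl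

  words : ℕ → List (List S)
  words zero = [] ∷ []
  words (suc n) = [] ∷ concatMap (λ s → map (s ∷_) (words n)) steps

  Path⇒∈words : ∀ n {c w} → Path c w → length w ≤ n → w ∈ words n
  Path⇒∈words zero [] _ = here refl
  Path⇒∈words (suc n) [] _ = here refl
  Path⇒∈words (suc n) {w = s ∷ w} (o ∷ p) (s≤s l) =
    there (∈-concatMap⁺ (λ s → map (s ∷_) (words n)) (Any.map (λ { refl → ∈-map⁺ (s ∷_) (Path⇒∈words n p l) }) (complete o)))

  -- With both weights zero the ratio hypothesis of `erase` is void, and erasure merely shortens.
  -- Thus a finite list of words reaches every state that the search has to consider.
  Reach⇒short : ∀ {c} → Reach c → ∃ λ u → u ∈ words N × Path c₀ u × runᶜ c₀ u ≡ c
  Reach⇒short (w , p , refl) with erase 0 0 (λ {_} {v} _ _ → ≤-reflexive (*-zeroʳ (tot L v))) w ([] , [] , refl) p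
  ... | u , pu , e , s , _ = u , Path⇒∈words N pu (simple⇒length≤ s) , pu , e

  module Optimum
    (noFree : ∀ {c s v} → Reach c → Path c (s ∷ v) → runᶜ c (s ∷ v) ≡ c → 0 < tot F (s ∷ v))
    (s₀ : S) (ok₀ : Ok c₀ s₀) (loop₀ : δ c₀ s₀ ≡ c₀) where

    Candidate : List S × List S → Set
    Candidate (u , v) = Path c₀ u × SimpleCycle (runᶜ c₀ u) v × 0 < tot F v

    candidate? : ∀ x → Dec (Candidate x)
    candidate? (u , v) = path? c₀ u ×-dec (path? (runᶜ c₀ u) v ×-dec (runᶜ (runᶜ c₀ u) v Fin.≟ runᶜ c₀ u) ×-dec unique? (sources (runᶜ c₀ u) v)) ×-dec (0 <? tot F v)

    candidates : List (List S × List S)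
    candidates = cartesianProduct (words N) (words N)

    -- The loop `s₀` makes sure that there is a candidate, and `noFree` that every nonempty
    -- reachable cycle is one. Ratios are compared by cross-multiplication.
    optimum : ∃ λ u → ∃ λ v → Path c₀ u × SimpleCycle (runᶜ c₀ u) v × 0 < tot F v ×
              (∀ {c v′} → Reach c → SimpleCycle c v′ → tot L v′ * tot F v ≤ tot L v * tot F v′)
    optimum with maxRatio candidate? (tot L ∘ proj₂) (tot F ∘ proj₂) (λ p → proj₂ (proj₂ p)) candidates
    ... | inj₁ none = contradiction ([] , cyc , noFree ([] , [] , refl) (proj₁ cyc) (proj₁ (proj₂ cyc)))
                        (none ([] , s₀ ∷ []) (∈-cartesianProduct⁺ (Path⇒∈words N {c₀} [] z≤n) (Path⇒∈words N (proj₁ cyc) (simple⇒length≤ {c₀} {s₀ ∷ []} (proj₂ (proj₂ cyc))))))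
      where
      cyc : SimpleCycle c₀ (s₀ ∷ [])
      cyc = ok₀ ∷ [] , loop₀ , [] ∷ []
    ... | inj₂ ((u , v) , (pu , cv , 0<F) , best) = u , v , pu , cv , 0<F , max
      where
      max : ∀ {c v′} → Reach c → SimpleCycle c v′ → tot L v′ * tot F v ≤ tot L v * tot F v′
      max {v′ = []} r cyc = z≤n
      max {v′ = s ∷ w} r cyc with Reach⇒short r
      ... | u′ , u∈ , pu′ , refl = best (u′ , s ∷ w) (∈-cartesianProduct⁺ u∈ (Path⇒∈words N (proj₁ cyc) (simple⇒length≤ {w = s ∷ w} (proj₂ (proj₂ cyc)))))
                                     (pu′ , cyc , noFree r (proj₁ cyc) (proj₁ (proj₂ cyc)))

  -- What loop erasure leaves is simple, hence has at most `N` steps, each contributing at most one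
  -- to `L`; this is the additive term.
  bound : ∀ a b → (∀ {c v} → Reach c → SimpleCycle c v → tot L v * b ≤ a * tot F v) →
          ∀ w → Path c₀ w → tot L w * b ≤ N * b + a * tot F w
  bound a b H w p with erase a b H w ([] , [] , refl) p
  ... | w° , p° , _ , s° , le = ≤-trans (≤-trans (m≤m+n _ _) le) (+-monoˡ-≤ (a * tot F w) (*-monoˡ-≤ b (≤-trans (tot-L≤length w°) (simple⇒length≤ s°))))

-- Coding the reachable states

-- Without falls a pair of wires that has crossed never returns to its original order.
crosses-progress : ∀ {k x y} π v → x < y → Good k π → Walk k π v → tot isFall v ≡ 0 →
                   (∀ p q → π p ≡ y → π q ≡ x → p < q) →
                   ∀ p q → run π v p ≡ y → run π v q ≡ x → p < q
crosses-progress π [] x<y g [] z up = up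
crosses-progress {k} {x} {y} π (cross h ∷ v) x<y g (o ∷ ws) z up =
  crosses-progress (next (cross h) π) v x<y (Good-next (cross h) g o) ws z up′
  where
  up′ : ∀ p q → next (cross h) π p ≡ y → next (cross h) π q ≡ x → p < q
  up′ p q ep eq = subst₂ _<_ (src-involutive h p) (src-involutive h q)
    (src-cross-< h (up (src (cross h) p) (src (cross h) q) ep′ eq′)
      λ (a , b) → <-asym x<y (subst₂ _<_ (trans (cong π (sym a)) ep′) (trans (cong π (sym b)) eq′) (proj₁ (proj₂ o))))
    where
    ep′ = trans (sym (applyStep-src π (cross h) p)) ep
    eq′ = trans (sym (applyStep-src π (cross h) q)) eq

closed-walk-falls : ∀ {k} π s v → Good k π → Walk k π (s ∷ v) → run π (s ∷ v) ≗ π → 0 < tot isFall (s ∷ v)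
closed-walk-falls π (fall h) v g ws e = s≤s z≤n
closed-walk-falls {k} π (cross h) v g (o ∷ ws) e with tot isFall v in z
... | suc _ = s≤s z≤n
... | zero = contradiction (crosses-progress (next (cross h) π) v x<y (Good-next (cross h) g o) ws z up (suc h) h (e (suc h)) (e h)) (<-asym ≤-refl)
  where
  x<y = proj₁ (proj₂ o)
  i = next-injective (cross h) (Good.inj g)
  up : ∀ p q → next (cross h) π p ≡ π (suc h) → next (cross h) π q ≡ π h → p < q
  up p q ep eq = subst₂ _<_ (i (trans (cross-upper π h) (sym ep))) (i (trans (cross-lower π h) (sym eq))) ≤-refl

states : State → List Step → List State
states π [] = []
states π (s ∷ w) = π ∷ states (next s π) w

Distinct : List State → Set
Distinct = AllPairs (λ π ρ → ¬ (π ≗ ρ))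

ClosedDistinct : ℕ → State → List Step → Set
ClosedDistinct k π v = Walk k π v × run π v ≗ π × Distinct (states π v)

record OptimalCycle (k N : ℕ) : Set where
  field
    u v : List Step
    walk-u : Walk k id u
    cycle-v : ClosedDistinct k (run id u) v
    falls>0 : 0 < tot isFall v
    best : ∀ {u′ v′} → Walk k id u′ → ClosedDistinct k (run id u′) v′ →
           tot (levelKStep k) v′ * tot isFall v ≤ tot (levelKStep k) v * tot isFall v′
    bounded : ∀ {w} → Walk k id w →
           tot (levelKStep k) w * tot isFall v ≤ N * tot isFall v + tot (levelKStep k) v * tot isFall w

module Coding (k : ℕ) (1≤k : 1 ≤ k) where

  B : ℕ
  B = k + k

  -- A reachable state maps the levels below `B` to themselves and fixes the others; `N` counts the
  -- self-maps of a set with `B` elements.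
  N : ℕ
  N = B ^ B

  -- The index serves as default because it is the element of `Fin B` at hand. For reachable states
  -- the default never occurs, by `Good-bounded`.
  clamp : Fin B → ℕ → Fin B
  clamp i x with x <? B
  ... | yes p = fromℕ< p
  ... | no _ = i

  toℕ-clamp : ∀ i {x} → x < B → toℕ (clamp i x) ≡ x
  toℕ-clamp i {x} l with x <? B
  ... | yes p = FinP.toℕ-fromℕ< p
  ... | no ¬p = contradiction l ¬p

  code : State → Fin N
  code π = funToFin (λ i → clamp i (π (toℕ i)))

  decode : Fin N → State
  decode c h with h <? B
  ... | yes p = toℕ (finToFun {B} {B} c (fromℕ< p))
  ... | no _ = h

  decode-≥ : ∀ c {h} → B ≤ h → decode c h ≡ h
  decode-≥ c {h} l with h <? B
  ... | yes p = contradiction p (≤⇒≯ l)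
  ... | no _ = refl

  decode-< : ∀ c {h} → h < B → decode c h < B
  decode-< c {h} l with h <? B
  ... | yes p = FinP.toℕ<n _
  ... | no ¬p = contradiction l ¬p

  decode-code : ∀ {π} → Good k π → decode (code π) ≗ π
  decode-code {π} g h with h <? B
  ... | yes p = trans (cong toℕ (FinP.finToFun-funToFin (λ i → clamp i (π (toℕ i))) (fromℕ< p)))
                  (trans (toℕ-clamp _ (Good-bounded g _ (FinP.toℕ<n _))) (cong π (FinP.toℕ-fromℕ< p)))
  ... | no ¬p = sym (Good-fixes g h (≮⇒≥ ¬p))

  funToFin-cong : ∀ {m n} {f g : Fin m → Fin n} → f ≗ g → funToFin f ≡ funToFin g
  funToFin-cong {zero} e = refl
  funToFin-cong {suc m} e = cong₂ Fin.combine (e Fin.zero) (funToFin-cong (e ∘ Fin.suc))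

  code-cong : ∀ {π ρ} → π ≗ ρ → code π ≡ code ρ
  code-cong e = funToFin-cong (λ i → cong (clamp i) (e (toℕ i)))

  δ : Fin N → Step → Fin N
  δ c s = code (next s (decode c))

  -- An arbitrary code need not represent a reachable state, so the bound on the level is built in;
  -- it keeps the list of steps finite. On reachable states `Ok-bounded` shows that nothing is lost.
  OkB : Fin N → Step → Set
  OkB c s = stepLevel s < B × Ok k (decode c) s

  okB? : ∀ c s → Dec (OkB c s)
  okB? c (cross h) = h <? B ×-dec (1 ≤? h ×-dec (π h <? π (suc h)) ×-dec ((h ≟ k) ⊎-dec ¬? (π (suc h) ≟ suc (π h))) ×-dec (suc (overtaken π h) <? k))
    where π = decode c
  okB? c (fall h) = go (h <? B)
    where
    π = decode c
    go : Dec (h < B) → Dec (OkB c (fall h))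
    go (no ¬p) = no (¬p ∘ proj₁)
    go (yes h<B) = map′ to (λ (_ , a , b , d) → a , (λ {l} _ → b l) , (λ {l} _ → d l))
         (1 ≤? h ×-dec allUpTo? (λ l → (h <? l) →-dec (π h <? π l)) (suc B)
                 ×-dec allUpTo? (λ l → (h <? l) →-dec (π l ≟ suc (π h)) →-dec (l ≟ suc k)) (suc B))
      where
      extend-< : (∀ {l} → l < suc B → h < l → π h < π l) → ∀ l → h < l → π h < π l
      extend-< f l h<l with l <? suc B
      ... | yes p = f p h<l
      ... | no ¬p = <-≤-trans (decode-< c h<B) (≤-trans (<⇒≤ (≮⇒≥ ¬p)) (≤-reflexive (sym (decode-≥ c (<⇒≤ (≮⇒≥ ¬p))))))
      -- Levels beyond `B` hold ranks beyond `B`, while `suc (π h)` is at most `B`. Level `B` itself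
      -- can hold the successor, so the range that is searched must include it.
      extend-≡ : (∀ {l} → l < suc B → h < l → π l ≡ suc (π h) → l ≡ suc k) → ∀ l → h < l → π l ≡ suc (π h) → l ≡ suc k
      extend-≡ f l h<l e with l <? suc B
      ... | yes p = f p h<l e
      ... | no ¬p = contradiction (trans (sym (decode-≥ c (<⇒≤ (≮⇒≥ ¬p)))) e) (≢-sym (<⇒≢ (≤-trans (s≤s (decode-< c h<B)) (≮⇒≥ ¬p))))
      to : 1 ≤ h × (∀ {l} → l < suc B → h < l → π h < π l) × (∀ {l} → l < suc B → h < l → π l ≡ suc (π h) → l ≡ suc k) → OkB c (fall h)
      to (a , b , d) = h<B , a , extend-< b , extend-≡ d

  allSteps : List Step
  allSteps = concatMap (λ h → cross h ∷ fall h ∷ []) (upTo B)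

  ∈allSteps : ∀ {c s} → OkB c s → s ∈ allSteps
  ∈allSteps {s = cross h} (l , _) = ∈-concatMap⁺ (λ h → cross h ∷ fall h ∷ []) (Any.map (λ { refl → here refl }) (∈-upTo⁺ l))
  ∈allSteps {s = fall h} (l , _) = ∈-concatMap⁺ (λ h → cross h ∷ fall h ∷ []) (Any.map (λ { refl → there (here refl) }) (∈-upTo⁺ l))

  levelKStep≤1 : ∀ s → levelKStep k s ≤ 1
  levelKStep≤1 (cross h) with h ≟ k
  ... | yes _ = ≤-refl
  ... | no _ = z≤n
  levelKStep≤1 (fall h) with h ≤? k
  ... | yes _ = ≤-refl
  ... | no _ = z≤n

  open Automaton N δ OkB okB? allSteps (λ {c} {s} → ∈allSteps {c} {s}) (levelKStep k) isFall levelKStep≤1 (code id)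

  Rep : Fin N → State → Set
  Rep c π = decode c ≗ π

  Rep-next : ∀ {c π} s → Good k π → Rep c π → Ok k π s → Rep (δ c s) (next s π)
  Rep-next {c} {π} s g r o l = trans (cong (λ z → decode z l) (code-cong (next-cong s r))) (decode-code (Good-next s g o) l)

  walk⇒path : ∀ {c π w} → Good k π → Rep c π → Walk k π w → Path c w × Rep (runᶜ c w) (run π w)
  walk⇒path g r [] = [] , r
  walk⇒path g r (_∷_ {s = s} o ws) with walk⇒path (Good-next s g o) (Rep-next s g r o) ws
  ... | p , r′ = ((Ok-bounded s 1≤k g o) , Ok-cong s (sym ∘ r) o) ∷ p , r′

  path⇒walk : ∀ {c π w} → Good k π → Rep c π → Path c w → Walk k π w × Rep (runᶜ c w) (run π w)
  path⇒walk g r [] = [] , r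
  path⇒walk g r (_∷_ {s = s} (_ , o′) p) with path⇒walk (Good-next s g o) (Rep-next s g r o) p
    where o = Ok-cong s r o′
  ... | ws , r′ = Ok-cong s r o′ ∷ ws , r′

  Rep-id : Rep (code id) id
  Rep-id = decode-code (Good-id 1≤k)

  -- Between such codes pointwise equality of the decoded states is equality of codes. This
  -- translates `Simple` into `Distinct`, and a walk that closes up pointwise into a cycle of the
  -- finite automaton.
  Coded : Fin N → Set
  Coded c = code (decode c) ≡ c

  Coded-code : ∀ {π} → Good k π → Coded (code π)
  Coded-code g = code-cong (decode-code g)

  Good-cong : ∀ {π ρ} → π ≗ ρ → Good k π → Good k ρ
  Good-cong {π} {ρ} e g = record
    { fix0 = trans (sym (e 0)) fix0
    ; inj = λ {p} {q} z → inj (trans (e p) (trans z (sym (e q))))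
    ; surj = λ v → let (p , z) = surj v in p , trans (sym (e p)) z
    ; overtaken< = λ h → subst (_< k) (overtaken-cong e h) (overtaken< h)
    ; low≤ = λ h → subst (λ z → 0 < z → h ≤ k + z) (overtaken-cong e h) (low≤ h) }
    where open Good g

  Coded-δ : ∀ {c} s → Good k (decode c) → Ok k (decode c) s → Coded (δ c s)
  Coded-δ s g o = Coded-code (Good-next s g o)

  sources-states : ∀ {c π w} → Good k π → Rep c π → Coded c → Walk k π w → Simple c w → Distinct (states π w)
  sources-states g r d [] u = []
  sources-states {c} {π} g r d (_∷_ {s = s} o ws) (c∉ ∷ u) = all (Good-next s g o) (Rep-next s g r o) cd ws c∉ ∷ sources-states (Good-next s g o) (Rep-next s g r o) cd ws u
    where
    cd = Coded-δ s (Good-cong (sym ∘ r) g) (Ok-cong s (sym ∘ r) o)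
    all : ∀ {c′ ρ v} → Good k ρ → Rep c′ ρ → Coded c′ → Walk k ρ v → All (c ≢_) (sources c′ v) → All (λ σ → ¬ (π ≗ σ)) (states ρ v)
    all g′ r′ d′ [] [] = []
    all {c′} {ρ} g′ r′ d′ (_∷_ {s = s} o ws) (n ∷ ns) = (λ e → n (trans (sym d) (trans (code-cong (λ l → trans (r l) (trans (e l) (sym (r′ l))))) d′)))
      ∷ all (Good-next s g′ o) (Rep-next s g′ r′ o) (Coded-δ s (Good-cong (sym ∘ r′) g′) (Ok-cong s (sym ∘ r′) o)) ws ns

  states-sources : ∀ {c π w} → Good k π → Rep c π → Walk k π w → Distinct (states π w) → Simple c w
  states-sources g r [] u = []
  states-sources {c} {π} g r (_∷_ {s = s} o ws) (π∉ ∷ u) = all (Good-next s g o) (Rep-next s g r o) ws π∉ ∷ states-sources (Good-next s g o) (Rep-next s g r o) ws u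
    where
    all : ∀ {c′ ρ v} → Good k ρ → Rep c′ ρ → Walk k ρ v → All (λ σ → ¬ (π ≗ σ)) (states ρ v) → All (c ≢_) (sources c′ v)
    all g′ r′ [] [] = []
    all g′ r′ (_∷_ {s = s} o ws) (n ∷ ns) = (λ { refl → n (λ l → trans (sym (r l)) (r′ l)) }) ∷ all (Good-next s g′ o) (Rep-next s g′ r′ o) ws ns

  Good-walk : ∀ {w} → Walk k id w → Good k (run id w)
  Good-walk = Good-run (Good-id 1≤k)

  Coded-run : ∀ {c w} → Coded c → Good k (decode c) → Path c w → Coded (runᶜ c w)
  Coded-run d g [] = d
  Coded-run d g (_∷_ {s = s} o p) = Coded-run (Coded-δ s g (proj₂ o)) (Good-cong (sym ∘ decode-code (Good-next s g (proj₂ o))) (Good-next s g (proj₂ o))) p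

  closed⇒cycle : ∀ {c π v} → Good k π → Rep c π → Coded c → ClosedDistinct k π v → SimpleCycle c v
  closed⇒cycle {c} {π} {v} g r d (ws , e , u) with walk⇒path g r ws
  ... | p , r′ = p , trans (sym (Coded-run d (Good-cong (sym ∘ r) g) p)) (trans (code-cong (λ l → trans (r′ l) (trans (e l) (sym (r l))))) d) , states-sources g r ws u

  cycle⇒closed : ∀ {c π v} → Good k π → Rep c π → Coded c → SimpleCycle c v → ClosedDistinct k π v
  cycle⇒closed {c} {π} {v} g r d (p , e , u) with path⇒walk g r p
  ... | ws , r′ = ws , (λ l → trans (sym (r′ l)) (trans (cong (λ z → decode z l) e) (r l))) , sources-states g r d ws u

  Coded-id : Coded (code id)
  Coded-id = Coded-code (Good-id 1≤k)

  Good-decode-id : Good k (decode (code id))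
  Good-decode-id = Good-cong (sym ∘ Rep-id) (Good-id 1≤k)

  reach-good : ∀ {c} → Reach c → Good k (decode c) × Coded c
  reach-good (u , p , refl) with path⇒walk (Good-id 1≤k) Rep-id p
  ... | ws , r = Good-cong (sym ∘ r) (Good-walk ws) , Coded-run Coded-id Good-decode-id p

  noFree : ∀ {c s v} → Reach c → Path c (s ∷ v) → runᶜ c (s ∷ v) ≡ c → 0 < tot isFall (s ∷ v)
  noFree {c} {s} {v} r p e with reach-good r
  ... | g , d with path⇒walk g (λ _ → refl) p
  ...   | ws , r′ = closed-walk-falls (decode c) s v g ws (λ l → trans (sym (r′ l)) (cong (λ z → decode z l) e))

  -- The wire at level k meets its successor exactly at level k, where (S1) is silent, and the
  -- survivors are again in order. This is the cycle of length one that starts the search.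
  Ok-fall-k : Ok k id (fall k)
  Ok-fall-k = 1≤k , (λ l p → p) , λ l p e → e

  next-fall-k : next (fall k) id ≗ id
  next-fall-k l with l <? k
  ... | yes p = lower-≤ k l (<⇒≤ p)
  ... | no ¬p = lower-> k (suc l) (s≤s (≮⇒≥ ¬p))

  open Optimum noFree (fall k) (m<m+n k 1≤k , Ok-cong (fall k) (sym ∘ Rep-id) Ok-fall-k)
    (code-cong (λ l → trans (next-cong (fall k) Rep-id l) (next-fall-k l)))

  optimalCycle : OptimalCycle k N
  optimalCycle with optimum
  ... | u , v , pu , cyc , f , mx with path⇒walk (Good-id 1≤k) Rep-id pu
  ... | wu , r = record
    { u = u ; v = v ; walk-u = wu
    ; cycle-v = cycle⇒closed (Good-walk wu) r (Coded-run Coded-id Good-decode-id pu) cyc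
    ; falls>0 = f
    ; best = λ {u′} {v′} wu′ cl → let (pu′ , r′) = walk⇒path (Good-id 1≤k) Rep-id wu′ in
        mx {runᶜ (code id) u′} {v′} (u′ , pu′ , refl) (closed⇒cycle (Good-walk wu′) r′ (Coded-run Coded-id Good-decode-id pu′) cl)
    ; bounded = λ {w} ws → bound (tot (levelKStep k) v) (tot isFall v) mx w (proj₁ (walk⇒path (Good-id 1≤k) Rep-id ws)) }

-- Diagrams as walks

take-snoc : ∀ {A : Set} (W : List A) t {s rest} → drop t W ≡ s ∷ rest → take (suc t) W ≡ take t W ++ s ∷ []
take-snoc (x ∷ W) zero refl = refl
take-snoc (x ∷ W) (suc t) e = cong (x ∷_) (take-snoc W t e)

take-end : ∀ {A : Set} (W : List A) t → drop t W ≡ [] → take (suc t) W ≡ take t W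
take-end [] zero e = refl
take-end [] (suc t) e = refl
take-end (x ∷ W) (suc t) e = cong (x ∷_) (take-end W t e)

stateAt : Diagram → ℕ → State
stateAt W t = run id (take t W)

conf-step : ∀ W t {s rest} → drop t W ≡ s ∷ rest → conf W (suc t) ≡ applyStep (conf W t) s
conf-step W t {s} e = trans (cong (foldl applyStep (λ l → l)) (take-snoc W t e)) (foldl-++ applyStep (λ l → l) (take t W) (s ∷ []))

conf-end : ∀ W t → drop t W ≡ [] → conf W (suc t) ≡ conf W t
conf-end W t e = cong (foldl applyStep (λ l → l)) (take-end W t e)

stateAt-step : ∀ W t {s rest} → drop t W ≡ s ∷ rest → stateAt W (suc t) ≡ next s (stateAt W t)
stateAt-step W t {s} e = trans (cong (run id) (take-snoc W t e)) (run-++ id (take t W) (s ∷ []))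

stateAt-end : ∀ W t → drop t W ≡ [] → stateAt W (suc t) ≡ stateAt W t
stateAt-end W t e = cong (run id) (take-end W t e)

by-steps : (W : Diagram) (P : ℕ → Set) → P 0 → (∀ t → drop t W ≡ [] → P t → P (suc t)) →
           (∀ t s rest → drop t W ≡ s ∷ rest → P t → P (suc t)) → ∀ t → P t
by-steps W P z e i zero = z
by-steps W P z e i (suc t) with drop t W in eq
... | [] = e t eq (by-steps W P z e i t)
... | s ∷ rest = i t s rest eq (by-steps W P z e i t)

drop-valid : ∀ W t {s rest} → ValidDiagram W → drop t W ≡ s ∷ rest → 1 ≤ stepLevel s
drop-valid W t v e = All.head (subst (All _) e (AllP.drop⁺ t v))

conf-injective : ∀ W t → Inj (conf W t)
conf-injective W = by-steps W (λ t → Inj (conf W t)) id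
  (λ t e i → subst Inj (sym (conf-end W t e)) i)
  (λ t s _ e i → subst Inj (sym (conf-step W t e)) (λ {p} {q} → applyStep-injective (conf W t) s i {p} {q}))

stateAt-injective : ∀ W t → Inj (stateAt W t)
stateAt-injective W = by-steps W (λ t → Inj (stateAt W t)) id
  (λ t e i → subst Inj (sym (stateAt-end W t e)) i)
  (λ t s _ e i → subst Inj (sym (stateAt-step W t e)) (λ {p} {q} → next-injective s i {p} {q}))

fallenAt : Diagram → ℕ → List ℕ
fallenAt W i with drop i W
... | fall h ∷ _ = conf W i h ∷ []
... | _ = []

-- fallenWires uses a nameless local function, which the underscore stands for.
fallenWires≡ : ∀ W t → fallenWires W t ≡ concatMap (fallenAt W) (upTo t)
fallenWires-pointwise : ∀ W t i → _ ≡ fallenAt W i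
fallenWires≡ W t = concatMap-cong (fallenWires-pointwise W t) (upTo t)
fallenWires-pointwise W t i with drop i W
... | [] = refl
... | cross h ∷ _ = refl
... | fall h ∷ _ = refl

fallen : Diagram → ℕ → List ℕ
fallen W t = concatMap (fallenAt W) (upTo t)

fallen-suc : ∀ W t → fallen W (suc t) ≡ fallen W t ++ fallenAt W t
fallen-suc W t = trans (cong (concatMap (fallenAt W)) (sym (upTo-∷ʳ t)))
  (trans (concatMap-++ (fallenAt W) (upTo t) (t ∷ [])) (cong (fallen W t ++_) (++-identityʳ _)))

smaller : ℕ → List ℕ → ℕ
smaller x l = length (filter (_<? x) l)

smaller-++ : ∀ x l m → smaller x (l ++ m) ≡ smaller x l + smaller x m
smaller-++ x l m = trans (cong length (filter-++ (_<? x) l m)) (length-++ (filter (_<? x) l))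

smaller-yes : ∀ {x y} → y < x → smaller x (y ∷ []) ≡ 1
smaller-yes {x} p = cong length (filter-accept (_<? x) p)

smaller-no : ∀ {x y} → x ≤ y → smaller x (y ∷ []) ≡ 0
smaller-no {x} p = cong length (filter-reject (_<? x) (≤⇒≯ p))

-- survivor r is the r-th smallest surviving label, with survivor 0 = 0.
record Survivors (W : Diagram) (t : ℕ) : Set where
  field
    survivor : ℕ → ℕ
    mono : ∀ {i j} → i < j → survivor i < survivor j
    conf≗ : ∀ l → conf W t l ≡ survivor (stateAt W t l)
    rank : ∀ i → survivor i ≡ i + smaller (survivor i) (fallen W t)
    cover : ∀ c → (∃ λ i → survivor i ≡ c) ⊎ (∃ λ t′ → t′ ≤ t × FallsAt W t′ c)
    fresh : ∀ {t′ c} → t′ ≤ t → FallsAt W t′ c → ∀ i → survivor i ≢ c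

  reflects : ∀ {i j} → survivor i < survivor j → i < j
  reflects {i} {j} p with <-cmp i j
  ... | tri< q _ _ = q
  ... | tri≈ _ refl _ = contradiction p (<-irrefl refl)
  ... | tri> _ _ q = contradiction p (<-asym (mono q))

  conf-< : ∀ {p q} → stateAt W t p < stateAt W t q → conf W t p < conf W t q
  conf-< {p} {q} l = subst₂ _<_ (sym (conf≗ p)) (sym (conf≗ q)) (mono l)

  stateAt-< : ∀ {p q} → conf W t p < conf W t q → stateAt W t p < stateAt W t q
  stateAt-< {p} {q} l = reflects (subst₂ _<_ (conf≗ p) (conf≗ q) l)

fallsAt-now : ∀ {W t s rest c} → drop t W ≡ s ∷ rest → FallsAt W (suc t) c → ∃ λ h → s ≡ fall h × conf W t h ≡ c
fallsAt-now e (_ , h , _ , refl , e′ , c) with trans (sym e) e′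
... | refl = h , refl , c

survivors : ∀ W → ValidDiagram W → ∀ t → Survivors W t
survivors W v = by-steps W (Survivors W) start end advance
  where
  later : ∀ {t c} → (∃ λ t′ → t′ ≤ t × FallsAt W t′ c) → ∃ λ t′ → t′ ≤ suc t × FallsAt W t′ c
  later (t′ , l , f) = t′ , m≤n⇒m≤1+n l , f
  start : Survivors W 0
  start = record
    { survivor = id ; mono = id ; conf≗ = λ l → refl ; rank = λ i → sym (+-identityʳ i)
    ; cover = λ c → inj₁ (c , refl) ; fresh = λ { z≤n (_ , _ , _ , () , _) } }
  end : ∀ t → drop t W ≡ [] → Survivors W t → Survivors W (suc t)
  end t e s = record
    { survivor = survivor ; mono = mono
    ; conf≗ = λ l → trans (cong (λ f → f l) (conf-end W t e)) (trans (conf≗ l) (cong (λ f → survivor (f l)) (sym (stateAt-end W t e))))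
    ; rank = λ i → trans (rank i) (cong (λ z → i + smaller (survivor i) z) (sym same))
    ; cover = λ c → Sum.map₂ later (cover c)
    ; fresh = fr }
    where
    open Survivors s
    none : fallenAt W t ≡ []
    none rewrite e = refl
    same : fallen W (suc t) ≡ fallen W t
    same = trans (fallen-suc W t) (trans (cong (fallen W t ++_) none) (++-identityʳ _))
    fr : ∀ {t′ c} → t′ ≤ suc t → FallsAt W t′ c → ∀ i → survivor i ≢ c
    fr {t′} l f with m≤n⇒m<n∨m≡n l
    ... | inj₁ l′ = fresh (≤-pred l′) f
    fr l (_ , _ , _ , refl , e′ , _) | inj₂ refl = contradiction (trans (sym e) e′) λ ()
  advance : ∀ t s rest → drop t W ≡ s ∷ rest → Survivors W t → Survivors W (suc t)
  advance t (cross h) rest e s = record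
    { survivor = survivor ; mono = mono
    ; conf≗ = λ l → trans (cong (λ f → f l) (conf-step W t e)) (trans (applyStep-src (conf W t) (cross h) l)
        (trans (conf≗ _) (cong survivor (sym (trans (cong (λ f → f l) (stateAt-step W t e)) (applyStep-src (stateAt W t) (cross h) l))))))
    ; rank = λ i → trans (rank i) (cong (λ z → i + smaller (survivor i) z) (sym same))
    ; cover = λ c → Sum.map₂ later (cover c)
    ; fresh = fr }
    where
    open Survivors s
    none : fallenAt W t ≡ []
    none rewrite e = refl
    same : fallen W (suc t) ≡ fallen W t
    same = trans (fallen-suc W t) (trans (cong (fallen W t ++_) none) (++-identityʳ _))
    fr : ∀ {t′ c} → t′ ≤ suc t → FallsAt W t′ c → ∀ i → survivor i ≢ c
    fr {t′} l f with m≤n⇒m<n∨m≡n l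
    ... | inj₁ l′ = fresh (≤-pred l′) f
    fr l f | inj₂ refl = contradiction (proj₁ (proj₂ (fallsAt-now e f))) λ ()
  advance t (fall h) rest e s = record
    { survivor = e′
    ; mono = mono′
    ; conf≗ = cf
    ; rank = rank′
    ; cover = cover′
    ; fresh = fr }
    where
    open Survivors s
    π = stateAt W t
    r = π h
    e′ : ℕ → ℕ
    -- Deleting the r-th term of the enumeration is the same shift as a fall at level `r`.
    e′ = applyStep survivor (fall r)
    e′-src : ∀ i → e′ i ≡ survivor (src (fall r) i)
    e′-src = applyStep-src survivor (fall r)
    mono′ : ∀ {i j} → i < j → e′ i < e′ j
    mono′ {i} {j} l = subst₂ _<_ (sym (e′-src i)) (sym (e′-src j)) (mono (src-fall-< r l))
    e′-lower : ∀ v → v ≢ r → e′ (lower r v) ≡ survivor v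
    e′-lower v v≢r with <-cmp v r
    ... | tri< l _ _ = trans (cong e′ (lower-≤ r v (<⇒≤ l))) (fall-above survivor r l)
    ... | tri≈ _ z _ = contradiction z v≢r
    e′-lower (suc v) v≢r | tri> _ _ l = trans (cong e′ (lower-> r (suc v) l)) (fall-below survivor r (≤-pred l))
    cf : ∀ l → conf W (suc t) l ≡ e′ (stateAt W (suc t) l)
    cf l = begin
      conf W (suc t) l ≡⟨ cong (λ f → f l) (conf-step W t e) ⟩
      applyStep (conf W t) (fall h) l ≡⟨ applyStep-src (conf W t) (fall h) l ⟩
      conf W t (src (fall h) l) ≡⟨ conf≗ _ ⟩
      survivor (π (src (fall h) l)) ≡⟨ e′-lower _ (λ z → src-fall≢ h l (stateAt-injective W t z)) ⟨
      e′ (lower r (π (src (fall h) l))) ≡⟨ cong (λ z → e′ (lower r z)) (applyStep-src π (fall h) l) ⟨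
      e′ (next (fall h) π l) ≡⟨ cong (λ f → e′ (f l)) (stateAt-step W t e) ⟨
      e′ (stateAt W (suc t) l) ∎
      where open ≡-Reasoning
    x = conf W t h
    now : fallenAt W t ≡ x ∷ []
    now rewrite e = refl
    count-suc : ∀ y → smaller y (fallen W (suc t)) ≡ smaller y (fallen W t) + smaller y (x ∷ [])
    count-suc y = trans (cong (smaller y) (trans (fallen-suc W t) (cong (fallen W t ++_) now))) (smaller-++ y (fallen W t) (x ∷ []))
    rank′ : ∀ i → e′ i ≡ i + smaller (e′ i) (fallen W (suc t))
    rank′ i with i <? r
    ... | yes i<r = trans (rank i) (cong (i +_) (sym (trans (count-suc (survivor i)) (trans (cong (smaller (survivor i) (fallen W t) +_)
                       (smaller-no (<⇒≤ (subst (survivor i <_) (sym (conf≗ h)) (mono i<r))))) (+-identityʳ _)))))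
    ... | no i≮r = trans (rank (suc i)) (trans (sym (+-suc i _)) (cong (i +_) (sym (trans (count-suc (survivor (suc i))) (trans (cong (smaller (survivor (suc i)) (fallen W t) +_)
                       (smaller-yes (subst (_< survivor (suc i)) (sym (conf≗ h)) (mono (s≤s (≮⇒≥ i≮r)))))) (+-comm _ 1))))))
    cover′ : ∀ c → (∃ λ i → e′ i ≡ c) ⊎ (∃ λ t′ → t′ ≤ suc t × FallsAt W t′ c)
    cover′ c with cover c
    ... | inj₂ f = inj₂ (later f)
    ... | inj₁ (i , z) with i ≟ r
    ...   | yes refl = inj₂ (suc t , ≤-refl , t , h , rest , refl , e , trans (conf≗ h) z)
    ...   | no i≢r with src-fall-surj r i≢r
    ...     | j , z′ = inj₁ (j , trans (e′-src j) (trans (cong survivor z′) z))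
    fr : ∀ {t′ c} → t′ ≤ suc t → FallsAt W t′ c → ∀ i → e′ i ≢ c
    fr {t′} {c} l f i z with m≤n⇒m<n∨m≡n l
    ... | inj₁ l′ = fresh (≤-pred l′) f _ (trans (sym (e′-src i)) z)
    ... | inj₂ refl with fallsAt-now e f
    ...   | _ , refl , z′ = <⇒≢′ (trans (sym (e′-src i)) (trans z (trans (sym z′) (conf≗ h))))
      where
      <⇒≢′ : survivor (src (fall r) i) ≡ survivor r → ⊥
      <⇒≢′ q with <-cmp (src (fall r) i) r
      ... | tri< a _ _ = <⇒≢ (mono a) q
      ... | tri≈ _ b _ = src-fall≢ r i b
      ... | tri> _ _ a = <⇒≢ (mono a) (sym q)

perm≗stateAt : ∀ W → ValidDiagram W → ∀ t → perm W t ≗ stateAt W t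
perm≗stateAt W v t h = begin
  conf W t h ∸ smaller (conf W t h) (fallenWires W t) ≡⟨ cong (λ z → conf W t h ∸ smaller (conf W t h) z) (fallenWires≡ W t) ⟩
  conf W t h ∸ smaller (conf W t h) (fallen W t) ≡⟨ cong (λ z → z ∸ smaller z (fallen W t)) (conf≗ h) ⟩
  survivor i ∸ smaller (survivor i) (fallen W t) ≡⟨ cong (_∸ smaller (survivor i) (fallen W t)) (rank i) ⟩
  i + smaller (survivor i) (fallen W t) ∸ smaller (survivor i) (fallen W t) ≡⟨ m+n∸n≡m i (smaller (survivor i) (fallen W t)) ⟩
  i ∎
  where
  open ≡-Reasoning
  open Survivors (survivors W v t)
  i = stateAt W t h

intersect-sym : ∀ {W t a b l} → Intersect W t a b l → Intersect W t b a l
intersect-sym = Sum.swap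

-- Labels start in increasing order and a fall keeps the relative order of the survivors, so only a
-- crossing of the two wires can have inverted the pair.
inversion⇒intersect : ∀ W t {p q} → p < q → conf W t q < conf W t p →
                      ∃ λ t′ → ∃ λ l → t′ ≤ t × Intersect W t′ (conf W t p) (conf W t q) l
inversion⇒intersect W = by-steps W P (λ p<q → contradiction p<q ∘ <-asym) end advance
  where
  P : ℕ → Set
  P t = ∀ {p q} → p < q → conf W t q < conf W t p → ∃ λ t′ → ∃ λ l → t′ ≤ t × Intersect W t′ (conf W t p) (conf W t q) l
  end : ∀ t → drop t W ≡ [] → P t → P (suc t)
  end t e ih p<q inv rewrite conf-end W t e with ih p<q inv
  ... | t′ , l , le , i = t′ , l , m≤n⇒m≤1+n le , i
  advance : ∀ t s rest → drop t W ≡ s ∷ rest → P t → P (suc t)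
  advance t s rest e ih {p} {q} p<q inv = subst₂ (λ a b → ∃ λ t′ → ∃ λ l → t′ ≤ suc t × Intersect W t′ a b l) (sym (lab p)) (sym (lab q)) (go s refl)
    where
    lab : ∀ x → conf W (suc t) x ≡ conf W t (src s x)
    lab x = trans (cong (λ f → f x) (conf-step W t e)) (applyStep-src (conf W t) s x)
    old : src s p < src s q → ∃ λ t′ → ∃ λ l → t′ ≤ suc t × Intersect W t′ (conf W t (src s p)) (conf W t (src s q)) l
    old l with ih l (subst₂ _<_ (lab q) (lab p) inv)
    ... | t′ , l′ , le , i = t′ , l′ , m≤n⇒m≤1+n le , i
    go : ∀ s′ → s ≡ s′ → ∃ λ t′ → ∃ λ l → t′ ≤ suc t × Intersect W t′ (conf W t (src s p)) (conf W t (src s q)) l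
    go (fall h) refl = old (src-fall-< h p<q)
    go (cross h) refl = cases (p ≟ h) (q ≟ suc h)
      where
      cases : Dec (p ≡ h) → Dec (q ≡ suc h) → ∃ λ t′ → ∃ λ l → t′ ≤ suc t × Intersect W t′ (conf W t (src (cross h) p)) (conf W t (src (cross h) q)) l
      cases (no p≢h) _ = old (src-cross-< h p<q (p≢h ∘ proj₁))
      cases (yes _) (no q≢) = old (src-cross-< h p<q (q≢ ∘ proj₂))
      cases (yes refl) (yes refl) = suc t , h , ≤-refl , inj₂ (byCross e (cong (conf W t) (sym (cross-lower id h))) (cong (conf W t) (sym (cross-upper id h))) refl)

simple⇒ok : ∀ {k W} → SimpleDiagram k W → ∀ t {s rest} → drop t W ≡ s ∷ rest → Ok k (stateAt W t) s
simple⇒ok {k} {W} (v , red , ¬S1 , ¬S2) t {s} {rest} e = go s refl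
  where
  open Survivors (survivors W v t)
  π = stateAt W t
  -- An inverted pair has intersected before, and `Reduced` forbids a second time.
  ordered : ∀ {p q l} → p < q → Intersect W (suc t) (conf W t p) (conf W t q) l → π p < π q
  ordered {p} {q} p<q i with <-cmp (π p) (π q)
  ... | tri< l _ _ = l
  ... | tri≈ _ z _ = contradiction (stateAt-injective W t z) (<⇒≢ p<q)
  ... | tri> _ _ l with inversion⇒intersect W t p<q (conf-< l)
  ...   | t′ , _ , le , i′ = contradiction (red i′ i) (<⇒≢ (s≤s le))
  level-k : ∀ {p q l} → p < q → Intersect W (suc t) (conf W t p) (conf W t q) l → π q ≡ suc (π p) → l ≡ k
  level-k {p} {q} {l} p<q i z = decidable-stable (l ≟ k) λ l≢k →
    ¬S1 (suc t , conf W t p , conf W t q , l , conf-< (ordered p<q i) , i , l≢k , between)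
    where
    between : ∀ c → conf W t p < c → c < conf W t q → Σ ℕ λ t′ → t′ < suc t × FallsAt W t′ c
    between c a b with cover c
    ... | inj₂ (t′ , le , f) = t′ , s≤s le , f
    ... | inj₁ (i′ , refl) = contradiction (reflects (subst (survivor i′ <_) (conf≗ q) b))
              (≤⇒≯ (≤-trans (≤-reflexive z) (reflects (subst (_< survivor i′) (conf≗ p) a))))
  go : ∀ s′ → s ≡ s′ → Ok k (stateAt W t) s
  go (fall h) refl = drop-valid W t v e , low , nxt
    where
    meet : ∀ {l} → h < l → Intersect W (suc t) (conf W t h) (conf W t l) (pred l)
    meet {suc l} (s≤s h≤l) = inj₁ (byFall {j = l ∸ h} e refl (cong (conf W t) (trans (+-suc h _) (cong suc (m+[n∸m]≡n h≤l)))) (sym (m+[n∸m]≡n h≤l)))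
    low : ∀ l → h < l → π h < π l
    low l h<l = ordered h<l (meet h<l)
    nxt : ∀ l → h < l → π l ≡ suc (π h) → l ≡ suc k
    nxt (suc l) h<l z = cong suc (level-k h<l (meet h<l) z)
  go (cross h) refl = drop-valid W t v e , x<y , adj , c<
    where
    meet : Intersect W (suc t) (conf W t h) (conf W t (suc h)) h
    meet = inj₁ (byCross e refl refl refl)
    x<y : π h < π (suc h)
    x<y = ordered ≤-refl meet
    adj : h ≡ k ⊎ π (suc h) ≢ suc (π h)
    adj with h ≟ k
    ... | yes z = inj₁ z
    ... | no h≢k = inj₂ (h≢k ∘ level-k ≤-refl meet)
    σ = stateAt W (suc t)
    σ≡ : σ ≡ next (cross h) π
    σ≡ = stateAt-step W t e
    module S = Survivors (survivors W v (suc t))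
    a = conf W (suc t) (suc h)
    -- Otherwise the wire that moves down to level h + 1 has k larger wires above it. It has
    -- intersected each of them, and none of these intersections came from its own fall because it
    -- is still present: a violation of (S2).
    c< : suc (overtaken π h) < k
    c< with suc (overtaken π h) <? k
    ... | yes p = p
    ... | no ¬p with ≤above⇒injection {k} σ (σ (suc h)) (suc h)
                      (≤-trans (≮⇒≥ ¬p) (≤-reflexive (sym (trans (cong (λ z → overtaken z (suc h)) σ≡) (overtaken-cross-lower π h x<y)))))
    ...   | g , g-inj , g-hit = ⊥-elim (¬S2 (a , conf W (suc t) ∘ g , (λ z → g-inj (conf-injective W (suc t) z)) , λ i →
              S.conf-< (proj₂ (g-hit i)) ,
              (let (t′ , l , le , x) = inversion⇒intersect W (suc t) (proj₁ (g-hit i)) (S.conf-< (proj₂ (g-hit i))) in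
               t′ , l , intersect-sym x , λ f → S.fresh le f (σ (suc h)) (sym (S.conf≗ (suc h))))))

simple⇒walk-take : ∀ {k W} → SimpleDiagram k W → ∀ t → Walk k id (take t W)
simple⇒walk-take {k} {W} sd = by-steps W (λ t → Walk k id (take t W)) []
  (λ t e w → subst (Walk k id) (sym (take-end W t e)) w)
  (λ t s _ e w → subst (Walk k id) (sym (take-snoc W t e)) (Walk-++ w (simple⇒ok sd t e ∷ [])))

-- Walks from the identity are simple diagrams

module _ {k W} (1≤k : 1 ≤ k) (walk : Walk k id W) where

  walk-take : ∀ t → Walk k id (take t W)
  walk-take t = proj₁ (Walk-++⁻ (take t W) (subst (Walk k id) (sym (take++drop≡id t W)) walk))

  walk-ok : ∀ t {s rest} → drop t W ≡ s ∷ rest → Ok k (stateAt W t) s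
  walk-ok t e with subst (Walk k (stateAt W t)) e (proj₂ (Walk-++⁻ (take t W) (subst (Walk k id) (sym (take++drop≡id t W)) walk)))
  ... | o ∷ _ = o

  walk-good : ∀ t → Good k (stateAt W t)
  walk-good t = Good-run (Good-id 1≤k) (walk-take t)

  walk-valid : ValidDiagram W
  walk-valid = go walk
    where
    go : ∀ {π w} → Walk k π w → All (λ s → 1 ≤ stepLevel s) w
    go [] = []
    go (_∷_ {s = s} o ws) = Ok⇒1≤ s o ∷ go ws

  private module V t = Survivors (survivors W walk-valid t)

  dir-< : ∀ {t a b l} → IntersectDir W t a b l → a < b
  dir-< (byCross {t} e refl refl refl) = V.conf-< t (proj₁ (proj₂ (walk-ok t e)))
  dir-< (byFall {t} {h} e refl refl refl) = V.conf-< t (proj₁ (proj₂ (walk-ok t e)) _ (m<m+n h z<s))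

  directed : ∀ {t a b l} → a < b → Intersect W t a b l → IntersectDir W t a b l
  directed a<b (inj₁ d) = d
  directed a<b (inj₂ d) = contradiction (dir-< d) (<-asym a<b)

  -- Wire b is above wire a at time t, or a has fallen.
  Over : ℕ → ℕ → ℕ → Set
  Over t b a = ∀ q → conf W t q ≡ a → ∃ λ p → p < q × conf W t p ≡ b

  -- A crossing in a walk has the smaller wire on top, so it never exchanges the pair back, and `b`
  -- cannot fall while the smaller `a` is below it. This persistence gives both `Reduced` and the
  -- absence of (S2) violations.
  over-suc : ∀ {a b} → a < b → ∀ t → Over t b a → Over (suc t) b a
  over-suc {a} {b} a<b t ov q z with drop t W in e
  ... | [] rewrite conf-end W t e = ov q z
  ... | s ∷ rest = go s refl
    where
    lab : ∀ x → conf W (suc t) x ≡ conf W t (src s x)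
    lab x = trans (cong (λ f → f x) (conf-step W t e)) (applyStep-src (conf W t) s x)
    old = ov (src s q) (trans (sym (lab q)) z)
    p₀ = proj₁ old
    p₀< = proj₁ (proj₂ old)
    p₀-b = proj₂ (proj₂ old)
    go : ∀ s′ → s ≡ s′ → ∃ λ p → p < q × conf W (suc t) p ≡ b
    go (cross h) refl = src s p₀ , subst (src s p₀ <_) (src-involutive h q) (src-cross-< h p₀< bad) ,
                        trans (lab (src s p₀)) (trans (cong (conf W t) (src-involutive h p₀)) p₀-b)
      where
      bad : ¬ (p₀ ≡ h × src (cross h) q ≡ suc h)
      bad (x , y) = <-asym a<b (subst₂ _<_ (trans (cong (conf W t) (sym x)) p₀-b) (trans (cong (conf W t) (sym y)) (trans (sym (lab q)) z))
                      (V.conf-< t (proj₁ (proj₂ (walk-ok t e)))))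
    go (fall h) refl with p₀ ≟ h
    ... | yes x = contradiction (subst₂ _<_ p₀-b (trans (sym (lab q)) z) (V.conf-< t (subst (λ y → stateAt W t y < _) (sym x)
                     (proj₁ (proj₂ (walk-ok t e)) _ (subst (_< _) x p₀<))))) (<-asym a<b)
    ... | no x with src-fall-surj h x
    ...   | p , y = p , src-fall-reflects-< h (subst (_< src (fall h) q) (sym y) p₀<) , trans (lab p) (trans (cong (conf W t) y) p₀-b)

  over-mono : ∀ {a b t t′} → a < b → t ≤ t′ → Over t b a → Over t′ b a
  over-mono {a} {b} {t} a<b le ov = go (≤⇒≤′ le)
    where
    go : ∀ {t′} → t ≤′ t′ → Over t′ b a
    go (≤′-reflexive refl) = ov
    go (≤′-step {n = n} l) = over-suc a<b n (go l)

  dir⇒over : ∀ {t a b l} → IntersectDir W t a b l → Over t b a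
  dir⇒over (byCross {t} {h} e refl refl refl) q z = h ,
    ≤-reflexive (sym (conf-injective W (suc t) {q} {suc h} (trans z (sym (trans (cong (λ f → f (suc h)) (conf-step W t e)) (cross-lower (conf W t) h)))))) ,
    trans (cong (λ f → f h) (conf-step W t e)) (cross-upper (conf W t) h)
  dir⇒over (byFall {t} {h} e refl refl refl) q z = contradiction
    (conf-injective W t (trans (sym (trans (cong (λ f → f q) (conf-step W t e)) (applyStep-src (conf W t) (fall h) q))) z)) (src-fall≢ h q)

  once : ∀ {t t′ a b l l′} → IntersectDir W t a b l → IntersectDir W t′ a b l′ → ¬ (t < t′)
  once d d′ lt = clash d′ (λ {t} e → over-mono (dir-< d) (≤-pred (subst (_ <_) e lt)) (dir⇒over d))
    where
    clash : ∀ {t′ a b l′} → IntersectDir W t′ a b l′ → (∀ {t} → t′ ≡ suc t → Over t b a) → ⊥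
    clash (byCross {t} {h} e refl refl refl) ov with ov refl h refl
    ... | p , p<h , z = <-asym p<h (subst (h <_) (sym (conf-injective W t z)) ≤-refl)
    clash (byFall {t} {h} e refl refl refl) ov with ov refl h refl
    ... | p , p<h , z = <-asym p<h (subst (h <_) (sym (conf-injective W t z)) (m<m+n h z<s))

  walk-reduced : Reduced W
  walk-reduced {t} {t′} {a} {b} i i′ = go i i′
    where
    same : ∀ {a b l l′} → IntersectDir W t a b l → IntersectDir W t′ a b l′ → t ≡ t′
    same d d′ with <-cmp t t′
    ... | tri< x _ _ = contradiction x (once d d′)
    ... | tri≈ _ x _ = x
    ... | tri> _ _ x = contradiction x (once d′ d)
    go : ∀ {l l′} → Intersect W t a b l → Intersect W t′ a b l′ → t ≡ t′
    go (inj₁ d) (inj₁ d′) = same d d′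
    go (inj₂ d) (inj₂ d′) = same d d′
    go (inj₁ d) (inj₂ d′) = contradiction (dir-< d) (<-asym (dir-< d′))
    go (inj₂ d) (inj₁ d′) = contradiction (dir-< d) (<-asym (dir-< d′))

  walk-¬S1 : ¬ S1-violation k W
  walk-¬S1 (t , a , b , l , a<b , i , l≢k , gone) = go (directed a<b i) gone
    where
    adjacent : ∀ t p q → conf W t p < conf W t q → (∀ c → conf W t p < c → c < conf W t q → Σ ℕ λ t′ → t′ < suc t × FallsAt W t′ c) →
               stateAt W t q ≡ suc (stateAt W t p)
    adjacent t p q lt gone with m≤n⇒m<n∨m≡n (V.stateAt-< t lt)
    ... | inj₂ z = sym z
    ... | inj₁ l with gone (V.survivor t (suc (stateAt W t p))) (subst (_< V.survivor t (suc (stateAt W t p))) (sym (V.conf≗ t p)) (V.mono t ≤-refl)) (subst (V.survivor t (suc (stateAt W t p)) <_) (sym (V.conf≗ t q)) (V.mono t l))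
    ...   | t′ , le , f = contradiction refl (V.fresh t (≤-pred le) f (suc (stateAt W t p)))
    go : IntersectDir W t a b l → (∀ c → a < c → c < b → Σ ℕ λ t′ → t′ < t × FallsAt W t′ c) → ⊥
    go (byCross {t} {h} e refl refl refl) gone with proj₁ (proj₂ (proj₂ (walk-ok t e)))
    ... | inj₁ z = l≢k z
    ... | inj₂ z = z (adjacent t h (suc h) a<b gone)
    go (byFall {t} {h} {j} e refl refl refl) gone =
      l≢k (suc-injective (trans (sym (+-suc h j)) (proj₂ (proj₂ (walk-ok t e)) (h + suc j) (m<m+n h z<s) (adjacent t h (h + suc j) a<b gone))))

  -- At the latest of the k intersection times the wire `a` is still present, and all k larger wires
  -- are above it simultaneously, which the invariant `overtaken<` excludes.
  walk-¬S2 : ¬ S2-violation k W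
  walk-¬S2 (a , g , g-inj , hit) = go 1≤k g g-inj hit refl
    where
    argmax : ∀ {m} (f : Fin (suc m) → ℕ) → ∃ λ i → ∀ j → f j ≤ f i
    argmax {zero} f = Fin.zero , λ { Fin.zero → ≤-refl }
    argmax {suc m} f with argmax (f ∘ Fin.suc)
    ... | i , mx with ≤-total (f Fin.zero) (f (Fin.suc i))
    ...   | inj₁ l = Fin.suc i , λ { Fin.zero → l ; (Fin.suc j) → mx j }
    ...   | inj₂ l = Fin.zero , λ { Fin.zero → ≤-refl ; (Fin.suc j) → ≤-trans (mx j) l }
    alive : ∀ {t b l} → IntersectDir W t a b l → ¬ FallsAt W t a → ∃ λ q → conf W t q ≡ a
    alive (byCross {t} {h} e refl refl refl) _ = suc h , trans (cong (λ f → f (suc h)) (conf-step W t e)) (cross-lower (conf W t) h)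
    alive (byFall {t} {h} e refl refl refl) ¬f = contradiction (t , h , _ , refl , e , refl) ¬f
    -- The size of the family is generalised so that it can be matched as a successor, which
    -- `argmax` requires, while k remains a variable.
    go : ∀ {m} → 1 ≤ m → (g : Fin m → ℕ) → Injective _≡_ _≡_ g →
         (∀ i → a < g i × Σ ℕ λ t → Σ ℕ λ l → Intersect W t a (g i) l × ¬ FallsAt W t a) → m ≡ k → ⊥
    go (s≤s {n = m} _) g g-inj hit refl = <⇒≱ (Good.overtaken< (walk-good T) q)
        (injection⇒≤above (stateAt W T) (stateAt W T q) q (proj₁ ∘ pos)
          (λ {i} {j} z → g-inj (trans (sym (proj₂ (proj₂ (pos i)))) (trans (cong (conf W T) z) (proj₂ (proj₂ (pos j))))))
          (λ i → proj₁ (proj₂ (pos i)) , V.stateAt-< T (subst₂ _<_ (sym q-a) (sym (proj₂ (proj₂ (pos i)))) (proj₁ (hit i)))))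
      where
      time : Fin (suc m) → ℕ
      time i = proj₁ (proj₂ (hit i))
      dir : ∀ i → IntersectDir W (time i) a (g i) _
      dir i = directed (proj₁ (hit i)) (proj₁ (proj₂ (proj₂ (proj₂ (hit i)))))
      last = argmax time
      T = time (proj₁ last)
      live = alive (dir (proj₁ last)) (proj₂ (proj₂ (proj₂ (proj₂ (hit (proj₁ last))))))
      q = proj₁ live
      q-a = proj₂ live
      pos : ∀ i → ∃ λ p → p < q × conf W T p ≡ g i
      pos i = over-mono (proj₁ (hit i)) (proj₂ last i) (dir⇒over (dir i)) q q-a

  walk⇒simple : SimpleDiagram k W
  walk⇒simple = walk-valid , walk-reduced , walk-¬S1 , walk-¬S2

-- Patterns as closed walks

take-length-++ : ∀ {A : Set} (u v : List A) → take (length u) (u ++ v) ≡ u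
take-length-++ [] v = refl
take-length-++ (x ∷ u) v = cong (x ∷_) (take-length-++ u v)

drop-length-++ : ∀ {A : Set} (u v : List A) → drop (length u) (u ++ v) ≡ v
drop-length-++ [] v = refl
drop-length-++ (x ∷ u) v = drop-length-++ u v

InT⇒walk : ∀ {k π} → InT k π → ∃ λ u → Walk k id u × π ≗ run id u
InT⇒walk (W , sd , t , _ , e) = take t W , simple⇒walk-take sd t , λ h → trans (e h) (perm≗stateAt W (proj₁ sd) t h)

walk⇒InT : ∀ {k u} → 1 ≤ k → Walk k id u → InT k (run id u)
walk⇒InT {k} {u} 1≤k w = u , walk⇒simple 1≤k w , length u , ≤-refl , λ h →
  sym (trans (perm≗stateAt u (walk-valid 1≤k w) (length u) h) (cong (λ z → run id z h) (take-all u)))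
  where
  take-all : ∀ {A : Set} (u : List A) → take (length u) u ≡ u
  take-all [] = refl
  take-all (x ∷ u) = cong (x ∷_) (take-all u)

-- Simplicity of a piece depends on its state and step alone, whichever diagram it was cut from.
-- This is why pieces of different diagrams can be joined to one walk.
piece⇒ok : ∀ {k P} → SimplePiece k P → Ok k (π⁻ P) (step P) × π⁺ P ≗ next (step P) (π⁻ P)
piece⇒ok {k} {P} (W , sd , t , rest , e , a , b) = Ok-cong (step P) (sym ∘ a′) (simple⇒ok sd t e) ,
  λ h → trans (b h) (trans (perm≗stateAt W (proj₁ sd) (suc t) h) (trans (cong (λ f → f h) (stateAt-step W t e)) (next-cong (step P) (sym ∘ a′) h)))
  where
  a′ : π⁻ P ≗ stateAt W t
  a′ h = trans (a h) (perm≗stateAt W (proj₁ sd) t h)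

ok⇒piece : ∀ {k u s} → 1 ≤ k → Walk k id u → Ok k (run id u) s → SimplePiece k (piece s (run id u) (next s (run id u)))
ok⇒piece {k} {u} {s} 1≤k w o = W , walk⇒simple 1≤k w′ , length u , [] , drop-length-++ u (s ∷ []) ,
  (λ h → sym (trans (perm≗stateAt W v (length u) h) (cong (λ f → f h) before))) ,
  λ h → sym (trans (perm≗stateAt W v (suc (length u)) h) (cong (λ f → f h) (trans (stateAt-step W (length u) (drop-length-++ u (s ∷ []))) (cong (next s) before))))
  where
  W = u ++ s ∷ []
  w′ : Walk k id W
  w′ = Walk-++ w (o ∷ [])
  v = walk-valid 1≤k w′
  before : stateAt W (length u) ≡ run id u
  before = cong (run id) (take-length-++ u (s ∷ []))

levelK-tot : ∀ k Ps → levelK k Ps ≡ tot (levelKStep k) (map step Ps)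
levelK-tot k [] = refl
levelK-tot k (P ∷ Ps) = cong (levelKStep k (step P) +_) (levelK-tot k Ps)

falls-tot : ∀ Ps → falls Ps ≡ tot isFall (map step Ps)
falls-tot [] = refl
falls-tot (P ∷ Ps) = cong (isFall (step P) +_) (falls-tot Ps)

Starts : State → List Piece → Set
Starts ρ [] = ⊤
Starts ρ (P ∷ Ps) = π⁻ P ≗ ρ

module _ {k : ℕ} where

  starts-next : ∀ {ρ P} Ps → SimplePiece k P → Chain (P ∷ Ps) → π⁻ P ≗ ρ → Starts (next (step P) ρ) Ps
  starts-next [] sp c e = tt
  starts-next {P = P} (Q ∷ Ps) sp (j , _) e h = trans (sym (j h)) (trans (proj₂ (piece⇒ok sp) h) (next-cong (step P) e h))

  chain-tail : ∀ {P} Ps → Chain (P ∷ Ps) → Chain Ps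
  chain-tail [] c = tt
  chain-tail (Q ∷ Ps) (_ , c) = c

  pattern⇒walk : ∀ {ρ} Ps → All (SimplePiece k) Ps → Chain Ps → Starts ρ Ps → Walk k ρ (map step Ps)
  pattern⇒walk [] [] c e = []
  pattern⇒walk (P ∷ Ps) (sp ∷ sps) c e = Ok-cong (step P) e (proj₁ (piece⇒ok sp)) ∷
    pattern⇒walk Ps sps (chain-tail Ps c) (starts-next Ps sp c e)

  pattern-end : ∀ {ρ} ini {Pr} → All (SimplePiece k) (ini ∷ʳ Pr) → Chain (ini ∷ʳ Pr) → Starts ρ (ini ∷ʳ Pr) → π⁺ Pr ≗ run ρ (map step (ini ∷ʳ Pr))
  pattern-end [] {Pr} (sp ∷ []) c e h = trans (proj₂ (piece⇒ok sp) h) (next-cong (step Pr) e h)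
  pattern-end (P ∷ ini) (sp ∷ sps) c e = pattern-end ini sps (chain-tail _ c) (starts-next _ sp c e)

  pattern-distinct : ∀ {ρ} Ps → All (SimplePiece k) Ps → Chain Ps → Starts ρ Ps → AllPairs (λ P Q → ¬ (π⁻ P ≗ π⁻ Q)) Ps →
                     Distinct (states ρ (map step Ps))
  pattern-distinct [] sps c e [] = []
  pattern-distinct {ρ} (P ∷ Ps) (sp ∷ sps) c e (n ∷ ns) =
    all Ps sps (chain-tail Ps c) (starts-next Ps sp c e) n ∷ pattern-distinct Ps sps (chain-tail Ps c) (starts-next Ps sp c e) ns
    where
    all : ∀ {σ} Qs → All (SimplePiece k) Qs → Chain Qs → Starts σ Qs → All (λ Q → ¬ (π⁻ P ≗ π⁻ Q)) Qs → All (λ τ → ¬ (ρ ≗ τ)) (states σ (map step Qs))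
    all [] _ _ _ [] = []
    all (Q ∷ Qs) (sq ∷ sqs) c f (n ∷ ns) = (λ z → n λ h → trans (e h) (trans (z h) (sym (f h)))) ∷ all Qs sqs (chain-tail Qs c) (starts-next Qs sq c f) ns

  admissible⇒closed : ∀ {f π ρ Ps} → π ≗ ρ → AdmissiblePattern k f π Ps → ClosedDistinct k ρ (map step Ps)
  admissible⇒closed {ρ = ρ} π≗ρ (sps , c , d , (P₁ , rest , refl , e₁) , (ini , Pr , eq , e₂) , _) =
    pattern⇒walk _ sps c e , closed , pattern-distinct _ sps c e d
    where
    e : π⁻ P₁ ≗ ρ
    e h = trans (e₁ h) (π≗ρ h)
    closed : run ρ (map step (P₁ ∷ rest)) ≗ ρ
    closed h = trans (sym (subst (λ Qs → All (SimplePiece k) Qs → Chain Qs → Starts ρ Qs → π⁺ Pr ≗ run ρ (map step Qs)) (sym eq) (pattern-end ini) sps c e h))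
                     (trans (e₂ h) (π≗ρ h))

  pieces : State → List Step → List Piece
  pieces ρ [] = []
  pieces ρ (s ∷ v) = piece s ρ (next s ρ) ∷ pieces (next s ρ) v

  map-step-pieces : ∀ ρ v → map step (pieces ρ v) ≡ v
  map-step-pieces ρ [] = refl
  map-step-pieces ρ (s ∷ v) = cong (s ∷_) (map-step-pieces (next s ρ) v)

  pieces-simple : ∀ {u v} → 1 ≤ k → Walk k id u → Walk k (run id u) v → All (SimplePiece k) (pieces (run id u) v)
  pieces-simple 1≤k w [] = []
  pieces-simple {u} {s ∷ v} 1≤k w (o ∷ ws) = ok⇒piece 1≤k w o ∷
    subst (λ ρ → All (SimplePiece k) (pieces ρ v)) e (pieces-simple 1≤k (Walk-++ w (o ∷ [])) (subst (λ ρ → Walk k ρ v) (sym e) ws))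
    where
    e : run id (u ++ s ∷ []) ≡ next s (run id u)
    e = run-++ id u (s ∷ [])

  pieces-chain : ∀ ρ v → Chain (pieces ρ v)
  pieces-chain ρ [] = tt
  pieces-chain ρ (s ∷ []) = tt
  pieces-chain ρ (s ∷ s′ ∷ v) = (λ h → refl) , pieces-chain (next s ρ) (s′ ∷ v)

  pieces-distinct : ∀ ρ v → Distinct (states ρ v) → AllPairs (λ P Q → ¬ (π⁻ P ≗ π⁻ Q)) (pieces ρ v)
  pieces-distinct ρ [] [] = []
  pieces-distinct ρ (s ∷ v) (n ∷ ns) = all (next s ρ) v n ∷ pieces-distinct (next s ρ) v ns
    where
    all : ∀ σ v → All (λ τ → ¬ (ρ ≗ τ)) (states σ v) → All (λ Q → ¬ (ρ ≗ π⁻ Q)) (pieces σ v)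
    all σ [] [] = []
    all σ (s ∷ v) (n ∷ ns) = n ∷ all (next s σ) v ns

  pieces-end : ∀ ρ s v → ∃ λ ini → ∃ λ Pr → pieces ρ (s ∷ v) ≡ ini ∷ʳ Pr × π⁺ Pr ≗ run ρ (s ∷ v)
  pieces-end ρ s [] = [] , piece s ρ (next s ρ) , refl , λ h → refl
  pieces-end ρ s (s′ ∷ v) with pieces-end (next s ρ) s′ v
  ... | ini , Pr , eq , e = piece s ρ (next s ρ) ∷ ini , Pr , cong (piece s ρ (next s ρ) ∷_) eq , e

  closed⇒admissible : ∀ {u v} → 1 ≤ k → Walk k id u → ClosedDistinct k (run id u) v → 0 < tot isFall v →
                      AdmissiblePattern k (tot isFall v) (run id u) (pieces (run id u) v)
  closed⇒admissible {u} {s ∷ v} 1≤k w (ws , closed , d) _ =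
    pieces-simple 1≤k w ws , pieces-chain ρ (s ∷ v) , pieces-distinct ρ (s ∷ v) d ,
    (piece s ρ (next s ρ) , pieces (next s ρ) v , refl , λ h → refl) ,
    (let (ini , Pr , eq , e) = pieces-end ρ s v in ini , Pr , eq , λ h → trans (e h) (closed h)) ,
    trans (falls-tot (pieces ρ (s ∷ v))) (cong (tot isFall) (map-step-pieces ρ (s ∷ v)))
    where ρ = run id u

-- Reduced words

data Cross : ℕ → List ℕ → List ℕ → Set where
  here : ∀ {x y l} → x < y → Cross 1 (x ∷ y ∷ l) (y ∷ x ∷ l)
  there : ∀ {i x l l′} → Cross (suc i) l l′ → Cross (suc (suc i)) (x ∷ l) (x ∷ l′)

-- Saturated chains of the weak order: every letter exchanges an ascent and so creates exactly one
-- inversion.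
data Asc : List ℕ → List ℕ → List ℕ → Set where
  [] : ∀ {l} → Asc l [] l
  _∷_ : ∀ {i l l′ w l″} → Cross i l l′ → Asc l′ w l″ → Asc l (i ∷ w) l″

Asc-++ : ∀ {l l′ l″ u v} → Asc l u l′ → Asc l′ v l″ → Asc l (u ++ v) l″
Asc-++ [] b = b
Asc-++ (c ∷ a) b = c ∷ Asc-++ a b

swaps : List ℕ → List ℕ → List ℕ
swaps = foldl (λ l i → swapAt i l)

Cross⇒swapAt : ∀ {i l l′} → Cross i l l′ → swapAt i l ≡ l′
Cross⇒swapAt (here _) = refl
Cross⇒swapAt (there c) = cong (_ ∷_) (Cross⇒swapAt c)

Asc⇒swaps : ∀ {l w l′} → Asc l w l′ → swaps l w ≡ l′
Asc⇒swaps [] = refl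
Asc⇒swaps {w = i ∷ w} (c ∷ a) = trans (cong (λ z → swaps z w) (Cross⇒swapAt c)) (Asc⇒swaps a)

Cross⇒↭ : ∀ {i l l′} → Cross i l l′ → l ↭ l′
Cross⇒↭ (here _) = swap _ _ ↭-refl
Cross⇒↭ (there c) = prep _ (Cross⇒↭ c)

Asc⇒↭ : ∀ {l w l′} → Asc l w l′ → l ↭ l′
Asc⇒↭ [] = ↭-refl
Asc⇒↭ (c ∷ a) = ↭-trans (Cross⇒↭ c) (Asc⇒↭ a)

Cross-range : ∀ {i l l′} → Cross i l l′ → 1 ≤ i × i < length l × length l′ ≡ length l
Cross-range (here _) = ≤-refl , s≤s (s≤s z≤n) , refl
Cross-range (there c) with Cross-range c
... | a , b , e = s≤s z≤n , s≤s b , cong suc e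

Asc-range : ∀ {l w l′} → Asc l w l′ → All (λ i → 1 ≤ i × i < length l) w
Asc-range [] = []
Asc-range (c ∷ a) with Cross-range c
... | p , q , e = (p , q) ∷ subst (λ n → All (λ i → 1 ≤ i × i < n) _) e (Asc-range a)

smaller-∷ : ∀ x y l → smaller x (y ∷ l) ≡ smaller x (y ∷ []) + smaller x l
smaller-∷ x y l = smaller-++ x (y ∷ []) l

smaller-swap : ∀ z x y l → smaller z (y ∷ x ∷ l) ≡ smaller z (x ∷ y ∷ l)
smaller-swap z x y l = begin
  smaller z (y ∷ x ∷ l) ≡⟨ trans (smaller-∷ z y (x ∷ l)) (cong (smaller z (y ∷ []) +_) (smaller-∷ z x l)) ⟩
  smaller z (y ∷ []) + (smaller z (x ∷ []) + smaller z l) ≡⟨ x∙yz≈y∙xz (smaller z (y ∷ [])) (smaller z (x ∷ [])) (smaller z l) ⟩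
  smaller z (x ∷ []) + (smaller z (y ∷ []) + smaller z l) ≡⟨ trans (smaller-∷ z x (y ∷ l)) (cong (smaller z (x ∷ []) +_) (smaller-∷ z y l)) ⟨
  smaller z (x ∷ y ∷ l) ∎
  where open ≡-Reasoning
        open import Algebra.Properties.CommutativeSemigroup +-commutativeSemigroup

inv : List ℕ → ℕ
inv [] = 0
inv (x ∷ l) = smaller x l + inv l

smaller-swapAt : ∀ z i l → smaller z (swapAt i l) ≡ smaller z l
smaller-swapAt z zero l = refl
smaller-swapAt z (suc zero) [] = refl
smaller-swapAt z (suc zero) (x ∷ []) = refl
smaller-swapAt z (suc zero) (x ∷ y ∷ l) = smaller-swap z x y l
smaller-swapAt z (suc (suc i)) [] = refl
smaller-swapAt z (suc (suc i)) (x ∷ l) = trans (smaller-∷ z x (swapAt (suc i) l)) (trans (cong (smaller z (x ∷ []) +_) (smaller-swapAt z (suc i) l)) (sym (smaller-∷ z x l)))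

inv-swap-head : ∀ x y l → x < y → inv (y ∷ x ∷ l) ≡ suc (inv (x ∷ y ∷ l))
inv-swap-head x y l x<y = begin
  smaller y (x ∷ l) + (smaller x l + inv l) ≡⟨ cong (_+ (smaller x l + inv l)) (trans (smaller-∷ y x l) (cong (_+ smaller y l) (smaller-yes x<y))) ⟩
  suc (smaller y l + (smaller x l + inv l)) ≡⟨ cong suc (x∙yz≈y∙xz (smaller y l) (smaller x l) (inv l)) ⟩
  suc (smaller x l + (smaller y l + inv l)) ≡⟨ cong (λ z → suc (z + (smaller y l + inv l))) (trans (smaller-∷ x y l) (cong (_+ smaller x l) (smaller-no (<⇒≤ x<y)))) ⟨
  suc (smaller x (y ∷ l) + (smaller y l + inv l)) ∎
  where open ≡-Reasoning
        open import Algebra.Properties.CommutativeSemigroup +-commutativeSemigroup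

Cross-inv : ∀ {i l l′} → Cross i l l′ → inv l′ ≡ suc (inv l)
Cross-inv (here {x} {y} {l} x<y) = inv-swap-head x y l x<y
Cross-inv (there {i} {x} {l} c) = trans (cong₂ _+_ (trans (cong (smaller x) (sym (Cross⇒swapAt c))) (smaller-swapAt x (suc i) l)) (Cross-inv c)) (+-suc (smaller x l) _)

Asc-inv : ∀ {l w l′} → Asc l w l′ → inv l′ ≡ length w + inv l
Asc-inv [] = refl
Asc-inv {w = i ∷ w} (c ∷ a) = trans (Asc-inv a) (trans (cong (length w +_) (Cross-inv c)) (+-suc (length w) _))

swapAt-cases : ∀ i l → Cross i l (swapAt i l) ⊎ inv (swapAt i l) ≤ inv l
swapAt-cases zero l = inj₂ ≤-refl
swapAt-cases (suc zero) [] = inj₂ ≤-refl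
swapAt-cases (suc zero) (x ∷ []) = inj₂ ≤-refl
swapAt-cases (suc zero) (x ∷ y ∷ l) with <-cmp x y
... | tri< p _ _ = inj₁ (here p)
... | tri≈ _ refl _ = inj₂ ≤-refl
... | tri> _ _ p = inj₂ (≤-trans (n≤1+n _) (≤-reflexive (sym (inv-swap-head y x l p))))
swapAt-cases (suc (suc i)) [] = inj₂ ≤-refl
swapAt-cases (suc (suc i)) (x ∷ l) with swapAt-cases (suc i) l
... | inj₁ c = inj₁ (there c)
... | inj₂ le = inj₂ (+-mono-≤ (≤-reflexive (smaller-swapAt x (suc i) l)) le)

inv-swapAt : ∀ i l → inv (swapAt i l) ≤ suc (inv l)
inv-swapAt i l with swapAt-cases i l
... | inj₁ c = ≤-reflexive (Cross-inv c)
... | inj₂ le = m≤n⇒m≤1+n le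

inv-swaps : ∀ l w → inv (swaps l w) ≤ length w + inv l
inv-swaps l [] = ≤-refl
inv-swaps l (i ∷ w) = ≤-trans (inv-swaps (swapAt i l) w) (≤-trans (+-monoʳ-≤ (length w) (inv-swapAt i l)) (≤-reflexive (+-suc (length w) _)))

-- A letter adds at most one inversion, so a total equal to the length leaves room for no letter
-- that adds none.
swaps⇒Asc : ∀ l w → inv (swaps l w) ≡ length w + inv l → Asc l w (swaps l w)
swaps⇒Asc l [] e = []
swaps⇒Asc l (i ∷ w) e with swapAt-cases i l
... | inj₁ c = c ∷ swaps⇒Asc (swapAt i l) w (trans e (trans (sym (+-suc (length w) _)) (cong (length w +_) (sym (Cross-inv c)))))
... | inj₂ le = contradiction (subst (_≤ length w + inv l) e (≤-trans (inv-swaps (swapAt i l) w) (+-monoʳ-≤ (length w) le))) 1+n≰n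

-- Reduced words of the longest permutation

desc : ℕ → List ℕ
desc zero = []
desc (suc n) = suc n ∷ desc n

reverse≡desc : ∀ n → reverse (map suc (upTo n)) ≡ desc n
reverse≡desc n = trans (sym (reverse-map suc (upTo n))) (trans (cong (map suc) (reverse-upTo n)) (go n))
  where
  go : ∀ n → map suc (downFrom n) ≡ desc n
  go zero = refl
  go (suc n) = cong (suc n ∷_) (go n)

smaller-desc : ∀ m n → n < m → smaller m (desc n) ≡ n
smaller-desc m zero _ = refl
smaller-desc m (suc n) l = trans (smaller-∷ m (suc n) (desc n)) (cong₂ _+_ (smaller-yes l) (smaller-desc m n (<-trans ≤-refl l)))

inv-desc : ∀ n → 2 * inv (desc n) ≡ n * (n ∸ 1)
inv-desc zero = refl
inv-desc (suc zero) = refl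
inv-desc (suc (suc n)) = trans (cong (λ z → 2 * (z + inv (desc (suc n)))) (smaller-desc (suc (suc n)) (suc n) ≤-refl))
  (trans (*-distribˡ-+ 2 (suc n) (inv (desc (suc n)))) (trans (cong (2 * suc n +_) (inv-desc (suc n)))
   (trans (cong (2 * suc n +_) (*-comm (suc n) n)) (trans (sym (*-distribʳ-+ (suc n) 2 n)) refl))))

inv-applyUpTo : ∀ (f : ℕ → ℕ) n → (∀ {i j} → i < j → f i < f j) → inv (applyUpTo f n) ≡ 0
inv-applyUpTo f zero m = refl
inv-applyUpTo f (suc n) m = cong₂ _+_ (go (f ∘ suc) n (λ i → <⇒≤ (m z<s))) (inv-applyUpTo (f ∘ suc) n (λ l → m (s≤s l)))
  where
  go : ∀ g n → (∀ i → f 0 ≤ g i) → smaller (f 0) (applyUpTo g n) ≡ 0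
  go g zero h = refl
  go g (suc n) h = trans (smaller-∷ (f 0) (g 0) _) (cong₂ _+_ (smaller-no (h 0)) (go (g ∘ suc) n (λ i → h (suc i))))

inv-initial : ∀ n → inv (map suc (upTo n)) ≡ 0
inv-initial n = trans (cong inv (map-upTo suc n)) (inv-applyUpTo suc n s≤s)

reduced⇒Asc : ∀ {n w} → IsReducedWordW0 n w → Asc (map suc (upTo n)) w (wordPerm n w)
reduced⇒Asc {n} {w} (_ , e , len) = swaps⇒Asc (map suc (upTo n)) w (begin
  inv (wordPerm n w) ≡⟨ cong inv (trans e (reverse≡desc n)) ⟩
  inv (desc n) ≡⟨ *-cancelˡ-≡ _ _ 2 (trans (inv-desc n) (sym len)) ⟩
  length w ≡⟨ +-identityʳ _ ⟨
  length w + 0 ≡⟨ cong (length w +_) (inv-initial n) ⟨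
  length w + inv (map suc (upTo n)) ∎)
  where open ≡-Reasoning

Asc⇒reduced : ∀ {n w} → Asc (map suc (upTo n)) w (desc n) → IsReducedWordW0 n w
Asc⇒reduced {n} {w} a = subst (λ m → All (λ i → 1 ≤ i × i < m) w) (trans (length-map suc (upTo n)) (length-upTo n)) (Asc-range a) ,
  trans (Asc⇒swaps a) (sym (reverse≡desc n)) ,
  trans (cong (2 *_) (sym (trans (Asc-inv a) (trans (cong (length w +_) (inv-initial n)) (+-identityʳ _))))) (inv-desc n)

Asc-∷ : ∀ {x l w l′} → Asc l w l′ → Asc (x ∷ l) (map suc w) (x ∷ l′)
Asc-∷ [] = []
Asc-∷ (c@(here _) ∷ a) = there c ∷ Asc-∷ a
Asc-∷ (c@(there _) ∷ a) = there c ∷ Asc-∷ a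

Descending : List ℕ → Set
Descending = Linked _≥_

-- Insertion moves `x` to the right past larger entries, each time exchanging an ascent. The last
-- component says that an entry may be put back in front of the result, as the recursion needs.
insert-desc : ∀ x l → Descending l → ∃ λ w → ∃ λ l′ → Asc (x ∷ l) w l′ × Descending l′ × (∀ {y} → x ≤ y → Linked _≥_ (y ∷ l) → Linked _≥_ (y ∷ l′))
insert-desc x [] d = [] , x ∷ [] , [] , [-] , λ p _ → p ∷ [-]
insert-desc x (y ∷ l) d with x <? y
... | no x≮y = [] , x ∷ y ∷ l , [] , ≮⇒≥ x≮y ∷ d , λ { p (q ∷ r) → p ∷ ≮⇒≥ x≮y ∷ r }
... | yes x<y with insert-desc x l (Linked.tail d)
...   | w , l′ , a , d′ , hd = 1 ∷ map suc w , y ∷ l′ , here x<y ∷ Asc-∷ a , hd (<⇒≤ x<y) d , λ { p (q ∷ r) → q ∷ hd (<⇒≤ x<y) r }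

sort-desc : ∀ l → ∃ λ w → ∃ λ l′ → Asc l w l′ × Descending l′
sort-desc [] = [] , [] , [] , []
sort-desc (x ∷ l) with sort-desc l
... | w , l′ , a , d with insert-desc x l′ d
...   | v , l″ , b , d′ , _ = map suc w ++ v , l″ , Asc-++ (Asc-∷ a) b , d′

desc-descending : ∀ n → Descending (desc n)
desc-descending zero = []
desc-descending (suc zero) = [-]
desc-descending (suc (suc n)) = n≤1+n _ ∷ desc-descending (suc n)

descending-unique : ∀ {l m} → Descending l → Descending m → l ↭ m → l ≡ m
descending-unique d e p = Pointwise-≡⇒≡ (Sorted.↗↭↗⇒≋ (Flip.totalOrder ≤-totalOrder) d e (↭⇒↭ₛ p))
  where open import Data.List.Relation.Binary.Permutation.Propositional using (↭⇒↭ₛ)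

initial↭desc : ∀ n → map suc (upTo n) ↭ desc n
initial↭desc n = ↭-trans (↭-sym (↭-reverse (map suc (upTo n)))) (↭-reflexive (reverse≡desc n))
  where open import Data.List.Relation.Binary.Permutation.Propositional.Properties using (↭-reverse)

-- Every chain of the weak order extends to the top: sorting into decreasing order uses ascents
-- only, and the decreasing arrangement is unique.
completion : ∀ {n w l} → Asc (map suc (upTo n)) w l → ∃ λ v → Asc (map suc (upTo n)) (w ++ v) (desc n)
completion {n} {w} {l} a with sort-desc l
... | v , l′ , b , d = v , subst (Asc (map suc (upTo n)) (w ++ v)) (descending-unique d (desc-descending n) (↭-trans (↭-sym (Asc⇒↭ (Asc-++ a b))) (initial↭desc n))) (Asc-++ a b)

-- One-line notation read by levels

at : ℕ → List ℕ → ℕ → ℕ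
at d [] p = d
at d (x ∷ l) zero = x
at d (x ∷ l) (suc p) = at d l p

-- label d l h is the entry of l at level h ≥ 1, with d beyond the end of l and 0 at the junk level 0.
label : ℕ → List ℕ → ℕ → ℕ
label d l = at d (0 ∷ l)

at-++ʳ : ∀ d l m p → at d (l ++ m) (length l + p) ≡ at d m p
at-++ʳ d [] m p = refl
at-++ʳ d (x ∷ l) m p = at-++ʳ d l m p

src-suc : ∀ h p → src (cross (suc h)) (suc p) ≡ suc (src (cross h) p)
src-suc h p with p ≟ h
... | yes refl = cross-upper id (suc p)
... | no a with p ≟ suc h
...   | yes refl = cross-lower id (suc h)
...   | no b = cross-other id (suc h) (a ∘ suc-injective) (b ∘ suc-injective)

at-Cross : ∀ d {i l l′} → Cross (suc i) l l′ → ∀ p → at d l′ p ≡ at d l (src (cross i) p)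
at-Cross d (here _) zero = refl
at-Cross d (here _) (suc zero) = refl
at-Cross d (here _) (suc (suc p)) = refl
at-Cross d (there c) zero = refl
at-Cross d (there {i} {x} {l} {l′} c) (suc p) = trans (at-Cross d c p) (sym (cong (at d (x ∷ l)) (src-suc i p)))

label-Cross : ∀ d {i l l′} → Cross i l l′ → ∀ p → label d l′ p ≡ label d l (src (cross i) p)
label-Cross d {suc i} {l} {l′} c zero = refl
label-Cross d {suc i} {l} {l′} c (suc p) = trans (at-Cross d c p) (sym (cong (label d l) (src-suc i p)))

occ-yes : ∀ k w → occ k (k ∷ w) ≡ suc (occ k w)
occ-yes k w = cong length (filter-accept (k ≟_) refl)

occ-no : ∀ {k i} w → k ≢ i → occ k (i ∷ w) ≡ occ k w
occ-no {k} w ne = cong length (filter-reject (k ≟_) ne)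

occ-++ : ∀ k u v → occ k (u ++ v) ≡ occ k u + occ k v
occ-++ k u v = trans (cong length (filter-++ (k ≟_) u v)) (length-++ (filter (k ≟_) u))
  where open import Data.List.Properties using (filter-++; length-++)

-- From walks to reduced words

cross-exists : ∀ {d h l} → 1 ≤ h → suc h ≤ length l → label d l h < label d l (suc h) → ∃ λ l′ → Cross h l l′
cross-exists {h = suc zero} {x ∷ y ∷ l} _ _ lt = y ∷ x ∷ l , here lt
cross-exists {h = suc zero} {x ∷ []} _ (s≤s ()) lt
cross-exists {d} {h = suc (suc h)} {x ∷ l} _ (s≤s b) lt with cross-exists {d} {suc h} {l} (s≤s z≤n) b lt
... | l′ , c = x ∷ l′ , there c

levelK-cross-k : ∀ k → levelKStep k (cross k) ≡ 1
levelK-cross-k k with k ≟ k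
... | yes _ = refl
... | no ne = contradiction refl ne

levelK-cross≢ : ∀ {k h} → h ≢ k → levelKStep k (cross h) ≡ 0
levelK-cross≢ {k} {h} ne with h ≟ k
... | yes e = contradiction e ne
... | no _ = refl

levelK-fall-≤ : ∀ {k h} → h ≤ k → levelKStep k (fall h) ≡ 1
levelK-fall-≤ {k} {h} le with h ≤? k
... | yes _ = refl
... | no ¬p = contradiction le ¬p

levelK-cross-word : ∀ k h w {n} → n ≤ occ k w → levelKStep k (cross h) + n ≤ occ k (h ∷ w)
levelK-cross-word k h w le with h ≟ k
... | yes refl = ≤-trans (s≤s le) (≤-reflexive (sym (occ-yes k w)))
... | no ne = ≤-trans le (≤-reflexive (sym (occ-no w (ne ∘ sym))))

Asc-length : ∀ {l w l′} → Asc l w l′ → length l′ ≡ length l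
Asc-length [] = refl
Asc-length (c ∷ a) = trans (Asc-length a) (proj₂ (proj₂ (Cross-range c)))

module _ (k d : ℕ) where

  -- The first m levels of π are ordered like those of l, where the fallen wires occupy the levels beyond m.
  Follows : ℕ → State → List ℕ → Set
  Follows m π l = ∀ p q → 1 ≤ p → p ≤ m → 1 ≤ q → q ≤ m → π p < π q → label d l p < label d l q

  follows-cong : ∀ {m π ρ l} → π ≗ ρ → Follows m π l → Follows m ρ l
  follows-cong e f p q a b c g lt = f p q a b c g (subst₂ _<_ (sym (e p)) (sym (e q)) lt)

  src-cross-range : ∀ {h m p} → 1 ≤ h → suc h ≤ m → 1 ≤ p → p ≤ m → 1 ≤ src (cross h) p × src (cross h) p ≤ m
  src-cross-range {h} {m} {p} a b c e with p ≟ h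
  ... | yes _ = s≤s z≤n , b
  ... | no _ with p ≟ suc h
  ...   | yes _ = a , <⇒≤ b
  ...   | no _ = c , e

  follows-cross : ∀ {m π l l′ h} → 1 ≤ h → suc h ≤ m → Cross h l l′ → Follows m π l → Follows m (next (cross h) π) l′
  follows-cross {m} {π} {l} {l′} {h} a b cr f p q p1 pm q1 qm lt with src-cross-range a b p1 pm | src-cross-range a b q1 qm
  ... | x , y | z , t = subst₂ _<_ (sym (label-Cross d cr p)) (sym (label-Cross d cr q))
          (f _ _ x y z t (subst₂ _<_ (applyStep-src π (cross h) p) (applyStep-src π (cross h) q) lt))

  follows-last : ∀ {m π l} → Inj π → Follows (suc m) π l → Follows m (next (fall (suc m)) π) l
  follows-last {m} {π} {l} inj f p q p1 pm q1 qm lt = f p q p1 (m≤n⇒m≤1+n pm) q1 (m≤n⇒m≤1+n qm)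
    (lower-reflects-< (π (suc m)) (λ e → contradiction (inj e) (<⇒≢ (s≤s qm)))
      (subst₂ (λ a b → lower (π (suc m)) a < lower (π (suc m)) b) (fall-above π (suc m) (s≤s pm)) (fall-above π (suc m) (s≤s qm)) lt))

  -- In Sₙ a fall becomes `j` crossings that carry the wire down to level m + 1, where it is parked
  -- while the first m levels go on. Starting at or above level k and ending below it, the wire
  -- passes level k.
  fall-word : ∀ j {h m π l} → h + j ≡ suc m → 1 ≤ h → suc m ≤ length l → Inj π → (∀ q → h < q → π h < π q) → Follows (suc m) π l →
              ∃ λ w → ∃ λ l′ → Asc l w l′ × Follows m (next (fall h) π) l′ × (h ≤ k → k ≤ m → 1 ≤ occ k w)
  fall-word zero {h} {m} {π} {l} e 1≤h len inj low f with trans (sym (+-identityʳ h)) e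
  ... | refl = [] , l , [] , follows-last {π = π} {l} inj f , λ a b → contradiction (≤-trans a b) 1+n≰n
  fall-word (suc j) {h} {m} {π} {l} e 1≤h len inj low f = h ∷ proj₁ rest , proj₁ (proj₂ rest) , cr ∷ proj₁ (proj₂ (proj₂ rest)) ,
      follows-cong {l = proj₁ (proj₂ rest)} (fall-after-cross π h) (proj₁ (proj₂ (proj₂ (proj₂ rest)))) , level
    where
    h<m : suc h ≤ suc m
    h<m = ≤-trans (≤-reflexive (sym (+-comm h 1))) (≤-trans (+-monoʳ-≤ h (s≤s z≤n)) (≤-reflexive e))
    crossed = cross-exists {d} {h} {l} 1≤h (≤-trans h<m len) (f h (suc h) 1≤h (<⇒≤ h<m) (s≤s z≤n) h<m (low (suc h) ≤-refl))
    l₁ = proj₁ crossed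
    cr = proj₂ crossed
    rest = fall-word j {suc h} {m} {next (cross h) π} {l₁} (trans (sym (+-suc h j)) e) (s≤s z≤n)
             (≤-trans len (≤-reflexive (sym (proj₂ (proj₂ (Cross-range cr)))))) (next-injective (cross h) inj)
             (λ q lt → subst₂ _<_ (sym (cross-lower π h)) (sym (cross-other π h (≢-sym (<⇒≢ (<-trans ≤-refl lt))) (≢-sym (<⇒≢ lt)))) (low q (<-trans ≤-refl lt)))
             (follows-cross {π = π} 1≤h h<m cr f)
    level : h ≤ k → k ≤ m → 1 ≤ occ k (h ∷ proj₁ rest)
    level a b with h ≟ k
    ... | yes refl = ≤-trans (s≤s z≤n) (≤-reflexive (sym (occ-yes k (proj₁ rest))))
    ... | no ne = ≤-trans (proj₂ (proj₂ (proj₂ (proj₂ rest))) (≤∧≢⇒< a ne) b) (≤-reflexive (sym (occ-no (proj₁ rest) (ne ∘ sym))))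

  -- Each fall uses up one of the m levels, and the bound keeps 2k of them to the end. That is
  -- enough, since all steps of a walk take place at levels below 2k.
  walk-word : ∀ {v m π l} → 1 ≤ k → Good k π → Walk k π v → k + k + tot isFall v ≤ m → m ≤ length l → Follows m π l →
              ∃ λ w → ∃ λ l′ → Asc l w l′ × tot (levelKStep k) v ≤ occ k w
  walk-word {l = l} 1≤k g [] le len f = [] , l , [] , z≤n
  walk-word {cross h ∷ v} {m} {π} {l} 1≤k g (o ∷ ws) le len f
    with cross-exists {d} {h} {l} (proj₁ o) (≤-trans h<m len) (f h (suc h) (proj₁ o) (<⇒≤ h<m) (s≤s z≤n) h<m (proj₁ (proj₂ o)))
    where
    h<m : suc h ≤ m
    h<m = ≤-trans (Ok-bounded (cross h) 1≤k g o) (≤-trans (m≤m+n _ _) le)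
  ... | l₁ , cr with walk-word {v} {m} {next (cross h) π} {l₁} 1≤k (Good-next (cross h) g o) ws le (≤-trans len (≤-reflexive (sym (proj₂ (proj₂ (Cross-range cr))))))
                       (follows-cross {π = π} (proj₁ o) (≤-trans (Ok-bounded (cross h) 1≤k g o) (≤-trans (m≤m+n _ _) le)) cr f)
  ...   | w , l′ , a , b = h ∷ w , l′ , cr ∷ a , levelK-cross-word k h w b
  walk-word {fall h ∷ v} {zero} 1≤k g (o ∷ ws) le len f = contradiction (≤-trans (≤-trans (m≤n+m 1 _) (+-monoʳ-≤ (k + k) (s≤s z≤n))) le) λ ()
  walk-word {fall h ∷ v} {suc m} {π} {l} 1≤k g (o ∷ ws) le len f
    with fall-word (suc m ∸ h) {h} {m} {π} {l} (m+[n∸m]≡n (<⇒≤ h<m)) (proj₁ o) len (Good.inj g) (proj₁ (proj₂ o)) f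
    where
    h<m : h < suc m
    h<m = ≤-trans (Ok-bounded (fall h) 1≤k g o) (≤-trans (m≤m+n _ _) le)
  ... | w , l₁ , a , f′ , lev with walk-word {v} {m} {next (fall h) π} {l₁} 1≤k (Good-next (fall h) g o) ws room
                                      (≤-trans (n≤1+n m) (≤-trans len (≤-reflexive (sym (Asc-length a))))) f′
    where
    room : k + k + tot isFall v ≤ m
    room = ≤-pred (≤-trans (≤-reflexive (sym (+-suc (k + k) _))) le)
  ...   | w′ , l′ , b , c = w ++ w′ , l′ , Asc-++ a b , ≤-trans (+-mono-≤ lev′ c) (≤-reflexive (sym (occ-++ k w w′)))
    where
    k≤m : k ≤ m
    k≤m = ≤-trans (m≤m+n k k) (≤-trans (m≤m+n _ _) (≤-pred (≤-trans (≤-reflexive (sym (+-suc (k + k) _))) le)))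
    lev′ : levelKStep k (fall h) ≤ occ k w
    lev′ with h ≤? k
    ... | yes p = lev p k≤m
    ... | no _ = z≤n

at-applyUpTo : ∀ d (f : ℕ → ℕ) n p → p < n → at d (applyUpTo f n) p ≡ f p
at-applyUpTo d f (suc n) zero lt = refl
at-applyUpTo d f (suc n) (suc p) (s≤s lt) = at-applyUpTo d (f ∘ suc) n p lt

label-initial : ∀ d n p → p ≤ n → label d (map suc (upTo n)) p ≡ p
label-initial d n p le = trans (cong (λ l → label d l p) (map-upTo suc n)) (at-applyUpTo d id (suc n) p (s≤s le))

walk⇒reduced-word : ∀ {k n v} → 1 ≤ k → Walk k id v → k + k + tot isFall v ≤ n →
                    ∃ λ w → IsReducedWordW0 n w × tot (levelKStep k) v ≤ occ k w
walk⇒reduced-word {k} {n} {v} 1≤k ws le with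
  walk-word k 0 {v} {n} {id} {map suc (upTo n)} 1≤k (Good-id 1≤k) ws le (≤-reflexive (sym (trans (length-map suc (upTo n)) (length-upTo n))))
    (λ p q _ pn _ qn lt → subst₂ _<_ (sym (label-initial 0 n p pn)) (sym (label-initial 0 n q qn)) lt)
... | w , l , a , b with completion a
...   | u , c = w ++ u , Asc⇒reduced c , ≤-trans b (≤-trans (m≤m+n _ _) (≤-reflexive (sym (occ-++ k w u))))

repeat : ℕ → List Step → List Step
repeat zero v = []
repeat (suc r) v = v ++ repeat r v

Walk-repeat : ∀ {k π v} r → Walk k π v → run π v ≗ π → Walk k π (repeat r v)
Walk-repeat zero w e = []
Walk-repeat (suc r) w e = Walk-++ w (Walk-cong (sym ∘ e) (Walk-repeat r w e))

tot-repeat : ∀ (f : Step → ℕ) r v → tot f (repeat r v) ≡ r * tot f v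
tot-repeat f zero v = refl
tot-repeat f (suc r) v = trans (tot-++ f v (repeat r v)) (cong (tot f v +_) (tot-repeat f r v))

-- From reduced words to walks

lower-suc : ∀ r {v} → v ≢ r → v ≢ suc r → lower (suc r) v ≡ lower r v
lower-suc r {v} a b with <-cmp v r
... | tri< l _ _ = trans (lower-≤ (suc r) v (m≤n⇒m≤1+n (<⇒≤ l))) (sym (lower-≤ r v (<⇒≤ l)))
... | tri≈ _ e _ = contradiction e a
... | tri> _ _ l = trans (lower-> (suc r) v (≤∧≢⇒< l (b ∘ sym))) (sym (lower-> r v l))

-- Neighbours in level and in rank are indistinguishable to all other wires, so after
-- standardisation it does not matter which of the two has fallen.
fall-adjacent : ∀ (π : State) h → Inj π → π (suc h) ≡ suc (π h) → next (fall (suc h)) π ≗ next (fall h) π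
fall-adjacent π h inj e l = trans (cong (λ r → lower r (applyStep π (fall (suc h)) l)) e) (go (<-cmp l h))
  where
  same : ∀ {x} → x ≢ h → x ≢ suc h → lower (suc (π h)) (π x) ≡ lower (π h) (π x)
  same a b = lower-suc (π h) (a ∘ inj) (λ z → b (inj (trans z (sym e))))
  go : Tri (l < h) (l ≡ h) (l > h) → lower (suc (π h)) (applyStep π (fall (suc h)) l) ≡ lower (π h) (applyStep π (fall h) l)
  go (tri< p _ _) = trans (cong (lower (suc (π h))) (fall-above π (suc h) (m<n⇒m<1+n p)))
    (trans (same (<⇒≢ p) (<⇒≢ (m<n⇒m<1+n p))) (cong (lower (π h)) (sym (fall-above π h p))))
  go (tri≈ _ refl _) = trans (cong (lower (suc (π h))) (fall-above π (suc h) ≤-refl))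
    (trans (lower-≤ (suc (π h)) (π h) (n≤1+n _))
      (sym (trans (cong (lower (π h)) (trans (fall-below π h ≤-refl) e)) (lower-> (π h) (suc (π h)) ≤-refl))))
  go (tri> _ _ p) = trans (cong (lower (suc (π h))) (fall-below π (suc h) p))
    (trans (same (≢-sym (<⇒≢ (m<n⇒m<1+n p))) (≢-sym (<⇒≢ (s≤s p)))) (cong (lower (π h)) (sym (fall-below π h (<⇒≤ p)))))

-- Beyond level 2k the state is the identity, and standardisation closes the gap. A wire that has
-- descended so far is deleted without any step, where `sink` ends.
fall-beyond : ∀ {k π} → Good k π → ∀ p → k + k ≤ p → π ≗ next (fall p) π
fall-beyond {k} {π} g p b l = sym (trans (cong (λ r → lower r (applyStep π (fall p) l)) fp) (go (l <? p)))
  where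
  fp = Good-fixes g p b
  go : Dec (l < p) → lower p (applyStep π (fall p) l) ≡ π l
  go (yes l<p) = trans (cong (lower p) (fall-above π p l<p)) (lower-≤ p (π l) small)
    where
    small : π l ≤ p
    small with π l ≤? p
    ... | yes q = q
    ... | no ¬q = contradiction (Good.inj g (Good-fixes g (π l) (≤-trans b (<⇒≤ (≰⇒> ¬q))))) (λ e → ¬q (subst (_≤ p) (sym e) (<⇒≤ l<p)))
  go (no l≮p) = trans (cong (lower p) (trans (fall-below π p (≮⇒≥ l≮p)) (Good-fixes g (suc l) (≤-trans b (m≤n⇒m≤1+n (≮⇒≥ l≮p))))))
    (trans (lower-> p (suc l) (s≤s (≮⇒≥ l≮p))) (sym (Good-fixes g l (≤-trans b (≮⇒≥ l≮p)))))

module _ {k : ℕ} (1≤k : 1 ≤ k) where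

  private
    L F : List Step → ℕ
    L = tot (levelKStep k)
    F = tot isFall

  record Sunk (π : State) (p : ℕ) : Set where
    constructor sunk
    field
      moves : List Step
      walk : Walk k π moves
      effect : run π moves ≗ next (fall p) π
      level : p ≡ k → 1 ≤ L moves
      one-fall : F moves ≤ 1

  -- Deleting the wire at level p up to standardisation. If its successor in rank lies below it, falling would
  -- violate (S1), so the wire first moves down next to the successor, and the successor is deleted in its place.
  sink : ∀ fuel p {π} → k + k ≤ fuel + p → 1 ≤ p → Good k π → (∀ q → p < q → π p < π q) → Sunk π p
  sink zero p {π} b 1≤p g low = sunk [] [] (fall-beyond g p b) (λ { refl → contradiction b (<⇒≱ (m<m+n k 1≤k)) }) z≤n
  sink (suc fuel) p {π} b 1≤p g low = go (π (suc p) ≟ suc (π p)) (p ≟ k) (surj (suc (π p)))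
    where
    open Good g
    b′ : k + k ≤ fuel + suc p
    b′ = ≤-trans b (≤-reflexive (sym (+-suc fuel p)))
    fall-now : (∀ l → p < l → π l ≡ suc (π p) → l ≡ suc k) → Sunk π p
    fall-now nx = sunk (fall p ∷ []) ((1≤p , low , nx) ∷ []) (λ _ → refl)
      (λ { refl → ≤-trans (≤-reflexive (sym (levelK-fall-≤ {k} ≤-refl))) (m≤m+n _ 0) }) ≤-refl
    go : Dec (π (suc p) ≡ suc (π p)) → Dec (p ≡ k) → (∃ λ r → π r ≡ suc (π p)) → Sunk π p
    go (yes adj) (yes refl) _ = fall-now λ l _ e → inj (trans e (sym adj))
    go (yes adj) (no p≢k) _ with sink fuel (suc p) b′ (s≤s z≤n) g low′
      where
      low′ : ∀ q → suc p < q → π (suc p) < π q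
      low′ q l = ≤∧≢⇒< (≤-trans (≤-reflexive adj) (low q (<-trans ≤-refl l))) (λ e → <⇒≢ l (inj e))
    ... | sunk w ws e lv one = sunk w ws (λ l → trans (e l) (fall-adjacent π p inj adj l)) (λ z → contradiction z p≢k) one
    go (no ¬adj) _ (r , r-rank) with <-cmp r p
    ... | tri< r<p _ _ = fall-now λ l p<l e → contradiction (inj (trans e (sym r-rank))) (≢-sym (<⇒≢ (<-trans r<p p<l)))
    ... | tri≈ _ refl _ = contradiction r-rank (≢-sym 1+n≢n)
    ... | tri> _ _ p<r = descend (sink fuel (suc p) b′ (s≤s z≤n) (Good-next (cross p) g ok) low′)
      where
      p+1<r : suc p < r
      p+1<r = ≤∧≢⇒< p<r (λ { refl → ¬adj r-rank })
      x<y : π p < π (suc p)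
      x<y = low (suc p) ≤-refl
      x+1<y : suc (π p) < π (suc p)
      x+1<y = ≤∧≢⇒< x<y (¬adj ∘ sym)
      -- All wires above level p that are larger than this wire are larger than its successor too,
      -- and so is the wire at level p + 1; all of them lie above the successor. The bound that the
      -- successor obeys therefore permits one more overtaking here.
      count : suc (overtaken π p) ≤ overtaken π r
      count = begin
        suc (above π (π p) p) ≤⟨ s≤s (above-mono p (λ q q<p x<q → ≤∧≢⇒< x<q (λ e → <⇒≢ (<-trans q<p p<r) (inj (trans (sym e) (sym r-rank)))))) ⟩
        suc (above π (suc (π p)) p) ≡⟨ cong suc (above-no π (suc (π p)) p (n≤1+n _)) ⟨
        suc (above π (suc (π p)) (suc p)) ≡⟨ above-yes π (suc (π p)) (suc p) x+1<y ⟨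
        above π (suc (π p)) (suc (suc p)) ≤⟨ above-length-mono π (suc (π p)) p+1<r ⟩
        above π (suc (π p)) r ≡⟨ cong (λ v → above π v r) r-rank ⟨
        overtaken π r ∎
        where open ≤-Reasoning
      ok : Ok k π (cross p)
      ok = 1≤p , x<y , inj₂ ¬adj , ≤-<-trans count (overtaken< r)
      low′ : ∀ q → suc p < q → next (cross p) π (suc p) < next (cross p) π q
      low′ q l = subst₂ _<_ (sym (cross-lower π p)) (sym (cross-other π p (≢-sym (<⇒≢ (<-trans ≤-refl l))) (≢-sym (<⇒≢ l)))) (low q (<-trans ≤-refl l))
      descend : Sunk (next (cross p) π) (suc p) → Sunk π p
      descend (sunk w ws e lv one) = sunk (cross p ∷ w) (ok ∷ ws) (λ l → trans (e l) (fall-after-cross π p l))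
        (λ { refl → ≤-trans (≤-reflexive (sym (levelK-cross-k k))) (m≤m+n _ _) }) one

  -- The weak order, with positions as arguments.
  Below : State → State → Set
  Below τ g = ∀ p q → p < q → τ q < τ p → g q < g p

  below-cong : ∀ {τ τ′ g g′} → τ ≗ τ′ → g ≗ g′ → Below τ g → Below τ′ g′
  below-cong e f B p q lt inv = subst₂ _<_ (f q) (f p) (B p q lt (subst₂ _<_ (sym (e q)) (sym (e p)) inv))

  below-cross : ∀ {τ g} h → g h < g (suc h) → Below τ g → Below (next (cross h) τ) (applyStep g (cross h))
  below-cross {τ} {g} h lt B p q p<q inv = go (p ≟ h) (q ≟ suc h)
    where
    by-src : ¬ (p ≡ h × q ≡ suc h) → applyStep g (cross h) q < applyStep g (cross h) p
    by-src ne = subst₂ _<_ (sym (applyStep-src g (cross h) q)) (sym (applyStep-src g (cross h) p))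
      (B _ _ (src-cross-< h p<q ne) (subst₂ _<_ (applyStep-src τ (cross h) q) (applyStep-src τ (cross h) p) inv))
    go : Dec (p ≡ h) → Dec (q ≡ suc h) → applyStep g (cross h) q < applyStep g (cross h) p
    go (yes refl) (yes refl) = subst₂ _<_ (sym (cross-lower g h)) (sym (cross-upper g h)) lt
    go (no a) _ = by-src (a ∘ proj₁)
    go (yes _) (no b) = by-src (b ∘ proj₂)

  -- The case in which the word crosses and the walk stands still, as (S1) demands. An inversion of
  -- `τ` involves at most one of the two levels, and there either level may stand for the other.
  below-skip : ∀ {τ g} h → Inj τ → τ (suc h) ≡ suc (τ h) → Below τ g → Below τ (applyStep g (cross h))
  below-skip {τ} {g} h inj adj B p q p<q inv =
    subst₂ _<_ (sym (applyStep-src g (cross h) q)) (sym (applyStep-src g (cross h) p)) (B _ _ (src-cross-< h p<q ne) (go (p ≟ h) (p ≟ suc h) (q ≟ h) (q ≟ suc h)))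
    where
    ne : ¬ (p ≡ h × q ≡ suc h)
    ne (refl , refl) = <-asym inv (subst (τ h <_) (sym adj) ≤-refl)
    -- Consecutive ranks compare alike with any third rank.
    up : ∀ {x} → τ x < τ (suc h) → x ≢ h → τ x < τ h
    up {x} l x≢h = ≤∧≢⇒< (≤-pred (subst (τ x <_) adj l)) (x≢h ∘ inj)
    down : ∀ {x} → τ h < τ x → x ≢ suc h → τ (suc h) < τ x
    down l x≢ = ≤∧≢⇒< (≤-trans (≤-reflexive adj) l) (λ e → x≢ (sym (inj e)))
    τ< : τ h < τ (suc h)
    τ< = subst (τ h <_) (sym adj) ≤-refl
    go : Dec (p ≡ h) → Dec (p ≡ suc h) → Dec (q ≡ h) → Dec (q ≡ suc h) → τ (src (cross h) q) < τ (src (cross h) p)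
    go (yes refl) _ (yes refl) _ = contradiction p<q (<-irrefl refl)
    go (yes refl) _ _ (yes refl) = contradiction (refl , refl) ne
    go (yes refl) _ (no a) (no b) = subst₂ (λ x y → τ x < τ y) (sym (cross-other id h a b)) (sym (cross-upper id h)) (<-trans inv τ<)
    go (no a) (yes refl) (yes refl) _ = contradiction p<q (<-asym ≤-refl)
    go (no a) (yes refl) _ (yes refl) = contradiction p<q (<-irrefl refl)
    go (no a) (yes refl) (no c) (no d) = subst₂ (λ x y → τ x < τ y) (sym (cross-other id h c d)) (sym (cross-lower id h)) (up inv c)
    go (no a) (no b) (yes refl) _ = subst₂ (λ x y → τ x < τ y) (sym (cross-upper id h)) (sym (cross-other id h a b)) (down inv b)
    go (no a) (no b) (no _) (yes refl) = subst₂ (λ x y → τ x < τ y) (sym (cross-lower id h)) (sym (cross-other id h a b)) (<-trans τ< inv)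
    go (no a) (no b) (no c) (no d) = subst₂ (λ x y → τ x < τ y) (sym (cross-other id h c d)) (sym (cross-other id h a b)) inv

  below-fall : ∀ {τ g} h → Inj τ → Below τ g → Below (next (fall h) τ) (applyStep g (fall h))
  below-fall {τ} {g} h inj B p q p<q inv =
    subst₂ _<_ (sym (applyStep-src g (fall h) q)) (sym (applyStep-src g (fall h) p))
      (B _ _ (src-fall-< h p<q) (subst₂ _<_ (applyStep-src τ (fall h) q) (applyStep-src τ (fall h) p)
        (lower-reflects-< (τ h) (fall≢ {τ} inj h p) inv)))

-- Entries with fewer than k larger ones before them

larger : ℕ → List ℕ → ℕ
larger x [] = 0
larger x (y ∷ l) with x <? y
... | yes _ = suc (larger x l)
... | no _ = larger x l

larger-yes : ∀ {x y} l → x < y → larger x (y ∷ l) ≡ suc (larger x l)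
larger-yes {x} {y} l p with x <? y
... | yes _ = refl
... | no ¬p = contradiction p ¬p

larger-no : ∀ {x y} l → y ≤ x → larger x (y ∷ l) ≡ larger x l
larger-no {x} {y} l p with x <? y
... | yes q = contradiction q (≤⇒≯ p)
... | no _ = refl

larger-antitone : ∀ {x z} l → z ≤ x → larger x l ≤ larger z l
larger-antitone [] le = z≤n
larger-antitone {x} {z} (y ∷ l) le with x <? y
... | yes p rewrite larger-yes l (≤-<-trans le p) = s≤s (larger-antitone l le)
... | no _ with z <? y
...   | yes _ = m≤n⇒m≤1+n (larger-antitone l le)
...   | no _ = larger-antitone l le

larger≤length : ∀ x l → larger x l ≤ length l
larger≤length x [] = z≤n
larger≤length x (y ∷ l) with x <? y
... | yes _ = s≤s (larger≤length x l)
... | no _ = m≤n⇒m≤1+n (larger≤length x l)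

larger-cons-cong : ∀ z y {a b} → larger z a ≡ larger z b → larger z (y ∷ a) ≡ larger z (y ∷ b)
larger-cons-cong z y {a} {b} e with z <? y
... | yes p = cong suc e
... | no p = e

larger-∷ : ∀ x y l → larger x (y ∷ l) ≡ ind x y + larger x l
larger-∷ x y l with x <? y
... | yes _ = refl
... | no _ = refl

larger-grows : ∀ x y l → larger x l ≤ larger x (y ∷ l)
larger-grows x y l = ≤-trans (m≤n+m _ (ind x y)) (≤-reflexive (sym (larger-∷ x y l)))

larger-swap : ∀ z x y a → larger z (y ∷ x ∷ a) ≡ larger z (x ∷ y ∷ a)
larger-swap z x y a = begin
  larger z (y ∷ x ∷ a) ≡⟨ trans (larger-∷ z y (x ∷ a)) (cong (ind z y +_) (larger-∷ z x a)) ⟩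
  ind z y + (ind z x + larger z a) ≡⟨ x∙yz≈y∙xz (ind z y) (ind z x) (larger z a) ⟩
  ind z x + (ind z y + larger z a) ≡⟨ trans (larger-∷ z x (y ∷ a)) (cong (ind z x +_) (larger-∷ z y a)) ⟨
  larger z (x ∷ y ∷ a) ∎
  where open ≡-Reasoning
        open import Algebra.Properties.CommutativeSemigroup +-commutativeSemigroup

-- This is `reverse u ++ acc`: the accumulator of `alive` after `u` has been read.
push : List ℕ → List ℕ → List ℕ
push acc [] = acc
push acc (x ∷ u) = push (x ∷ acc) u

module _ (k : ℕ) where

  -- The entries of l with fewer than k larger entries before them, where acc is read before l. The others
  -- stay below level k for good.
  alive : List ℕ → List ℕ → List ℕ
  alive acc [] = []
  alive acc (x ∷ l) with larger x acc <? k
  ... | yes _ = x ∷ alive (x ∷ acc) l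
  ... | no _ = alive (x ∷ acc) l

  alive-yes : ∀ {acc x} l → larger x acc < k → alive acc (x ∷ l) ≡ x ∷ alive (x ∷ acc) l
  alive-yes {acc} {x} l p with larger x acc <? k
  ... | yes _ = refl
  ... | no ¬p = contradiction p ¬p

  alive-no : ∀ {acc x} l → k ≤ larger x acc → alive acc (x ∷ l) ≡ alive (x ∷ acc) l
  alive-no {acc} {x} l p with larger x acc <? k
  ... | yes q = contradiction q (≤⇒≯ p)
  ... | no _ = refl

  alive-++ : ∀ acc u v → alive acc (u ++ v) ≡ alive acc u ++ alive (push acc u) v
  alive-++ acc [] v = refl
  alive-++ acc (x ∷ u) v with larger x acc <? k
  ... | yes _ = cong (x ∷_) (alive-++ (x ∷ acc) u v)
  ... | no _ = alive-++ (x ∷ acc) u v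

  alive-cong : ∀ {a b} l → (∀ z → larger z a ≡ larger z b) → alive a l ≡ alive b l
  alive-cong [] e = refl
  alive-cong {a} {b} (x ∷ l) e with larger x a <? k
  ... | yes p = trans (cong (x ∷_) (alive-cong l (λ z → larger-cons-cong z x (e z)))) (sym (alive-yes l (subst (_< k) (e x) p)))
  ... | no ¬p = trans (alive-cong l (λ z → larger-cons-cong z x (e z))) (sym (alive-no l (≮⇒≥ (¬p ∘ subst (_< k) (sym (e x))))))

  alive-All : ∀ acc l → All (λ z → larger z acc < k) (alive acc l)
  alive-All acc [] = []
  alive-All acc (x ∷ l) with larger x acc <? k
  ... | yes p = p ∷ All.map (λ {z} → ≤-<-trans (larger-grows z x acc)) (alive-All (x ∷ acc) l)
  ... | no _ = All.map (λ {z} → ≤-<-trans (larger-grows z x acc)) (alive-All (x ∷ acc) l)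

  -- Too few entries come before for any of these to have been overtaken k times. Hence a crossing
  -- of the word at level k is at level k among the alive entries as well.
  alive-short : ∀ acc u → length acc + length u ≤ k → alive acc u ≡ u
  alive-short acc [] le = refl
  alive-short acc (x ∷ u) le = trans (alive-yes u (≤-<-trans (larger≤length x acc) (≤-trans (≤-trans (s≤s (m≤m+n _ _)) (≤-reflexive (sym (+-suc (length acc) _)))) le)))
    (cong (x ∷_) (alive-short (x ∷ acc) u (≤-trans (≤-reflexive (sym (+-suc (length acc) _))) le)))

  larger-alive : ∀ x acc u → larger x (alive acc u) + larger x acc ≤ larger x (push acc u)
  larger-alive x acc [] = ≤-refl
  larger-alive x acc (y ∷ u) with larger y acc <? k
  ... | yes _ = ≤-trans (≤-reflexive (begin
    larger x (y ∷ alive (y ∷ acc) u) + larger x acc ≡⟨ cong (_+ larger x acc) (larger-∷ x y (alive (y ∷ acc) u)) ⟩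
    ind x y + larger x (alive (y ∷ acc) u) + larger x acc ≡⟨ xy∙z≈y∙xz (ind x y) (larger x (alive (y ∷ acc) u)) (larger x acc) ⟩
    larger x (alive (y ∷ acc) u) + (ind x y + larger x acc) ≡⟨ cong (larger x (alive (y ∷ acc) u) +_) (larger-∷ x y acc) ⟨
    larger x (alive (y ∷ acc) u) + larger x (y ∷ acc) ∎)) (larger-alive x (y ∷ acc) u)
    where open ≡-Reasoning
          open import Algebra.Properties.CommutativeSemigroup +-commutativeSemigroup
  ... | no _ = ≤-trans (+-monoʳ-≤ (larger x (alive (y ∷ acc) u)) (larger-grows x y acc)) (larger-alive x (y ∷ acc) u)

  alive≤length : ∀ acc l → length (alive acc l) ≤ length l
  alive≤length acc [] = z≤n
  alive≤length acc (x ∷ l) with larger x acc <? k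
  ... | yes _ = s≤s (alive≤length (x ∷ acc) l)
  ... | no _ = m≤n⇒m≤1+n (alive≤length (x ∷ acc) l)

above-at : ∀ d x l m → above (at d (l ++ m)) x (length l) ≡ larger x l
above-at d x [] m = refl
above-at d x (y ∷ l) m with x <? y
... | yes p = trans (above-head-yes (at d (y ∷ l ++ m)) x (length l) p) (cong suc (above-at d x l m))
... | no p = trans (above-head-no (at d (y ∷ l ++ m)) x (length l) (≮⇒≥ p)) (above-at d x l m)

Cross-split : ∀ {i l l′} → Cross i l l′ → ∃ λ u → ∃ λ x → ∃ λ y → ∃ λ v →
              l ≡ u ++ x ∷ y ∷ v × l′ ≡ u ++ y ∷ x ∷ v × i ≡ suc (length u) × x < y
Cross-split (here {x} {y} {l} p) = [] , x , y , l , refl , refl , refl , p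
Cross-split (there {x = z} c) with Cross-split c
... | u , x , y , v , refl , refl , e , p = z ∷ u , x , y , v , refl , refl , cong suc e , p

Cross-at : ∀ u {x y v} → x < y → Cross (suc (length u)) (u ++ x ∷ y ∷ v) (u ++ y ∷ x ∷ v)
Cross-at [] p = here p
Cross-at (z ∷ u) p = there (Cross-at u p)

src-fall-suc : ∀ h q → src (fall (suc h)) (suc q) ≡ suc (src (fall h) q)
src-fall-suc h q with q <? h
... | yes p = fall-above id (suc h) (s≤s p)
... | no ¬p = fall-below id (suc h) (s≤s (≮⇒≥ ¬p))

at-delete : ∀ d u x m q → at d (u ++ m) q ≡ at d (u ++ x ∷ m) (src (fall (length u)) q)
at-delete d [] x m q = refl
at-delete d (z ∷ u) x m zero = refl
at-delete d (z ∷ u) x m (suc q) = trans (at-delete d u x m q) (cong (at d (z ∷ u ++ x ∷ m)) (sym (src-fall-suc (length u) q)))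

at-All : ∀ {P : ℕ → Set} d l p → P d → All P l → P (at d l p)
at-All d [] p pd a = pd
at-All d (x ∷ l) zero pd (px ∷ a) = px
at-All d (x ∷ l) (suc p) pd (px ∷ a) = at-All d l p pd a

module _ {k : ℕ} (1≤k : 1 ≤ k) (d : ℕ) where

  -- The length of the alive list is a potential: a fall is paid for by an entry that leaves the
  -- list, which bounds the falls of the whole walk by n.
  record Simulation (π : State) (target : List ℕ) (budget : ℕ) (need : ℕ) : Set where
    constructor simulation
    field
      moves : List Step
      walk : Walk k π moves
      below : Below 1≤k (run π moves) (label d target)
      level : need ≤ tot (levelKStep k) moves
      spent : tot isFall moves + length target ≤ budget

  -- When x is overtaken for the k-th time, its counterpart in the simple diagram is deleted. The order of the
  -- counterparts stays below that of the alive entries, because skipping a crossing of consecutive ranks,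
  -- which (S1) forbids away from level k, keeps it there.
  simulate-cross : ∀ {π i l l′} → Good k π → Below 1≤k π (label d (alive k [] l)) → All (_≤ d) l → Cross i l l′ →
                   Simulation π (alive k [] l′) (length (alive k [] l)) (levelKStep k (cross i))
  simulate-cross {π} {i} g B le c with Cross-split c
  ... | u , x , y , v , refl , refl , refl , x<y = go (<-cmp (suc cx) k)
    where
    open Good g
    A = push [] u
    cx = larger x A
    ρu = alive k [] u
    ρv = alive k (y ∷ x ∷ A) v
    p = suc (length ρu)
    i′ = suc (length u)
    y≤x : larger y A ≤ larger x A
    y≤x = larger-antitone A (<⇒≤ x<y)
    low-level : i′ ≡ k → p ≡ k
    low-level e = trans (cong (suc ∘ length) (alive-short k [] u (≤-trans (n≤1+n _) (≤-reflexive e)))) e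
    ρv′ : alive k (x ∷ y ∷ A) v ≡ ρv
    ρv′ = alive-cong k v (λ z → larger-swap z y x A)
    larger-y : larger y (x ∷ A) ≡ larger y A
    larger-y = larger-no A (<⇒≤ x<y)
    larger-x : larger x (y ∷ A) ≡ suc cx
    larger-x = larger-yes A x<y

    module Alive (cx<k : cx < k) where
      y-alive : larger y A < k
      y-alive = ≤-<-trans y≤x cx<k
      before : alive k [] (u ++ x ∷ y ∷ v) ≡ ρu ++ x ∷ y ∷ ρv
      before = trans (alive-++ k [] u (x ∷ y ∷ v)) (cong (ρu ++_)
        (trans (alive-yes k (y ∷ v) cx<k) (cong (x ∷_) (alive-yes k v (subst (_< k) (sym larger-y) y-alive)))))
      G : State
      G = label d (ρu ++ x ∷ y ∷ ρv)
      B′ : Below 1≤k π G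
      B′ = subst (λ l → Below 1≤k π (label d l)) before B
      G-from : ∀ j → G (p + j) ≡ at d (x ∷ y ∷ ρv) j
      G-from j = at-++ʳ d ρu (x ∷ y ∷ ρv) j
      G-p : G p ≡ x
      G-p = trans (cong G (sym (+-identityʳ p))) (G-from 0)
      G-p+1 : G (suc p) ≡ y
      G-p+1 = trans (cong G (sym (+-comm p 1))) (G-from 1)
      π< : π p < π (suc p)
      π< with <-cmp (π p) (π (suc p))
      ... | tri< a _ _ = a
      ... | tri≈ _ a _ = contradiction (inj a) (<⇒≢ ≤-refl)
      ... | tri> _ _ a = contradiction (subst₂ _<_ G-p+1 G-p (B′ p (suc p) ≤-refl a)) (<-asym x<y)
      count : overtaken π p ≤ cx
      count = begin
        above π (π p) p ≤⟨ above-mono p (λ q q<p lt → subst (_< G q) G-p (B′ q p q<p lt)) ⟩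
        above G x (suc (length ρu)) ≡⟨ above-head-no G x (length ρu) z≤n ⟩
        above (at d (ρu ++ x ∷ y ∷ ρv)) x (length ρu) ≡⟨ above-at d x ρu (x ∷ y ∷ ρv) ⟩
        larger x ρu ≡⟨ +-identityʳ _ ⟨
        larger x ρu + 0 ≤⟨ larger-alive k x [] u ⟩
        cx ∎
        where open ≤-Reasoning

    go : Tri (suc cx < k) (suc cx ≡ k) (suc cx > k) →
         Simulation π (alive k [] (u ++ y ∷ x ∷ v)) (length (alive k [] (u ++ x ∷ y ∷ v))) (levelKStep k (cross i′))
    go (tri> _ _ dead) = simulation [] [] (subst (λ l → Below 1≤k π (label d l)) (sym same) B) quiet (≤-reflexive (cong length same))
      where
      k≤cx : k ≤ cx
      k≤cx = ≤-pred dead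
      same : alive k [] (u ++ y ∷ x ∷ v) ≡ alive k [] (u ++ x ∷ y ∷ v)
      same = trans (alive-++ k [] u (y ∷ x ∷ v)) (trans (cong (ρu ++_) (trans (head (larger y A <? k)) (sym (alive-no k (y ∷ v) k≤cx)))) (sym (alive-++ k [] u (x ∷ y ∷ v))))
        where
        tail : alive k (y ∷ A) (x ∷ v) ≡ ρv
        tail = trans (alive-no k v (≤-trans (m≤n⇒m≤1+n k≤cx) (≤-reflexive (sym larger-x)))) ρv′
        head : Dec (larger y A < k) → alive k A (y ∷ x ∷ v) ≡ alive k (x ∷ A) (y ∷ v)
        head (yes q) = trans (alive-yes k (x ∷ v) q) (trans (cong (y ∷_) tail) (sym (alive-yes k v (subst (_< k) (sym larger-y) q))))
        head (no q) = trans (alive-no k (x ∷ v) (≮⇒≥ q)) (trans tail (sym (alive-no k v (≤-trans (≮⇒≥ q) (≤-reflexive (sym larger-y))))))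
      length-push : ∀ acc w → length (push acc w) ≡ length acc + length w
      length-push acc [] = sym (+-identityʳ _)
      length-push acc (z ∷ w) = trans (length-push (z ∷ acc) w) (sym (+-suc (length acc) (length w)))
      -- At least k larger entries precede `x`, so this crossing lies deeper than level k and
      -- contributes nothing.
      quiet : levelKStep k (cross i′) ≤ 0
      quiet = ≤-reflexive (levelK-cross≢ {k} (λ e → <⇒≱ (≤-reflexive e) (≤-trans k≤cx (≤-trans (larger≤length x A) (≤-reflexive (length-push [] u))))))
    go (tri< few _ _) = choose (π (suc p) ≟ suc (π p)) (p ≟ k)
      where
      cx<k : cx < k
      cx<k = <-trans ≤-refl few
      open Alive cx<k
      after : alive k [] (u ++ y ∷ x ∷ v) ≡ ρu ++ y ∷ x ∷ ρv
      after = trans (alive-++ k [] u (y ∷ x ∷ v)) (cong (ρu ++_)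
        (trans (alive-yes k (x ∷ v) y-alive) (cong (y ∷_) (trans (alive-yes k v (subst (_< k) (sym larger-x) few)) (cong (x ∷_) ρv′)))))
      G′ : applyStep G (cross p) ≗ label d (alive k [] (u ++ y ∷ x ∷ v))
      G′ q = trans (applyStep-src G (cross p) q) (trans (sym (label-Cross d (Cross-at ρu x<y) q)) (cong (λ l → label d l q) (sym after)))
      lengths : length (alive k [] (u ++ y ∷ x ∷ v)) ≤ length (alive k [] (u ++ x ∷ y ∷ v))
      lengths = ≤-reflexive (trans (cong length after) (trans (length-++ ρu) (sym (trans (cong length before) (length-++ ρu)))))
      crossing : (p ≡ k ⊎ π (suc p) ≢ suc (π p)) → Simulation π (alive k [] (u ++ y ∷ x ∷ v)) (length (alive k [] (u ++ x ∷ y ∷ v))) (levelKStep k (cross i′))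
      crossing adj = simulation (cross p ∷ []) ((s≤s z≤n , π< , adj , ≤-<-trans (s≤s count) few) ∷ [])
        (below-cong 1≤k (λ _ → refl) G′ (below-cross 1≤k p (subst₂ _<_ (sym G-p) (sym G-p+1) x<y) B′)) level lengths
        where
        level : levelKStep k (cross i′) ≤ levelKStep k (cross p) + 0
        level with i′ ≟ k
        ... | no _ = z≤n
        ... | yes e = ≤-reflexive (sym (trans (+-identityʳ _) (trans (cong (λ z → levelKStep k (cross z)) (low-level e)) (levelK-cross-k k))))
      choose : Dec (π (suc p) ≡ suc (π p)) → Dec (p ≡ k) → Simulation π (alive k [] (u ++ y ∷ x ∷ v)) (length (alive k [] (u ++ x ∷ y ∷ v))) (levelKStep k (cross i′))
      choose _ (yes e) = crossing (inj₁ e)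
      choose (no ne) _ = crossing (inj₂ ne)
      -- By `low-level` the crossing of the word is not at level k either, so skipping it costs no
      -- intersection.
      choose (yes adj) (no p≢k) = simulation [] [] (below-cong 1≤k (λ _ → refl) G′ (below-skip 1≤k p inj adj B′))
        (≤-reflexive (levelK-cross≢ {k} (p≢k ∘ low-level))) lengths
    go (tri≈ _ dies _) = simulation moves walk
        (below-cong 1≤k (sym ∘ effect) G′ (below-fall 1≤k p inj B′)) level′ spent
      where
      cx<k : cx < k
      cx<k = ≤-reflexive dies
      open Alive cx<k
      after : alive k [] (u ++ y ∷ x ∷ v) ≡ ρu ++ y ∷ ρv
      after = trans (alive-++ k [] u (y ∷ x ∷ v)) (cong (ρu ++_)
        (trans (alive-yes k (x ∷ v) y-alive) (cong (y ∷_) (trans (alive-no k v (≤-reflexive (trans (sym dies) (sym larger-x)))) ρv′))))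
      G′ : applyStep G (fall p) ≗ label d (alive k [] (u ++ y ∷ x ∷ v))
      G′ zero = refl
      G′ (suc q) = trans (applyStep-src G (fall p) (suc q)) (trans (cong G (src-fall-suc (length ρu) q))
        (trans (sym (at-delete d ρu x (y ∷ ρv) q)) (cong (λ l → at d l q) (sym after))))
      -- An entry below x and smaller than x has x and the k − 1 entries that overtook x before it.
      rest : All (λ z → ¬ z < x) (y ∷ ρv)
      rest = <-asym x<y ∷ All.map (λ {z} al z<x → <⇒≱ al (≤-trans (≤-reflexive (sym dies)) (≤-trans (s≤s (larger-antitone A (<⇒≤ z<x)))
               (≤-trans (≤-reflexive (sym (larger-yes A z<x))) (≤-trans (n≤1+n _) (≤-reflexive (sym (larger-yes (x ∷ A) (<-trans z<x x<y)))))))))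
               (alive-All k (y ∷ x ∷ A) v)
      x≤d : x ≤ d
      x≤d = All.head (AllP.++⁻ʳ u le)
      low : ∀ q → p < q → π p < π q
      low q p<q with <-cmp (π p) (π q)
      ... | tri< a _ _ = a
      ... | tri≈ _ a _ = contradiction (inj a) (<⇒≢ p<q)
      ... | tri> _ _ a = contradiction (subst₂ _<_ G-q G-p (B′ p q p<q a)) (at-All d (y ∷ ρv) (q ∸ suc p) (≤⇒≯ x≤d) rest)
        where
        G-q : G q ≡ at d (y ∷ ρv) (q ∸ suc p)
        G-q = trans (cong G (trans (sym (m+[n∸m]≡n p<q)) (sym (+-suc p (q ∸ suc p))))) (G-from (suc (q ∸ suc p)))
      open Sunk (sink 1≤k (k + k) p (m≤m+n (k + k) p) (s≤s z≤n) g low)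
      level′ : levelKStep k (cross i′) ≤ tot (levelKStep k) moves
      level′ with i′ ≟ k
      ... | no _ = z≤n
      ... | yes e = level (low-level e)
      spent : tot isFall moves + length (alive k [] (u ++ y ∷ x ∷ v)) ≤ length (alive k [] (u ++ x ∷ y ∷ v))
      spent = ≤-trans (+-monoˡ-≤ _ one-fall) (≤-reflexive (trans (cong (suc ∘ length) after) (trans (cong suc (length-++ ρu))
        (sym (trans (cong length before) (trans (length-++ ρu) (+-suc (length ρu) _)))))))

  simulate : ∀ {π l w l′} → Good k π → Below 1≤k π (label d (alive k [] l)) → All (_≤ d) l → Asc l w l′ →
             ∃ λ v → Walk k π v × occ k w ≤ tot (levelKStep k) v × tot isFall v ≤ length (alive k [] l)
  simulate g B le [] = [] , [] , z≤n , z≤n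
  simulate {π} {l} {i ∷ w} g B le (c ∷ a) with simulate-cross g B le c
  ... | simulation u wu B′ lu fu with simulate (Good-run g wu) B′ (All-resp-↭ (Cross⇒↭ c) le) a
  ...   | v , wv , lv , fv = u ++ v , Walk-++ wu wv ,
          ≤-trans (≤-reflexive occ-cons) (≤-trans (+-mono-≤ lu lv) (≤-reflexive (sym (tot-++ (levelKStep k) u v)))) ,
          ≤-trans (≤-reflexive (tot-++ isFall u v)) (≤-trans (+-monoʳ-≤ (tot isFall u) fv) fu)
    where
    occ-cons : occ k (i ∷ w) ≡ levelKStep k (cross i) + occ k w
    occ-cons with i ≟ k
    ... | yes refl = occ-yes k w
    ... | no ne = occ-no w (ne ∘ sym)

reduced-word⇒walk : ∀ {k n w} → 1 ≤ k → IsReducedWordW0 n w →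
                    ∃ λ v → Walk k id v × occ k w ≤ tot (levelKStep k) v × tot isFall v ≤ n
reduced-word⇒walk {k} {n} {w} 1≤k red
  -- The label n for levels beyond the alive list is at least every entry, so no level beyond the
  -- list appears to be overtaken by an entry of it.
  with simulate 1≤k n (Good-id 1≤k) (λ p q p<q inv → contradiction p<q (<-asym inv)) bounds (reduced⇒Asc {n} red)
  where
  bounds : All (_≤ n) (map suc (upTo n))
  bounds = AllP.map⁺ (AllP.all-upTo n)
... | v , wv , lv , fv = v , wv , lv , ≤-trans fv (≤-trans (alive≤length k [] (map suc (upTo n))) (≤-reflexive (trans (length-map suc (upTo n)) (length-upTo n))))

-- The limit

open import Data.Integer using (+_; -[1+_]; +[1+_]; +<+; +≤+)
import Data.Integer as ℤ
import Data.Integer.Properties as ℤP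
open import Data.Rational using (ℚ; mkℚ; _/_; _-_; ∣_∣; 0ℚ; toℚᵘ; *<*) renaming (_<_ to _<ℚ_; _≤_ to _≤ℚ_)
import Data.Rational as ℚ
import Data.Rational.Properties as ℚP
open import Data.Rational.Unnormalised as ℚᵘ using (mkℚᵘ)
import Data.Rational.Unnormalised.Properties as ℚᵘP

fraction-≤ : ∀ a b c d (nb : NonZero b) (nd : NonZero d) → a * d ≤ c * b → ((+ a) / b) {{nb}} ≤ℚ ((+ c) / d) {{nd}}
fraction-≤ a (suc b) c (suc d) _ _ le = ℚP.toℚᵘ-cancel-≤
  (ℚᵘP.≤-respˡ-≃ (ℚᵘP.≃-sym (ℚP.toℚᵘ-fromℚᵘ (mkℚᵘ (+ a) b))) (ℚᵘP.≤-respʳ-≃ (ℚᵘP.≃-sym (ℚP.toℚᵘ-fromℚᵘ (mkℚᵘ (+ c) d)))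
    (ℚᵘ.*≤* (subst₂ ℤ._≤_ (ℤP.pos-* a (suc d)) (ℤP.pos-* c (suc b)) (+≤+ le)))))

∣⊖∣≤ : ∀ a b C → a ≤ b + C → b ≤ a + C → ℤ.∣ a ℤ.⊖ b ∣ ≤ C
∣⊖∣≤ a b C p q with ≤-total a b
... | inj₁ l = ≤-trans (≤-reflexive (ℤP.∣⊖∣-≤ l)) (m≤n+o⇒m∸n≤o b a q)
... | inj₂ l = ≤-trans (≤-reflexive (trans (ℤP.∣m⊖n∣≡∣n⊖m∣ a b) (ℤP.∣⊖∣-≤ l))) (m≤n+o⇒m∸n≤o a b p)

-- The numerator of the difference is at most C in absolute value, so the distance is at most C / n.
-- This is less than the reciprocal of the denominator of ε, which is at most ε because its
-- numerator is at least 1.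
fraction-close : ∀ m n a b C (nn : NonZero n) (nb : NonZero b) (ε : ℚ) → 0ℚ <ℚ ε →
                 m * b ≤ a * n + C → a * n ≤ m * b + C → C * ℚ.↧ₙ ε < n →
                 ∣ ((+ m) / n) {{nn}} - ((+ a) / b) {{nb}} ∣ <ℚ ε
fraction-close m (suc n) a (suc b) C _ _ (mkℚ (+ zero) q _) (*<* (+<+ ())) u l big
fraction-close m (suc n) a (suc b) C _ _ (mkℚ (-[1+ p ]) q _) (*<* ()) u l big
fraction-close m (suc n) a (suc b) C _ _ ε@(mkℚ (+[1+ p ]) q _) _ u l big =
  ℚP.toℚᵘ-cancel-< (ℚᵘP.<-respˡ-≃ (ℚᵘP.≃-sym norm) (ℚᵘ.*<* num-ℤ<))
  where
  x = (+ m) / suc n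
  y = (+ a) / suc b
  X = mkℚᵘ (+ m) n
  Y = mkℚᵘ (+ a) b
  norm : toℚᵘ ∣ x - y ∣ ℚᵘ.≃ ℚᵘ.∣ X ℚᵘ.- Y ∣
  norm = ℚᵘP.≃-trans (ℚP.toℚᵘ-homo-∣-∣ (x - y)) (ℚᵘP.∣-∣-cong (ℚᵘP.≃-trans (ℚP.toℚᵘ-homo-+ x (ℚ.- y))
    (ℚᵘP.+-cong (ℚP.toℚᵘ-fromℚᵘ X) (ℚᵘP.≃-trans (ℚP.toℚᵘ-homo‿- y) (ℚᵘP.-‿cong (ℚP.toℚᵘ-fromℚᵘ Y))))))
  num = + m ℤ.* + suc b ℤ.+ (ℤ.- (+ a)) ℤ.* + suc n
  num≡ : num ≡ (m * suc b) ℤ.⊖ (a * suc n)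
  num≡ = trans (cong₂ ℤ._+_ (sym (ℤP.pos-* m (suc b))) (trans (sym (ℤP.neg-distribˡ-* (+ a) (+ suc n))) (cong ℤ.-_ (sym (ℤP.pos-* a (suc n))))))
               (ℤP.m-n≡m⊖n (m * suc b) (a * suc n))
  num≤ : ℤ.∣ num ∣ ≤ C
  num≤ = subst (λ z → ℤ.∣ z ∣ ≤ C) (sym num≡) (∣⊖∣≤ (m * suc b) (a * suc n) C u l)
  num-ℕ< : ℤ.∣ num ∣ * suc q < suc p * (suc n * suc b)
  num-ℕ< = begin-strict
    ℤ.∣ num ∣ * suc q ≤⟨ *-monoˡ-≤ (suc q) num≤ ⟩
    C * suc q <⟨ big ⟩
    suc n ≤⟨ m≤m*n (suc n) (suc b) ⟩
    suc n * suc b ≤⟨ m≤n*m (suc n * suc b) (suc p) ⟩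
    suc p * (suc n * suc b) ∎
    where open ≤-Reasoning
  num-ℤ< : + ℤ.∣ num ∣ ℤ.* + suc q ℤ.< +[1+ p ] ℤ.* (+ suc n ℤ.* + suc b)
  num-ℤ< = subst₂ ℤ._<_ (ℤP.pos-* ℤ.∣ num ∣ (suc q)) (trans (ℤP.pos-* (suc p) (suc n * suc b)) (cong (+[1+ p ] ℤ.*_) (ℤP.pos-* (suc n) (suc b)))) (+<+ num-ℕ<)

optimalCycle⇒theorem : (k : ℕ) → 1 ≤ k → ∀ {N} → OptimalCycle k N →
    Σ ℕ λ f → Σ (ℕ → ℕ) λ π → Σ ℕ λ K → Σ (NonZero f) λ nz →
    InT k π × IsK k f π K
    × (∀ f' π' K' → (nz' : NonZero f') → InT k π' → IsK k f' π' K' →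
    ((+ K') / f') {{nz'}} ≤ℚ ((+ K) / f) {{nz}})
    × (∀ (ε : ℚ) → 0ℚ <ℚ ε → Σ ℕ λ N → ∀ n m → N ≤ n → 2 ≤ n → (nzn : NonZero n) → IsM k n m →
    ∣ ((+ m) / n) {{nzn}} - ((+ K) / f) {{nz}} ∣ <ℚ ε)
optimalCycle⇒theorem k 1≤k {N} cycle = f , π , K , nz , walk⇒InT 1≤k walk-u , (attained , λ Ps adm → maximal Ps adm) , optimal , limit
  where
  open OptimalCycle cycle
  L = tot (levelKStep k)
  π = run id u
  f = tot isFall v
  K = L v
  nz : NonZero f
  nz = >-nonZero falls>0
  attained : Σ (List Piece) λ Ps → AdmissiblePattern k f π Ps × levelK k Ps ≡ K
  attained = pieces {k} π v , closed⇒admissible 1≤k walk-u cycle-v falls>0 ,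
    trans (levelK-tot k (pieces {k} π v)) (cong L (map-step-pieces {k} π v))
  ratio≤ : ∀ {f′ π′} Ps → InT k π′ → AdmissiblePattern k f′ π′ Ps → levelK k Ps * f ≤ K * f′
  ratio≤ {f′} Ps inT adm = let (u′ , w′ , e) = InT⇒walk inT in subst₂ (λ a b → a * f ≤ K * b) (sym (levelK-tot k Ps))
          (trans (sym (falls-tot Ps)) (proj₂ (proj₂ (proj₂ (proj₂ (proj₂ adm))))))
          (best w′ (admissible⇒closed e adm))
  maximal : ∀ Ps → AdmissiblePattern k f π Ps → levelK k Ps ≤ K
  maximal Ps adm = *-cancelʳ-≤ (levelK k Ps) K f {{nz}} (ratio≤ Ps (walk⇒InT 1≤k walk-u) adm)
  optimal : ∀ f' π' K' → (nz' : NonZero f') → InT k π' → IsK k f' π' K' → ((+ K') / f') {{nz'}} ≤ℚ ((+ K) / f) {{nz}}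
  optimal f' π' K' nz' inT ((Ps , adm , e) , _) = fraction-≤ K' f' K f nz' nz (subst (λ z → z * f ≤ K * f') e (ratio≤ Ps inT adm))
  -- Reaching the cycle costs the falls of `u`, and 2k levels must remain at the end; the other
  -- wires pay for rounds of the cycle. In `C`, the first term stands for the steps that survive
  -- loop erasure, the second for the offset and one unfinished round.
  offset = k + k + tot isFall u
  C = N * f + K * (offset + f)
  upper : ∀ n m → IsM k n m → m * f ≤ K * n + C
  upper n m ((w , red , refl) , _) = let (x , walk-x , more , few) = reduced-word⇒walk 1≤k red in begin
    occ k w * f ≤⟨ *-monoˡ-≤ f more ⟩
    L x * f ≤⟨ bounded walk-x ⟩
    N * f + K * tot isFall x ≤⟨ +-monoʳ-≤ (N * f) (*-monoʳ-≤ K few) ⟩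
    N * f + K * n ≡⟨ +-comm (N * f) (K * n) ⟩
    K * n + N * f ≤⟨ +-monoʳ-≤ (K * n) (m≤m+n (N * f) _) ⟩
    K * n + C ∎
    where open ≤-Reasoning
  lower-bound : ∀ n m → IsM k n m → K * n ≤ m * f + C
  lower-bound n m (_ , mx) = ≤-trans (go (≤-total n offset)) (+-monoʳ-≤ (m * f) (m≤n+m (K * (offset + f)) (N * f)))
    where
    open ≤-Reasoning
    go : n ≤ offset ⊎ offset ≤ n → K * n ≤ m * f + K * (offset + f)
    go (inj₁ le) = ≤-trans (*-monoʳ-≤ K (≤-trans le (m≤m+n offset f))) (m≤n+m _ (m * f))
    go (inj₂ le) = repeated (walk⇒reduced-word {k} {n} {u ++ repeat r v} 1≤k (Walk-++ walk-u (Walk-repeat r (proj₁ cycle-v) (proj₁ (proj₂ cycle-v)))) room)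
      where
      r = DivMod._/_ (n ∸ offset) f {{nz}}
      room : k + k + tot isFall (u ++ repeat r v) ≤ n
      room = begin
        k + k + tot isFall (u ++ repeat r v) ≡⟨ cong (λ z → k + k + z) (tot-++ isFall u (repeat r v)) ⟩
        k + k + (tot isFall u + tot isFall (repeat r v)) ≡⟨ +-assoc (k + k) (tot isFall u) (tot isFall (repeat r v)) ⟨
        offset + tot isFall (repeat r v) ≡⟨ cong (λ z → offset + z) (tot-repeat isFall r v) ⟩
        offset + r * f ≤⟨ +-monoʳ-≤ offset (m/n*n≤m (n ∸ offset) f {{nz}}) ⟩
        offset + (n ∸ offset) ≡⟨ m+[n∸m]≡n le ⟩
        n ∎
      n≤ : n ≤ r * f + (offset + f)
      n≤ = begin
        n ≡⟨ m+[n∸m]≡n le ⟨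
        offset + (n ∸ offset) ≡⟨ cong (λ z → offset + z) (m≡m%n+[m/n]*n (n ∸ offset) f {{nz}}) ⟩
        offset + (DivMod._%_ (n ∸ offset) f {{nz}} + r * f) ≤⟨ +-monoʳ-≤ offset (+-monoˡ-≤ (r * f) (<⇒≤ (m%n<n (n ∸ offset) f {{nz}}))) ⟩
        offset + (f + r * f) ≡⟨ +-assoc offset f (r * f) ⟨
        offset + f + r * f ≡⟨ +-comm (offset + f) (r * f) ⟩
        r * f + (offset + f) ∎
      repeated : (∃ λ w → IsReducedWordW0 n w × L (u ++ repeat r v) ≤ occ k w) → K * n ≤ m * f + K * (offset + f)
      repeated (w , red , more) = begin
        K * n ≤⟨ *-monoʳ-≤ K n≤ ⟩
        K * (r * f + (offset + f)) ≡⟨ *-distribˡ-+ K (r * f) (offset + f) ⟩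
        K * (r * f) + K * (offset + f) ≡⟨ cong (λ z → z + K * (offset + f)) (trans (sym (*-assoc K r f)) (cong (_* f) (*-comm K r))) ⟩
        r * K * f + K * (offset + f) ≤⟨ +-monoˡ-≤ (K * (offset + f)) (*-monoˡ-≤ f rK≤m) ⟩
        m * f + K * (offset + f) ∎
        where
        rK≤m : r * K ≤ m
        rK≤m = begin
          r * K ≡⟨ tot-repeat (levelKStep k) r v ⟨
          L (repeat r v) ≤⟨ m≤n+m (L (repeat r v)) (L u) ⟩
          L u + L (repeat r v) ≡⟨ tot-++ (levelKStep k) u (repeat r v) ⟨
          L (u ++ repeat r v) ≤⟨ more ⟩
          occ k w ≤⟨ mx w red ⟩
          m ∎
  limit : ∀ (ε : ℚ) → 0ℚ <ℚ ε → Σ ℕ λ N → ∀ n m → N ≤ n → 2 ≤ n → (nzn : NonZero n) → IsM k n m →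
          ∣ ((+ m) / n) {{nzn}} - ((+ K) / f) {{nz}} ∣ <ℚ ε
  limit ε pos = suc (C * ℚ.↧ₙ ε) , λ n m big _ nzn isM → fraction-close m n K f C nzn nz ε pos (upper n m isM) (lower-bound n m isM) big

theorem4p16 : (k : ℕ) → 1 ≤ k →
    Σ ℕ λ f → Σ (ℕ → ℕ) λ π → Σ ℕ λ K → Σ (NonZero f) λ nz →
    InT k π × IsK k f π K
    × (∀ f' π' K' → (nz' : NonZero f') → InT k π' → IsK k f' π' K' →
    ((+ K') / f') {{nz'}} ≤ℚ ((+ K) / f) {{nz}})
    × (∀ (ε : ℚ) → 0ℚ <ℚ ε → Σ ℕ λ N → ∀ n m → N ≤ n → 2 ≤ n → (nzn : NonZero n) → IsM k n m →
    ∣ ((+ m) / n) {{nzn}} - ((+ K) / f) {{nz}} ∣ <ℚ ε)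
theorem4p16 k 1≤k = optimalCycle⇒theorem k 1≤k (Coding.optimalCycle k 1≤k)
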